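{- The exponential generating function $F_2(x,y)$ of connected bipartite graphs with Betti number $2$ is expressed as $F_2 = f_2(Z,W)$ with \[ f_2(z,w) = \frac{w^2}{24(1-w)^3} \big\{ (2+3w)z + 2w(6-w) \big\}. \]
   Context: For integers $r,s\ge 0$ and $k$, $N_{\rm bi}(r,s,k)$ is the number of connected bipartite simple graphs with labeled bipartition $V_1\sqcup V_2$, $|V_1|=r$, $|V_2|=s$, having exactly $r+s+k-1$ edges; equivalently, the number of connected spanning subgraphs of the complete bipartite graph $K_{r,s}$ with $r+s+k-1$ edges (so the Betti number is $k$). Conventions: if $rs=0$, then $N_{\rm bi}(r,s,k)=1$ if $k=0$ and $(r,s)\in\{(1,0),(0,1)\}$, and $0$ otherwise. It is known that $N_{\rm bi}(r,s,0)=r^{s-1}s^{r-1}$ for $r,s\ge1$. For $k\ge 0$ let $F_k(x,y) = \sum_{r,s=0}^{\infty} \frac{N_{\rm bi}(r,s,k)}{r!s!}x^r y^s$ (formal power series), and put $T:=F_0$. With the Euler operators $D_x=x\partial_x$, $D_y=y\partial_y$, put $T_x = D_xT$, $T_y=D_yT$, $Z=T_x+T_y$, $W=T_xT_y$. (Subscripts $x,y$ denote application of $D_x,D_y$, not ordinary partial derivatives.) -}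

module Defs where

open import Data.Fin.Base as Fin using (Fin; toℕ)
open import Data.Fin.Properties as Finₚ using (all?)
open import Data.Fin.Subset using (Subset; inside; outside; _∈_; ∣_∣)
open import Data.Fin.Subset.Properties using (_∈?_)
open import Data.Integer.Base as ℤ using ()
open import Data.List.Base as List
  using (List; []; _∷_; _++_; length; filter; allFin; cartesianProductWith)
open import Data.List.Membership.Propositional using () renaming (_∈_ to _∈ₗ_)
open import Data.List.Membership.Propositional.Properties
  using (∈-++⁺ˡ; ∈-++⁺ʳ; ∈-map⁺; ∈-allFin)
open import Data.List.Relation.Unary.Any using (here; there)
open import Data.Nat.Base as ℕ using (ℕ; zero; suc; _∸_; _!; z≤n; s≤s)
open import Data.Nat.Properties as ℕₚ using (_!≢0; m*n≢0)
open import Data.Product.Base using (_×_; _,_)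
open import Data.Rational.Base as ℚ using (ℚ; 0ℚ; 1ℚ; _/_)
open import Data.Rational.Properties as ℚₚ using (+-*-commutativeRing)
open import Data.Sum.Base using (_⊎_; inj₁; inj₂)
open import Data.Sum.Properties using (≡-dec)
open import Data.Vec.Base as Vec using (Vec; lookup)
open import Algebra.Bundles using (CommutativeRing)
open import Function.Base using (_∘_)
open import Relation.Binary.Core using (Rel)
open import Relation.Binary.Definitions using (Decidable; DecidableEquality)
open import Relation.Binary.Construct.Closure.ReflexiveTransitive
  using (Star; ε; _◅_; _◅◅_)
open import Relation.Binary.PropositionalEquality
open import Relation.Nullary.Decidable
  using (Dec; yes; no; map′; _×-dec_; _⊎-dec_)
import Algebra.Properties.Semiring.Sum as SemiringSum
open import Level using (0ℓ)

open SemiringSum (CommutativeRing.semiring +-*-commutativeRing)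
  using (sum-syntax; sum⁺-syntax; sum-cong-≗; sum-replicate-zero;
         ∑-distrib-+; ∑-comm; *-distribˡ-sum)

-- The i-th row is the set of neighbours in V₂ of the i-th vertex of V₁, so
-- a graph is an arbitrary set of edges of K_{r,s}.
Graph : ℕ → ℕ → Set
Graph r s = Vec (Subset s) r

Vertex : ℕ → ℕ → Set
Vertex r s = Fin r ⊎ Fin s

data Adj {r s} (g : Graph r s) : Rel (Vertex r s) 0ℓ where
  forth : ∀ {i j} → j ∈ lookup g i → Adj g (inj₁ i) (inj₂ j)
  back  : ∀ {i j} → j ∈ lookup g i → Adj g (inj₂ j) (inj₁ i)

Connected : ∀ {r s} → Graph r s → Set
Connected g = ∀ u v → Star (Adj g) u v

edgeCount : ∀ {r s} → Graph r s → ℕ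
edgeCount g = Vec.sum (Vec.map ∣_∣ g)

-- Connectedness is decided by Warshall's algorithm.
module _ {A : Set} (_≟_ : DecidableEquality A)
         {R : Rel A 0ℓ} (R? : Decidable R) where

  -- Reachability by walks whose interior vertices lie in the given list.
  Via : List A → Rel A 0ℓ
  Via []       u v = u ≡ v ⊎ R u v
  Via (x ∷ xs) u v = Via xs u v ⊎ (Via xs u x × Via xs x v)

  via? : ∀ xs → Decidable (Via xs)
  via? []       u v = (u ≟ v) ⊎-dec R? u v
  via? (x ∷ xs) u v = via? xs u v ⊎-dec (via? xs u x ×-dec via? xs x v)

  via⇒star : ∀ xs {u v} → Via xs u v → Star R u v
  via⇒star []       (inj₁ refl)    = ε
  via⇒star []       (inj₂ e)       = e ◅ ε
  via⇒star (x ∷ xs) (inj₁ p)       = via⇒star xs p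
  via⇒star (x ∷ xs) (inj₂ (p , q)) = via⇒star xs p ◅◅ via⇒star xs q

  via-base : ∀ xs {u v} → Via [] u v → Via xs u v
  via-base []       p = p
  via-base (x ∷ xs) p = inj₁ (via-base xs p)

  via-trans : ∀ xs {u w v} → w ∈ₗ xs → Via xs u w → Via xs w v → Via xs u v
  via-trans (x ∷ xs) (here refl) p q = inj₂ (to p , from q)
    where
    to : ∀ {u} → Via (x ∷ xs) u x → Via xs u x
    to (inj₁ p)       = p
    to (inj₂ (p , _)) = p
    from : ∀ {v} → Via (x ∷ xs) x v → Via xs x v
    from (inj₁ q)       = q
    from (inj₂ (_ , q)) = q
  via-trans (x ∷ xs) (there m) (inj₁ p) (inj₁ q) = inj₁ (via-trans xs m p q)
  via-trans (x ∷ xs) (there m) (inj₁ p) (inj₂ (q , q′)) =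
    inj₂ (via-trans xs m p q , q′)
  via-trans (x ∷ xs) (there m) (inj₂ (p , p′)) (inj₁ q) =
    inj₂ (p , via-trans xs m p′ q)
  via-trans (x ∷ xs) (there m) (inj₂ (p , _)) (inj₂ (_ , q)) = inj₂ (p , q)

  star? : ∀ xs → (∀ x → x ∈ₗ xs) → Decidable (Star R)
  star? xs full u v = map′ (via⇒star xs) star⇒via (via? xs u v)
    where
    star⇒via : ∀ {u v} → Star R u v → Via xs u v
    star⇒via ε       = via-base xs (inj₁ refl)
    star⇒via (e ◅ p) =
      via-trans xs (full _) (via-base xs (inj₂ e)) (star⇒via p)

vertices : ∀ r s → List (Vertex r s)
vertices r s = List.map inj₁ (allFin r) ++ List.map inj₂ (allFin s)

∈-vertices : ∀ {r s} (v : Vertex r s) → v ∈ₗ vertices r s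
∈-vertices (inj₁ i) = ∈-++⁺ˡ (∈-map⁺ inj₁ (∈-allFin i))
∈-vertices (inj₂ j) = ∈-++⁺ʳ _ (∈-map⁺ inj₂ (∈-allFin j))

adj? : ∀ {r s} (g : Graph r s) → Decidable (Adj g)
adj? g (inj₁ i) (inj₂ j) = map′ forth (λ { (forth p) → p }) (j ∈? lookup g i)
adj? g (inj₂ j) (inj₁ i) = map′ back (λ { (back p) → p }) (j ∈? lookup g i)
adj? g (inj₁ _) (inj₁ _) = no λ ()
adj? g (inj₂ _) (inj₂ _) = no λ ()

connected? : ∀ {r s} (g : Graph r s) → Dec (Connected g)
connected? {r} {s} g =
  map′ (λ (p , q) → λ { (inj₁ i) → p i ; (inj₂ j) → q j })
       (λ c → (c ∘ inj₁) , (c ∘ inj₂))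
       (all? (from? ∘ inj₁) ×-dec all? (from? ∘ inj₂))
  where
  walk? : Decidable (Star (Adj g))
  walk? = star? (≡-dec Finₚ._≟_ Finₚ._≟_) (adj? g) (vertices r s) ∈-vertices

  from? : ∀ u → Dec (∀ v → Star (Adj g) u v)
  from? u =
    map′ (λ (p , q) → λ { (inj₁ i) → p i ; (inj₂ j) → q j })
         (λ c → (c ∘ inj₁) , (c ∘ inj₂))
         (all? (walk? u ∘ inj₁) ×-dec all? (walk? u ∘ inj₂))

allVecs : ∀ {A : Set} → List A → ∀ n → List (Vec A n)
allVecs as zero    = Vec.[] ∷ []
allVecs as (suc n) = cartesianProductWith Vec._∷_ as (allVecs as n)

-- Every graph occurs exactly once.
allGraphs : ∀ r s → List (Graph r s)
allGraphs r s = allVecs (allVecs (inside ∷ outside ∷ []) s) r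

-- e = r + s + k - 1 is written e + 1 = r + s + k, avoiding truncated
-- subtraction.
IsConnectedOfBetti : ∀ {r s} → ℕ → Graph r s → Set
IsConnectedOfBetti {r} {s} k g =
  Connected g × edgeCount g ℕ.+ 1 ≡ r ℕ.+ s ℕ.+ k

isConnectedOfBetti? : ∀ {r s} k (g : Graph r s) →
                      Dec (IsConnectedOfBetti k g)
isConnectedOfBetti? k g = connected? g ×-dec (_ ℕₚ.≟ _)

Nbi : ℕ → ℕ → ℕ → ℕ
Nbi r@(suc _) s@(suc _) k =
  length (filter (isConnectedOfBetti? k) (allGraphs r s))
Nbi 1 0 0 = 1
Nbi 0 1 0 = 1
Nbi _ _ _ = 0

-- A i j is the coefficient of xⁱyʲ.
PowerSeries : Set
PowerSeries = ℕ → ℕ → ℚ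

infix  4 _≈_
infixl 6 _+_ _-_
infixl 7 _·_
infixr 8 _^_

_≈_ : Rel PowerSeries 0ℓ
A ≈ B = ∀ i j → A i j ≡ B i j

const : ℚ → PowerSeries
const c zero    zero    = c
const c zero    (suc _) = 0ℚ
const c (suc _) _       = 0ℚ

_+_ _-_ _·_ : PowerSeries → PowerSeries → PowerSeries
(A + B) i j = A i j ℚ.+ B i j
(A - B) i j = A i j ℚ.- B i j
-- ∑[ a ≤ i ] is the library's sum over a : Fin (suc i).
(A · B) i j =
  ∑[ a ≤ i ] ∑[ b ≤ j ]
    (A (toℕ a) (toℕ b) ℚ.* B (i ∸ toℕ a) (j ∸ toℕ b))

_^_ : PowerSeries → ℕ → PowerSeries
A ^ zero  = const 1ℚ
A ^ suc n = A · A ^ n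

Dx Dy : PowerSeries → PowerSeries
Dx A i j = (ℤ.+ i / 1) ℚ.* A i j
Dy A i j = (ℤ.+ j / 1) ℚ.* A i j

-- The geometric series ∑ₙ Uⁿ, meaningful when U has zero constant term: Uⁿ
-- then has no terms of total degree below n, so the coefficient of xⁱyʲ
-- only involves n ≤ i + j.  `1/[1-]-inverse` below shows that it inverts
-- 1 - U.
1/[1-_] : PowerSeries → PowerSeries
1/[1- U ] i j = ∑[ n ≤ i ℕ.+ j ] (U ^ toℕ n) i j

F : ℕ → PowerSeries
F k r s = ℤ.+ Nbi r s k / (r ! ℕ.* s !)
  where instance _ = m*n≢0 (r !) (s !) {{r !≢0}} {{s !≢0}}

T Tx Ty Z W : PowerSeries
T  = F 0
Tx = Dx T
Ty = Dy T
Z  = Tx + Ty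
W  = Tx · Ty

-- The value of the rational function at power series z and w, where w has
-- zero constant term (as W has).
f₂ : PowerSeries → PowerSeries → PowerSeries
f₂ z w =
  const (ℤ.+ 1 / 24) · w ^ 2 · 1/[1- w ] ^ 3
    · ((‵ 2 + ‵ 3 · w) · z + ‵ 2 · w · (‵ 6 - w))
  where
  ‵_ : ℕ → PowerSeries
  ‵ n = const (ℤ.+ n / 1)
  infix 9 ‵_

sum-zero : ∀ n (f : Fin n → ℚ) → (∀ a → f a ≡ 0ℚ) → ∑[ a < n ] f a ≡ 0ℚ
sum-zero n f eq =
  trans (sum-cong-≗ {n} {f} {λ _ → 0ℚ} eq) (sum-replicate-zero n)

sum-extend : ∀ {m n} (f : ℕ → ℚ) → m ℕ.≤ n →
             (∀ k → m ℕ.≤ k → f k ≡ 0ℚ) →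
             ∑[ a < n ] f (toℕ a) ≡ ∑[ a < m ] f (toℕ a)
sum-extend {n = n} f z≤n       eq = sum-zero n (f ∘ toℕ) (λ a → eq (toℕ a) z≤n)
sum-extend         f (s≤s m≤n) eq =
  cong (f 0 ℚ.+_) (sum-extend (f ∘ suc) m≤n (λ k → eq (suc k) ∘ s≤s))

∑∑-cong : ∀ m n (f g : Fin m → Fin n → ℚ) → (∀ a b → f a b ≡ g a b) →
          ∑[ a < m ] ∑[ b < n ] f a b ≡ ∑[ a < m ] ∑[ b < n ] g a b
∑∑-cong m n f g eq =
  sum-cong-≗ {m} {λ a → ∑[ b < n ] f a b} {λ a → ∑[ b < n ] g a b}
    λ a → sum-cong-≗ {n} {f a} {g a} (eq a)

term : ∀ (A B : PowerSeries) i j → Fin (suc i) → Fin (suc j) → ℚ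
term A B i j a b = A (toℕ a) (toℕ b) ℚ.* B (i ∸ toℕ a) (j ∸ toℕ b)

const-· : ∀ A → const 1ℚ · A ≈ A
const-· A i j = begin
  (const 1ℚ · A) i j          ≡⟨⟩
  (1ℚ ℚ.* A i j ℚ.+ ∑[ b < j ] t Fin.zero (Fin.suc b)) ℚ.+
    ∑[ a < i ] ∑[ b ≤ j ] t (Fin.suc a) b
    ≡⟨ cong₂ ℚ._+_
         (cong₂ ℚ._+_ (ℚₚ.*-identityˡ (A i j))
           (sum-zero j (λ b → t Fin.zero (Fin.suc b))
             (λ b → ℚₚ.*-zeroˡ (A i (j ∸ suc (toℕ b))))))
         (sum-zero i (λ a → ∑[ b ≤ j ] t (Fin.suc a) b)
           (λ a → sum-zero (suc j) (t (Fin.suc a))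
             (λ b → ℚₚ.*-zeroˡ (A (i ∸ suc (toℕ a)) (j ∸ toℕ b))))) ⟩
  (A i j ℚ.+ 0ℚ) ℚ.+ 0ℚ       ≡⟨ ℚₚ.+-identityʳ (A i j ℚ.+ 0ℚ) ⟩
  A i j ℚ.+ 0ℚ                ≡⟨ ℚₚ.+-identityʳ (A i j) ⟩
  A i j                       ∎
  where
  open ≡-Reasoning
  t = term (const 1ℚ) A i j

·-distribʳ-+ : ∀ A B C → (A + B) · C ≈ A · C + B · C
·-distribʳ-+ A B C i j = begin
  ∑[ a ≤ i ] ∑[ b ≤ j ] term (A + B) C i j a b
    ≡⟨ ∑∑-cong (suc i) (suc j) (term (A + B) C i j)
         (λ a b → term A C i j a b ℚ.+ term B C i j a b)
         (λ a b → ℚₚ.*-distribʳ-+ (C (i ∸ toℕ a) (j ∸ toℕ b))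
                    (A (toℕ a) (toℕ b)) (B (toℕ a) (toℕ b))) ⟩
  ∑[ a ≤ i ] ∑[ b ≤ j ] (term A C i j a b ℚ.+ term B C i j a b)
    ≡⟨ sum-cong-≗ {suc i}
         {λ a → ∑[ b ≤ j ] (term A C i j a b ℚ.+ term B C i j a b)}
         {λ a → ∑[ b ≤ j ] term A C i j a b ℚ.+ ∑[ b ≤ j ] term B C i j a b}
         (λ a → ∑-distrib-+ {suc j} (term A C i j a) (term B C i j a)) ⟩
  ∑[ a ≤ i ] (∑[ b ≤ j ] term A C i j a b ℚ.+ ∑[ b ≤ j ] term B C i j a b)
    ≡⟨ ∑-distrib-+ {suc i} (λ a → ∑[ b ≤ j ] term A C i j a b)
         (λ a → ∑[ b ≤ j ] term B C i j a b) ⟩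
  (A · C + B · C) i j ∎
  where open ≡-Reasoning

x+y-y≡x : ∀ x y → (x ℚ.+ y) ℚ.- y ≡ x
x+y-y≡x x y = trans (ℚₚ.+-assoc x y (ℚ.- y))
  (trans (cong (x ℚ.+_) (ℚₚ.+-inverseʳ y)) (ℚₚ.+-identityʳ x))

x-y+y≡x : ∀ x y → (x ℚ.- y) ℚ.+ y ≡ x
x-y+y≡x x y = trans (ℚₚ.+-assoc x (ℚ.- y) y)
  (trans (cong (x ℚ.+_) (ℚₚ.+-inverseˡ y)) (ℚₚ.+-identityʳ x))

·-distribʳ-- : ∀ A B C → (A - B) · C ≈ A · C - B · C
·-distribʳ-- A B C i j = begin
  ((A - B) · C) i j
    ≡⟨ x+y-y≡x (((A - B) · C) i j) ((B · C) i j) ⟨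
  ((A - B) · C + B · C) i j ℚ.- (B · C) i j
    ≡⟨ cong (ℚ._- (B · C) i j) (·-distribʳ-+ (A - B) B C i j) ⟨
  (((A - B) + B) · C) i j ℚ.- (B · C) i j
    ≡⟨ cong (ℚ._- (B · C) i j)
         (∑∑-cong (suc i) (suc j) (term ((A - B) + B) C i j) (term A C i j)
           λ a b → cong (ℚ._* C (i ∸ toℕ a) (j ∸ toℕ b))
             (x-y+y≡x (A (toℕ a) (toℕ b)) (B (toℕ a) (toℕ b)))) ⟩
  (A · C) i j ℚ.- (B · C) i j ∎
  where open ≡-Reasoning

·-sum : ∀ N A (B : ℕ → PowerSeries) i j →
        (A · (λ p q → ∑[ n < N ] B (toℕ n) p q)) i j ≡
        ∑[ n < N ] (A · B (toℕ n)) i j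
·-sum N A B i j = begin
  ∑[ a ≤ i ] ∑[ b ≤ j ] term A (λ p q → ∑[ n < N ] B (toℕ n) p q) i j a b
    ≡⟨ ∑∑-cong (suc i) (suc j)
         (term A (λ p q → ∑[ n < N ] B (toℕ n) p q) i j)
         (λ a b → ∑[ n < N ] t a b n)
         (λ a b → *-distribˡ-sum {N} (A (toℕ a) (toℕ b))
           (λ n → B (toℕ n) (i ∸ toℕ a) (j ∸ toℕ b))) ⟩
  ∑[ a ≤ i ] ∑[ b ≤ j ] ∑[ n < N ] t a b n
    ≡⟨ sum-cong-≗ {suc i} {λ a → ∑[ b ≤ j ] ∑[ n < N ] t a b n}
         {λ a → ∑[ n < N ] ∑[ b ≤ j ] t a b n}
         (λ a → ∑-comm {suc j} {N} (t a)) ⟩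
  ∑[ a ≤ i ] ∑[ n < N ] ∑[ b ≤ j ] t a b n
    ≡⟨ ∑-comm {suc i} {N} (λ a n → ∑[ b ≤ j ] t a b n) ⟩
  ∑[ n < N ] ∑[ a ≤ i ] ∑[ b ≤ j ] t a b n ∎
  where
  open ≡-Reasoning
  t : Fin (suc i) → Fin (suc j) → Fin N → ℚ
  t a b n = term A (B (toℕ n)) i j a b

module _ (U : PowerSeries) (U₀₀≡0 : U 0 0 ≡ 0ℚ) where

  ^-vanishes : ∀ n i j → i ℕ.+ j ℕ.< n → (U ^ n) i j ≡ 0ℚ
  ^-vanishes (suc n) i j (s≤s i+j≤n) =
    sum-zero (suc i) (λ a → ∑[ b ≤ j ] term U (U ^ n) i j a b) λ a →
      sum-zero (suc j) (term U (U ^ n) i j a) λ b → vanishes a b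
    where
    times-zero : ∀ x {y} → y ≡ 0ℚ → x ℚ.* y ≡ 0ℚ
    times-zero x refl = ℚₚ.*-zeroʳ x

    vanishes : ∀ a b → term U (U ^ n) i j a b ≡ 0ℚ
    vanishes Fin.zero Fin.zero =
      trans (cong (ℚ._* (U ^ n) i j) U₀₀≡0) (ℚₚ.*-zeroˡ ((U ^ n) i j))
    vanishes Fin.zero b@(Fin.suc {suc j′} b′) = times-zero (U 0 (toℕ b))
      (^-vanishes n i (j′ ∸ toℕ b′) (ℕₚ.<-≤-trans
        (ℕₚ.+-monoʳ-< i (s≤s (ℕₚ.m∸n≤m j′ (toℕ b′)))) i+j≤n))
    vanishes a@(Fin.suc {suc i′} a′) b = times-zero (U (toℕ a) (toℕ b))
      (^-vanishes n (i′ ∸ toℕ a′) (j ∸ toℕ b) (ℕₚ.<-≤-trans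
        (ℕₚ.+-mono-<-≤ (s≤s (ℕₚ.m∸n≤m i′ (toℕ a′))) (ℕₚ.m∸n≤m j (toℕ b)))
        i+j≤n))

  1/[1-]-inverse : (const 1ℚ - U) · 1/[1- U ] ≈ const 1ℚ
  1/[1-]-inverse i j = begin
    ((const 1ℚ - U) · G) i j         ≡⟨ ·-distribʳ-- (const 1ℚ) U G i j ⟩
    (const 1ℚ · G) i j ℚ.- (U · G) i j
      ≡⟨ cong (ℚ._- (U · G) i j) (trans (const-· G i j) G≡1+UG) ⟩
    (const 1ℚ i j ℚ.+ (U · G) i j) ℚ.- (U · G) i j
      ≡⟨ x+y-y≡x (const 1ℚ i j) ((U · G) i j) ⟩
    const 1ℚ i j                     ∎
    where
    open ≡-Reasoning
    G = 1/[1- U ]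
    N = suc (i ℕ.+ j)
    Gₙ : PowerSeries
    Gₙ p q = ∑[ n < N ] (U ^ toℕ n) p q

    truncate : ∀ M p q → p ℕ.+ q ℕ.< M →
               ∑[ n < M ] (U ^ toℕ n) p q ≡ G p q
    truncate M p q p+q<M =
      sum-extend (λ n → (U ^ n) p q) p+q<M (λ n → ^-vanishes n p q)

    G≡1+UG : G i j ≡ const 1ℚ i j ℚ.+ (U · G) i j
    G≡1+UG = begin
      G i j
        ≡⟨ truncate (suc N) i j (ℕₚ.m≤n⇒m≤1+n ℕₚ.≤-refl) ⟨
      const 1ℚ i j ℚ.+ ∑[ n < N ] (U · U ^ toℕ n) i j
        ≡⟨ cong (const 1ℚ i j ℚ.+_) (·-sum N U (U ^_) i j) ⟨
      const 1ℚ i j ℚ.+ (U · Gₙ) i j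
        ≡⟨ cong (const 1ℚ i j ℚ.+_)
             (∑∑-cong (suc i) (suc j) (term U Gₙ i j) (term U G i j)
               λ a b → cong (U (toℕ a) (toℕ b) ℚ.*_)
                 (truncate N (i ∸ toℕ a) (j ∸ toℕ b)
                   (s≤s (ℕₚ.+-mono-≤ (ℕₚ.m∸n≤m i (toℕ a))
                                     (ℕₚ.m∸n≤m j (toℕ b)))))) ⟩
      const 1ℚ i j ℚ.+ (U · G) i j ∎

W₀₀≡0 : W 0 0 ≡ 0ℚ
W₀₀≡0 = refl

-- Let u mark edges. The series G of all bipartite graphs has coefficients
-- (1 + u)^(rs), so (1 + u) ∂ᵤ G = Dx (Dy G). Splitting off the component of a
-- vertex of V₁ gives Dx G = Dx C · G for the series C of connected graphs, hence
--   (1 + u) u ∂ᵤ C = u (Dx (Dy C) + Dx C · Dy C).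
-- Sorting coefficients by Betti number turns this into
--   Tx + Ty = T + Tx Ty,
--   (Dx + Dy) F₁ = Dx (Dy T) - Tx - Ty + T + Tx · Dy F₁ + Ty · Dx F₁,
--   (Dx + Dy + 1) F₂ = Dx (Dy F₁) - Dx F₁ - Dy F₁
--                      + Tx · Dy F₂ + Ty · Dx F₂ + Dx F₁ · Dy F₁,
-- and each equation determines its unknown by induction on the degree. Writing
-- a = Tx, b = Ty, w = ab and m = w / (1 - w), one obtains successively
--   Dx a = a (1 + m), Dy b = b (1 + m), Dy a = Dx b = m,
--   2 Dx F₁ = m² (1 + a), 2 Dy F₁ = m² (1 + b),
--   24 F₂ = m² ((2 + 5 m) (a + b) + 10 m + 2 a b).
module Submission where

open import Algebra.Bundles using (CommutativeRing)
import Algebra.Properties.AbelianGroup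
import Algebra.Properties.Ring
import Algebra.Properties.Semiring.Exp
import Algebra.Properties.Semiring.Mult
import Algebra.Properties.Semiring.Mult.TCOptimised
import Algebra.Properties.Semiring.Sum
import Algebra.Solver.Ring
import Algebra.Solver.Ring.AlmostCommutativeRing as ACR
open import Data.Bool.Base using (true; false; if_then_else_)
import Data.Bool.Properties as Boolₚ
open import Data.Fin.Base as Fin using (Fin; zero; suc; toℕ)
import Data.Fin.Properties as Finₚ
open import Data.Fin.Subset using (Subset; inside; outside; _∈_; _∉_; ∣_∣; ∁)
open import Data.Fin.Subset.Properties
  using (x∈∁p⇒x∉p; x∉∁p⇒x∈p; ⊆-antisym)
import Data.Integer.Base as ℤ
open ℤ using (ℤ; +_; -[1+_]; _⊖_; _◃_)
import Data.Integer.Properties as ℤₚ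
import Data.Integer.Solver
open import Data.List.Base as List
  using (List; []; _∷_; _++_; length; filter; cartesianProductWith)
import Data.List.Properties as Listₚ
import Data.List.Relation.Unary.All as All
open import Data.Maybe.Base using (just; nothing)
open import Data.Nat.Base as ℕ using (ℕ; zero; suc; _∸_; _!; z≤n; s≤s)
import Data.Nat.Properties as ℕₚ
import Data.Nat.Solver
open import Data.Product.Base using (_×_; _,_; proj₁; proj₂; Σ-syntax)
open import Data.Rational.Base as ℚ using (ℚ; 0ℚ; 1ℚ; _/_)
import Data.Rational.Properties as ℚₚ
import Data.Rational.Unnormalised.Base as ℚᵘ
import Data.Rational.Unnormalised.Properties as ℚᵘₚ
import Data.Sign.Base as Sign
open import Data.Sum.Base using (inj₁; inj₂)
open import Data.Sum.Properties using (≡-dec)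
open import Data.Vec.Base as Vec using (Vec; []; _∷_; lookup; here; there; tabulate)
open import Data.Vec.Properties as Vecₚ
  using ([]=⇒lookup; lookup⇒[]=; lookup-map; lookup∘tabulate)
open import Function.Base using (_∘_)
open import Level using (0ℓ; _⊔_)
open import Relation.Binary.Construct.Closure.ReflexiveTransitive
  using (Star; ε; _◅_; _◅◅_; gmap; reverse)
open import Relation.Binary.Definitions using (DecidableEquality; WeaklyDecidable)
import Relation.Binary.PropositionalEquality as ≡
open ≡ using (_≡_)
import Relation.Binary.Reasoning.Setoid
open import Relation.Nullary.Decidable using (Dec; yes; no; does; _×-dec_; dec-true)
open import Relation.Nullary.Negation using (¬_; contradiction)
open import Defs
  using (Graph; Vertex; Adj; forth; back; Connected; connected?; edgeCount;
         star?; adj?; vertices; ∈-vertices; allVecs; allGraphs)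

-- The component decomposition privileges V₁ and yields Dx G = Dx C · G only. The mirror identity
-- for Dy and the equation for C come from one device: a difference that satisfies a homogeneous
-- equation in x and vanishes at x = 0, where C = y and G = exp y. Euler operators preserve degree,
-- while multiplication by a series without constant term raises it. Hence on the lowest part of an
-- unknown Dx + Dy acts as the degree n, and a linear equation fixes every degree in which the
-- resulting integer factor is nonzero. In the equations for F₁ and F₂, and for m after
-- differentiation of the tree equation, the unknown is differentiated only by (1 - b) Dx + (1 - a)
-- Dy, so its two derivatives are not given separately. The equation for m is nonlinear; its closed
-- form is verified because the defect of that form obeys a linear equation. For F₁ the missing
-- second equation is Dy (Dx F₁) = Dx (Dy F₁). For F₂ the candidate is verified through the
-- homogeneous equation of its error.

module RingSolver {c ℓ} (R : CommutativeRing c ℓ) where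

  open CommutativeRing R
  open Algebra.Properties.Semiring.Mult.TCOptimised semiring renaming (_×_ to _×′_)
  open Algebra.Properties.Ring ring
  open Relation.Binary.Reasoning.Setoid setoid

  -- Integer coefficients have decidable equality, so one normaliser serves every series ring. The
  -- optimised multiple makes `⟦ + 1 ⟧ℤ` reduce to `1#`, so that `con (+ 1)` stands for `1#` itself.
  ⟦_⟧ℤ : ℤ → Carrier
  ⟦ + n ⟧ℤ      = n ×′ 1#
  ⟦ -[1+ n ] ⟧ℤ = - (suc n ×′ 1#)

  private
    signed : Sign.Sign → Carrier → Carrier
    signed Sign.+ x = x
    signed Sign.- x = - x

    signed-cong : ∀ s {x y} → x ≈ y → signed s x ≈ signed s y
    signed-cong Sign.+ e = e
    signed-cong Sign.- e = -‿cong e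

    signed-* : ∀ s t x y → signed (s Sign.* t) (x * y) ≈ signed s x * signed t y
    signed-* Sign.+ Sign.+ x y = refl
    signed-* Sign.+ Sign.- x y = -‿distribʳ-* x y
    signed-* Sign.- Sign.+ x y = -‿distribˡ-* x y
    signed-* Sign.- Sign.- x y = begin
      x * y         ≈⟨ -‿involutive (x * y) ⟨
      - - (x * y)   ≈⟨ -‿cong (-‿distribˡ-* x y) ⟩
      - (- x * y)   ≈⟨ -‿distribʳ-* (- x) y ⟩
      - x * - y     ∎

    ◃-homo : ∀ s n → ⟦ s ◃ n ⟧ℤ ≈ signed s (n ×′ 1#)
    ◃-homo Sign.+ zero    = refl
    ◃-homo Sign.- zero    = sym -0#≈0#
    ◃-homo Sign.+ (suc n) = refl
    ◃-homo Sign.- (suc n) = refl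

    signed-abs : ∀ i → signed (ℤ.sign i) (ℤ.∣ i ∣ ×′ 1#) ≈ ⟦ i ⟧ℤ
    signed-abs (+ n)      = refl
    signed-abs -[1+ n ]   = refl

    *-homo : ∀ i j → ⟦ i ℤ.* j ⟧ℤ ≈ ⟦ i ⟧ℤ * ⟦ j ⟧ℤ
    *-homo i j = begin
      ⟦ i ℤ.* j ⟧ℤ
        ≈⟨ ◃-homo (ℤ.sign i Sign.* ℤ.sign j) (ℤ.∣ i ∣ ℕ.* ℤ.∣ j ∣) ⟩
      signed (ℤ.sign i Sign.* ℤ.sign j) ((ℤ.∣ i ∣ ℕ.* ℤ.∣ j ∣) ×′ 1#)
        ≈⟨ signed-cong (ℤ.sign i Sign.* ℤ.sign j) (×1-homo-* ℤ.∣ i ∣ ℤ.∣ j ∣) ⟩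
      signed (ℤ.sign i Sign.* ℤ.sign j) ((ℤ.∣ i ∣ ×′ 1#) * (ℤ.∣ j ∣ ×′ 1#))
        ≈⟨ signed-* (ℤ.sign i) (ℤ.sign j) _ _ ⟩
      signed (ℤ.sign i) (ℤ.∣ i ∣ ×′ 1#) * signed (ℤ.sign j) (ℤ.∣ j ∣ ×′ 1#)
        ≈⟨ *-cong (signed-abs i) (signed-abs j) ⟩
      ⟦ i ⟧ℤ * ⟦ j ⟧ℤ ∎

    cancel-1 : ∀ x y → (1# + x) - (1# + y) ≈ x - y
    cancel-1 x y = begin
      (1# + x) - (1# + y)       ≈⟨ +-cong (+-comm 1# x) (sym (-‿+-comm 1# y)) ⟩
      (x + 1#) + (- 1# + - y)   ≈⟨ +-assoc (x + 1#) (- 1#) (- y) ⟨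
      ((x + 1#) + - 1#) + - y   ≈⟨ +-congʳ (+-assoc x 1# (- 1#)) ⟩
      (x + (1# + - 1#)) + - y   ≈⟨ +-congʳ (+-congˡ (-‿inverseʳ 1#)) ⟩
      (x + 0#) + - y            ≈⟨ +-congʳ (+-identityʳ x) ⟩
      x - y                     ∎

    ⊖-homo : ∀ m n → ⟦ m ⊖ n ⟧ℤ ≈ m ×′ 1# - n ×′ 1#
    ⊖-homo m       zero    = sym (trans (+-congˡ -0#≈0#) (+-identityʳ _))
    ⊖-homo zero    (suc n) = sym (+-identityˡ _)
    ⊖-homo (suc m) (suc n) = begin
      ⟦ suc m ⊖ suc n ⟧ℤ          ≡⟨ ≡.cong ⟦_⟧ℤ (ℤₚ.[1+m]⊖[1+n]≡m⊖n m n) ⟩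
      ⟦ m ⊖ n ⟧ℤ                  ≈⟨ ⊖-homo m n ⟩
      m ×′ 1# - n ×′ 1#             ≈⟨ cancel-1 (m ×′ 1#) (n ×′ 1#) ⟨
      (1# + m ×′ 1#) - (1# + n ×′ 1#)
        ≈⟨ +-cong (1+× m 1#) (-‿cong (1+× n 1#)) ⟨
      suc m ×′ 1# - suc n ×′ 1#     ∎

    +-homo : ∀ i j → ⟦ i ℤ.+ j ⟧ℤ ≈ ⟦ i ⟧ℤ + ⟦ j ⟧ℤ
    +-homo (+ m)    (+ n)    = ×-homo-+ 1# m n
    +-homo (+ m)    -[1+ n ] = ⊖-homo m (suc n)
    +-homo -[1+ m ] (+ n)    = trans (⊖-homo n (suc m)) (+-comm _ _)
    +-homo -[1+ m ] -[1+ n ] = begin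
      - (suc (suc (m ℕ.+ n)) ×′ 1#)
        ≡⟨ ≡.cong (λ k → - (suc k ×′ 1#)) (≡.sym (ℕₚ.+-suc m n)) ⟩
      - ((suc m ℕ.+ suc n) ×′ 1#)       ≈⟨ -‿cong (×-homo-+ 1# (suc m) (suc n)) ⟩
      - (suc m ×′ 1# + suc n ×′ 1#)      ≈⟨ -‿+-comm _ _ ⟨
      - (suc m ×′ 1#) + - (suc n ×′ 1#)  ∎

    -‿homo : ∀ i → ⟦ ℤ.- i ⟧ℤ ≈ - ⟦ i ⟧ℤ
    -‿homo (+ zero)  = sym -0#≈0#
    -‿homo (+ suc n) = refl
    -‿homo -[1+ n ]  = sym (-‿involutive _)

    morphism : ℤ.+-*-rawRing ACR.-Raw-AlmostCommutative⟶ ACR.fromCommutativeRing R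
    morphism = record
      { ⟦_⟧    = ⟦_⟧ℤ
      ; +-homo = +-homo
      ; *-homo = *-homo
      ; -‿homo = -‿homo
      ; 0-homo = refl
      ; 1-homo = refl
      }

    _coeff≟_ : WeaklyDecidable (ACR.Induced-equivalence morphism)
    i coeff≟ j with i ℤₚ.≟ j
    ... | yes i≡j = just (reflexive (≡.cong ⟦_⟧ℤ i≡j))
    ... | no  _   = nothing

  open Algebra.Solver.Ring ℤ.+-*-rawRing (ACR.fromCommutativeRing R) morphism _coeff≟_ public
    using (solve; _:=_; _:+_; _:*_; _:-_; :-_; con)

-- Formal power series

module Numerals {c ℓ} (R : CommutativeRing c ℓ) where
  open CommutativeRing R
  open Algebra.Properties.Semiring.Mult semiring using () renaming (_×_ to _×ᴿ_)

  -- The plain multiple unfolds `nat (suc n)` to `1# + nat n`, the shape in which the solver calls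
  -- below write it.
  nat : ℕ → Carrier
  nat n = n ×ᴿ 1#

-- This makes the ring a ℚ-algebra: it provides 1/n! and the cancellation of positive integers on
-- which the inductions on degree rest.
record Reciprocals {c ℓ} (R : CommutativeRing c ℓ) : Set (c ⊔ ℓ) where
  open CommutativeRing R
  open Numerals R
  field
    recip     : ℕ → Carrier
    nat*recip : ∀ n → nat (suc n) * recip n ≈ 1#

  nat-cancel : ∀ n {x} → nat (suc n) * x ≈ 0# → x ≈ 0#
  nat-cancel n {x} e = begin
    x                                ≈⟨ *-identityˡ x ⟨
    1# * x                           ≈⟨ *-congʳ (nat*recip n) ⟨
    (nat (suc n) * recip n) * x      ≈⟨ *-congʳ (*-comm _ _) ⟩
    (recip n * nat (suc n)) * x      ≈⟨ *-assoc _ _ _ ⟩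
    recip n * (nat (suc n) * x)      ≈⟨ *-congˡ e ⟩
    recip n * 0#                     ≈⟨ zeroʳ _ ⟩
    0#                               ∎
    where open Relation.Binary.Reasoning.Setoid setoid

  nat-cancel-≈ : ∀ n {x y} → nat (suc n) * x ≈ nat (suc n) * y → x ≈ y
  nat-cancel-≈ n {x} {y} e = x∙y⁻¹≈ε⇒x≈y x y (nat-cancel n (begin
    nat (suc n) * (x - y)              ≈⟨ x[y-z]≈xy-xz _ x y ⟩
    nat (suc n) * x - nat (suc n) * y  ≈⟨ x≈y⇒x∙y⁻¹≈ε e ⟩
    0#                                 ∎))
    where
    open Relation.Binary.Reasoning.Setoid setoid
    open Algebra.Properties.Ring ring using (x[y-z]≈xy-xz)
    open Algebra.Properties.AbelianGroup +-abelianGroup using (x∙y⁻¹≈ε⇒x≈y; x≈y⇒x∙y⁻¹≈ε)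

  1/_! : ℕ → Carrier
  1/ zero !  = 1#
  1/ suc n ! = recip n * 1/ n !

  nat*1/! : ∀ n → nat (suc n) * 1/ suc n ! ≈ 1/ n !
  nat*1/! n = begin
    nat (suc n) * (recip n * 1/ n !)  ≈⟨ *-assoc _ _ _ ⟨
    (nat (suc n) * recip n) * 1/ n !  ≈⟨ *-congʳ (nat*recip n) ⟩
    1# * 1/ n !                       ≈⟨ *-identityˡ _ ⟩
    1/ n !                            ∎
    where open Relation.Binary.Reasoning.Setoid setoid

record Derivation {c ℓ} (R : CommutativeRing c ℓ) : Set (c ⊔ ℓ) where
  open CommutativeRing R
  open Numerals R
  field
    D       : Carrier → Carrier
    D-cong  : ∀ {x y} → x ≈ y → D x ≈ D y
    D-+     : ∀ x y → D (x + y) ≈ D x + D y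
    D-*     : ∀ x y → D (x * y) ≈ D x * y + x * D y

  open Algebra.Properties.Ring ring using (x+x≈x⇒x≈0)
  open Algebra.Properties.AbelianGroup +-abelianGroup using (inverseʳ-unique)

  D-0 : D 0# ≈ 0#
  D-0 = x+x≈x⇒x≈0 (D 0#) (trans (sym (D-+ 0# 0#)) (D-cong (+-identityˡ 0#)))

  D-1 : D 1# ≈ 0#
  D-1 = x+x≈x⇒x≈0 (D 1#) (begin
    D 1# + D 1#            ≈⟨ +-cong (*-identityʳ _) (*-identityˡ _) ⟨
    D 1# * 1# + 1# * D 1#  ≈⟨ D-* 1# 1# ⟨
    D (1# * 1#)            ≈⟨ D-cong (*-identityˡ 1#) ⟩
    D 1#                   ∎)
    where open Relation.Binary.Reasoning.Setoid setoid

  D-neg : ∀ x → D (- x) ≈ - D x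
  D-neg x = inverseʳ-unique (D x) (D (- x))
    (trans (sym (D-+ x (- x))) (trans (D-cong (-‿inverseʳ x)) D-0))

  D-- : ∀ x y → D (x - y) ≈ D x - D y
  D-- x y = trans (D-+ x (- y)) (+-congˡ (D-neg y))

  D-nat : ∀ n → D (nat n) ≈ 0#
  D-nat zero    = D-0
  D-nat (suc n) = trans (D-+ 1# (nat n)) (trans (+-cong D-1 (D-nat n)) (+-identityˡ 0#))

  D-nat* : ∀ n x → D (nat n * x) ≈ nat n * D x
  D-nat* n x = trans (D-* (nat n) x)
    (trans (+-congʳ (trans (*-congʳ (D-nat n)) (zeroˡ x))) (+-identityˡ _))

  D-const* : ∀ k x → D k ≈ 0# → D (k * x) ≈ k * D x
  D-const* k x Dk≈0 = trans (D-* k x)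
    (trans (+-congʳ (trans (*-congʳ Dk≈0) (zeroˡ x))) (+-identityˡ _))

module _ {c ℓ} (R : CommutativeRing c ℓ) where
  open CommutativeRing R
  open RingSolver R
  open Derivation

  scaled : Carrier → Derivation R → Derivation R
  scaled k δ = record
    { D      = λ x → k * D δ x
    ; D-cong = λ p → *-congˡ (D-cong δ p)
    ; D-+    = λ x y → trans (*-congˡ (D-+ δ x y)) (distribˡ _ _ _)
    ; D-*    = λ x y → trans (*-congˡ (D-* δ x y))
        (solve 5 (λ k x y a b → k :* (a :* y :+ x :* b) := k :* a :* y :+ x :* (k :* b)) refl
          k x y (D δ x) (D δ y))
    }

module Series {c ℓ} (R : CommutativeRing c ℓ) where

  open CommutativeRing R
  open Numerals R
  open Relation.Binary.Reasoning.Setoid setoid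

  infix  4 _≋_
  infixl 6 _⊕_
  infixl 7 _⊛_

  _≋_ : (a b : ℕ → Carrier) → Set ℓ
  a ≋ b = ∀ n → a n ≈ b n

  -- The Cauchy product is given by recursion on the index, so that the ring laws are plain
  -- inductions; `SeriesSum` recovers the finite sum.
  _⊕_ _⊛_ : (a b : ℕ → Carrier) → ℕ → Carrier
  (a ⊕ b) n = a n + b n

  tail : (ℕ → Carrier) → ℕ → Carrier
  tail a n = a (suc n)

  (a ⊛ b) zero    = a 0 * b 0
  (a ⊛ b) (suc n) = a 0 * b (suc n) + (tail a ⊛ b) n

  constant : Carrier → ℕ → Carrier
  constant x zero    = x
  constant x (suc _) = 0#

  𝟘 𝟙 : ℕ → Carrier
  𝟘 _ = 0#
  𝟙   = constant 1#

  open RingSolver R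

  ⊛-cong : ∀ {a a′ b b′} → a ≋ a′ → b ≋ b′ → a ⊛ b ≋ a′ ⊛ b′
  ⊛-cong p q zero    = *-cong (p 0) (q 0)
  ⊛-cong p q (suc n) = +-cong (*-cong (p 0) (q (suc n)))
                              (⊛-cong (λ k → p (suc k)) q n)

  -- The mirror image of the defining clause, peeling the right factor; commutativity follows by
  -- playing the two against each other.
  ⊛-tailʳ : ∀ a b n → (a ⊛ b) (suc n) ≈ (a ⊛ tail b) n + a (suc n) * b 0
  ⊛-tailʳ a b zero    = refl
  ⊛-tailʳ a b (suc n) =
    trans (+-congˡ (⊛-tailʳ (tail a) b n)) (sym (+-assoc _ _ _))

  ⊛-comm : ∀ a b → a ⊛ b ≋ b ⊛ a
  ⊛-comm a b zero    = *-comm _ _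
  ⊛-comm a b (suc n) = begin
    a 0 * b (suc n) + (tail a ⊛ b) n   ≈⟨ +-cong (*-comm _ _) (⊛-comm (tail a) b n) ⟩
    b (suc n) * a 0 + (b ⊛ tail a) n   ≈⟨ +-comm _ _ ⟩
    (b ⊛ tail a) n + b (suc n) * a 0   ≈⟨ ⊛-tailʳ b a n ⟨
    (b ⊛ a) (suc n)                    ∎

  ⊛-distribʳ : ∀ c a b → (a ⊕ b) ⊛ c ≋ (a ⊛ c) ⊕ (b ⊛ c)
  ⊛-distribʳ c a b zero    = distribʳ _ _ _
  ⊛-distribʳ c a b (suc n) =
    trans (+-congˡ (⊛-distribʳ c (tail a) (tail b) n))
      (solve 5 (λ x y z u v → (x :+ y) :* z :+ (u :+ v) :=
                              (x :* z :+ u) :+ (y :* z :+ v)) refl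
        (a 0) (b 0) (c (suc n)) _ _)

  ⊛-distribˡ : ∀ c a b → c ⊛ (a ⊕ b) ≋ (c ⊛ a) ⊕ (c ⊛ b)
  ⊛-distribˡ c a b n = trans (⊛-comm c (a ⊕ b) n)
    (trans (⊛-distribʳ c a b n) (+-cong (⊛-comm a c n) (⊛-comm b c n)))

  ⊛-scaleˡ : ∀ x a b n → ((λ k → x * a k) ⊛ b) n ≈ x * (a ⊛ b) n
  ⊛-scaleˡ x a b zero    = *-assoc _ _ _
  ⊛-scaleˡ x a b (suc n) =
    trans (+-cong (*-assoc _ _ _) (⊛-scaleˡ x (tail a) b n)) (sym (distribˡ _ _ _))

  ⊛-assoc : ∀ a b c → (a ⊛ b) ⊛ c ≋ a ⊛ (b ⊛ c)
  ⊛-assoc a b c zero    = *-assoc _ _ _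
  ⊛-assoc a b c (suc n) = begin
    a 0 * b 0 * c (suc n) + (((λ k → a 0 * b (suc k)) ⊕ (tail a ⊛ b)) ⊛ c) n
      ≈⟨ +-congˡ (⊛-distribʳ c (λ k → a 0 * b (suc k)) (tail a ⊛ b) n) ⟩
    a 0 * b 0 * c (suc n) + (((λ k → a 0 * b (suc k)) ⊛ c) n + ((tail a ⊛ b) ⊛ c) n)
      ≈⟨ +-congˡ (+-cong (⊛-scaleˡ (a 0) (tail b) c n) (⊛-assoc (tail a) b c n)) ⟩
    a 0 * b 0 * c (suc n) + (a 0 * (tail b ⊛ c) n + (tail a ⊛ (b ⊛ c)) n)
      ≈⟨ solve 5 (λ x y z u v → x :* y :* z :+ (x :* u :+ v) :=
                                x :* (y :* z :+ u) :+ v) refl (a 0) (b 0) (c (suc n)) _ _ ⟩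
    a 0 * (b 0 * c (suc n) + (tail b ⊛ c) n) + (tail a ⊛ (b ⊛ c)) n ∎

  ⊛-vanishʳ : ∀ a b n → (∀ {m} → m ℕ.≤ n → b m ≈ 0#) → (a ⊛ b) n ≈ 0#
  ⊛-vanishʳ a b zero    b≈0 = trans (*-congˡ (b≈0 z≤n)) (zeroʳ _)
  ⊛-vanishʳ a b (suc n) b≈0 = trans
    (+-cong (trans (*-congˡ (b≈0 ℕₚ.≤-refl)) (zeroʳ _))
            (⊛-vanishʳ (tail a) b n (λ m≤n → b≈0 (ℕₚ.m≤n⇒m≤1+n m≤n))))
    (+-identityˡ 0#)

  ⊛-zeroʳ : ∀ a → a ⊛ 𝟘 ≋ 𝟘
  ⊛-zeroʳ a n = ⊛-vanishʳ a 𝟘 n (λ _ → refl)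

  ⊛-constantˡ : ∀ x a n → (constant x ⊛ a) n ≈ x * a n
  ⊛-constantˡ x a zero    = refl
  ⊛-constantˡ x a (suc n) =
    trans (+-congˡ (trans (⊛-comm 𝟘 a n) (⊛-zeroʳ a n))) (+-identityʳ _)

  ⊛-identityˡ : ∀ a → 𝟙 ⊛ a ≋ a
  ⊛-identityˡ a n = trans (⊛-constantˡ 1# a n) (*-identityˡ _)

  commutativeRing : CommutativeRing c ℓ
  commutativeRing = record
    { Carrier = ℕ → Carrier
    ; _≈_ = _≋_
    ; _+_ = _⊕_
    ; _*_ = _⊛_
    ; -_  = λ a n → - a n
    ; 0#  = 𝟘
    ; 1#  = 𝟙
    ; isCommutativeRing = record
      { isRing = record
        { +-isAbelianGroup = record
          { isGroup = record
            { isMonoid = record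
              { isSemigroup = record
                { isMagma = record
                  { isEquivalence = record
                    { refl  = λ n → refl
                    ; sym   = λ p n → sym (p n)
                    ; trans = λ p q n → trans (p n) (q n)
                    }
                  ; ∙-cong = λ p q n → +-cong (p n) (q n)
                  }
                ; assoc = λ a b c n → +-assoc _ _ _
                }
              ; identity = (λ a n → +-identityˡ _) , (λ a n → +-identityʳ _)
              }
            ; inverse = (λ a n → -‿inverseˡ _) , (λ a n → -‿inverseʳ _)
            ; ⁻¹-cong = λ p n → -‿cong (p n)
            }
          ; comm = λ a b n → +-comm _ _
          }
        ; *-cong     = ⊛-cong
        ; *-assoc    = ⊛-assoc
        ; *-identity = ⊛-identityˡ , λ a n → trans (⊛-comm a 𝟙 n) (⊛-identityˡ a n)
        ; distrib    = ⊛-distribˡ , ⊛-distribʳ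
        }
      ; *-comm = ⊛-comm
      }
    }

  private module S = Numerals commutativeRing

  nat-constant : ∀ n → S.nat n ≋ constant (nat n)
  nat-constant zero    zero    = refl
  nat-constant zero    (suc k) = refl
  nat-constant (suc n) zero    = +-congˡ (nat-constant n 0)
  nat-constant (suc n) (suc k) = trans (+-identityˡ _) (nat-constant n (suc k))

  nat-⊛ : ∀ n a k → (S.nat n ⊛ a) k ≈ nat n * a k
  nat-⊛ n a k = trans (⊛-cong {b = a} (nat-constant n) (λ _ → refl) k) (⊛-constantˡ (nat n) a k)

  reciprocals : Reciprocals R → Reciprocals commutativeRing
  reciprocals ρ = record
    { recip     = λ n → constant (recip n)
    ; nat*recip = λ n k → trans (nat-⊛ (suc n) (constant (recip n)) k) (at n k)
    }
    where
    open Reciprocals ρ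
    at : ∀ n k → nat (suc n) * constant (recip n) k ≈ 𝟙 k
    at n zero    = nat*recip n
    at n (suc k) = zeroʳ _

  euler : Derivation commutativeRing
  euler = record
    { D      = E
    ; D-cong = λ p n → *-congˡ (p n)
    ; D-+    = λ a b n → distribˡ _ _ _
    ; D-*    = leibniz
    }
    where
    E : (ℕ → Carrier) → ℕ → Carrier
    E a n = nat n * a n

    -- As a = a 0 + x · `tail a`, this is D (x t) = x (t + D t) with the factor x removed.
    tail-E : ∀ a → tail (E a) ≋ tail a ⊕ E (tail a)
    tail-E a n = trans (distribʳ _ _ _) (+-congʳ (*-identityˡ _))

    leibniz : ∀ a b n → nat n * (a ⊛ b) n ≈ (E a ⊛ b) n + (a ⊛ E b) n
    leibniz a b zero    =
      solve 2 (λ x y → con (ℤ.+ 0) :* (x :* y) :=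
                       con (ℤ.+ 0) :* x :* y :+ x :* (con (ℤ.+ 0) :* y)) refl (a 0) (b 0)
    leibniz a b (suc n) = begin
      nat (suc n) * (a 0 * b (suc n) + (tail a ⊛ b) n)
        ≈⟨ solve 4 (λ x y k t → (con (ℤ.+ 1) :+ k) :* (x :* y :+ t) :=
             (con (ℤ.+ 0) :* x :* y :+ t) :+ (x :* ((con (ℤ.+ 1) :+ k) :* y) :+ k :* t)) refl
             (a 0) (b (suc n)) (nat n) ((tail a ⊛ b) n) ⟩
      (0# * a 0 * b (suc n) + (tail a ⊛ b) n) + (a 0 * E b (suc n) + nat n * (tail a ⊛ b) n)
        ≈⟨ +-congˡ (+-congˡ (leibniz (tail a) b n)) ⟩
      (0# * a 0 * b (suc n) + (tail a ⊛ b) n)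
        + (a 0 * E b (suc n) + ((E (tail a) ⊛ b) n + (tail a ⊛ E b) n))
        ≈⟨ solve 5 (λ u t v w s → (u :+ t) :+ (v :+ (w :+ s)) := (u :+ (t :+ w)) :+ (v :+ s)) refl
             (0# * a 0 * b (suc n)) _ _ _ _ ⟩
      (0# * a 0 * b (suc n) + ((tail a ⊛ b) n + (E (tail a) ⊛ b) n))
        + (a 0 * E b (suc n) + (tail a ⊛ E b) n)
        ≈⟨ +-congʳ (+-congˡ (trans (⊛-cong {b = b} (tail-E a) (λ _ → refl) n)
                                   (⊛-distribʳ b (tail a) (E (tail a)) n))) ⟨
      (E a ⊛ b) (suc n) + (a ⊛ E b) (suc n) ∎

  pointwise : Derivation R → Derivation commutativeRing
  pointwise δ = record
    { D      = λ a n → D (a n)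
    ; D-cong = λ p n → D-cong (p n)
    ; D-+    = λ a b n → D-+ (a n) (b n)
    ; D-*    = leibniz
    }
    where
    open Derivation δ
    leibniz : ∀ a b n → D ((a ⊛ b) n) ≈ ((λ k → D (a k)) ⊛ b) n + (a ⊛ (λ k → D (b k))) n
    leibniz a b zero    = D-* (a 0) (b 0)
    leibniz a b (suc n) = begin
      D (a 0 * b (suc n) + (tail a ⊛ b) n)
        ≈⟨ trans (D-+ _ _) (+-cong (D-* _ _) (leibniz (tail a) b n)) ⟩
      (D (a 0) * b (suc n) + a 0 * D (b (suc n)))
        + (((λ k → D (a (suc k))) ⊛ b) n + (tail a ⊛ (λ k → D (b k))) n)
        ≈⟨ solve 4 (λ x y z w → (x :+ y) :+ (z :+ w) := (x :+ z) :+ (y :+ w)) refl _ _ _ _ ⟩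
      (((λ k → D (a k)) ⊛ b) (suc n) + (a ⊛ (λ k → D (b k))) (suc n)) ∎

  euler-pointwise-comm : ∀ (δ : Derivation R) a →
    Derivation.D euler (Derivation.D (pointwise δ) a) ≋
    Derivation.D (pointwise δ) (Derivation.D euler a)
  euler-pointwise-comm δ a n = sym (Derivation.D-nat* δ n (a n))

  private
    vanish-≤ : ∀ {x : ℕ → Carrier} → x 0 ≈ 0# →
               (∀ n → (∀ {m} → m ℕ.≤ n → x m ≈ 0#) → x (suc n) ≈ 0#) →
               ∀ n {m} → m ℕ.≤ n → x m ≈ 0#
    vanish-≤ x₀ step zero    z≤n = x₀
    vanish-≤ x₀ step (suc n) {m} m≤1+n with ℕₚ.m≤n⇒m<n∨m≡n m≤1+n
    ... | inj₁ (s≤s m≤n) = vanish-≤ x₀ step n m≤n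
    ... | inj₂ ≡.refl    = step n (vanish-≤ x₀ step n)

  vanish : ∀ {x : ℕ → Carrier} → x 0 ≈ 0# →
           (∀ n → (∀ {m} → m ℕ.≤ n → x m ≈ 0#) → x (suc n) ≈ 0#) → x ≋ 𝟘
  vanish x₀ step n = vanish-≤ x₀ step n ℕₚ.≤-refl

  -- In each new coefficient of the product, all terms but the one with `g 0` contain earlier
  -- coefficients of `x`, already known to vanish.
  regular : ∀ (g : ℕ → Carrier) → (∀ x → g 0 * x ≈ 0# → x ≈ 0#) →
            ∀ x → g ⊛ x ≋ 𝟘 → x ≋ 𝟘
  regular g reg x gx≈0 = vanish (reg (x 0) (gx≈0 0)) λ n x≈0 → reg (x (suc n)) (begin
    g 0 * x (suc n)                    ≈⟨ +-identityʳ _ ⟨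
    g 0 * x (suc n) + 0#               ≈⟨ +-congˡ (⊛-vanishʳ (tail g) x n x≈0) ⟨
    (g ⊛ x) (suc n)                    ≈⟨ gx≈0 (suc n) ⟩
    0#                                 ∎)

  module _ (ρ : Reciprocals R) where
    open Reciprocals ρ
    open Derivation euler

    -- Since `a` has no constant term, (n + 1) times coefficient n + 1 of `x` is a combination of
    -- earlier coefficients.
    linear-ode-unique : ∀ a x → D x ≋ a ⊛ x → a 0 ≈ 0# → x 0 ≈ 0# → x ≋ 𝟘
    linear-ode-unique a x ode a₀ x₀ = vanish x₀ λ n x≈0 → nat-cancel n (begin
      nat (suc n) * x (suc n)              ≈⟨ ode (suc n) ⟩
      a 0 * x (suc n) + (tail a ⊛ x) n     ≈⟨ +-cong (*-congʳ a₀) (⊛-vanishʳ (tail a) x n x≈0) ⟩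
      0# * x (suc n) + 0#                  ≈⟨ trans (+-identityʳ _) (zeroˡ _) ⟩
      0#                                   ∎)

    euler-kernel : ∀ x → D x ≋ 𝟘 → x 0 ≈ 0# → x ≋ 𝟘
    euler-kernel x Dx≈0 x₀ = vanish x₀ λ n _ → nat-cancel n (Dx≈0 (suc n))

-- Blocks and components of bipartite graphs

restrict : ∀ {A : Set} {n} (S : Subset n) → Vec A n → Vec A ∣ S ∣
restrict []            []      = []
restrict (inside  ∷ S) (x ∷ v) = x ∷ restrict S v
restrict (outside ∷ S) (x ∷ v) = restrict S v

emb : ∀ {n} (S : Subset n) → Fin ∣ S ∣ → Fin n
emb (inside  ∷ S) zero    = zero
emb (inside  ∷ S) (suc k) = suc (emb S k)
emb (outside ∷ S) k       = suc (emb S k)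

emb-∈ : ∀ {n} (S : Subset n) k → emb S k ∈ S
emb-∈ (inside  ∷ S) zero    = here
emb-∈ (inside  ∷ S) (suc k) = there (emb-∈ S k)
emb-∈ (outside ∷ S) k       = there (emb-∈ S k)

index : ∀ {n} {S : Subset n} {i} → i ∈ S → Fin ∣ S ∣
index                    here      = zero
index {S = inside  ∷ _} (there p) = suc (index p)
index {S = outside ∷ _} (there p) = index p

emb-index : ∀ {n} {S : Subset n} {i} (p : i ∈ S) → emb S (index p) ≡ i
emb-index                   here      = ≡.refl
emb-index {S = inside  ∷ _} (there p) = ≡.cong suc (emb-index p)
emb-index {S = outside ∷ _} (there p) = ≡.cong suc (emb-index p)

index-emb : ∀ {n} (S : Subset n) k {i} (p : i ∈ S) → i ≡ emb S k → index p ≡ k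
index-emb (inside  ∷ S) zero    here      ≡.refl = ≡.refl
index-emb (inside  ∷ S) (suc k) (there p) ≡.refl = ≡.cong suc (index-emb S k p ≡.refl)
index-emb (outside ∷ S) k       (there p) ≡.refl = index-emb S k p ≡.refl

lookup-restrict : ∀ {A : Set} {n} (S : Subset n) (v : Vec A n) k →
                  lookup (restrict S v) k ≡ lookup v (emb S k)
lookup-restrict (inside  ∷ S) (x ∷ v) zero    = ≡.refl
lookup-restrict (inside  ∷ S) (x ∷ v) (suc k) = lookup-restrict S v k
lookup-restrict (outside ∷ S) (x ∷ v) k       = lookup-restrict S v k

∈-restrict⁺ : ∀ {n} (T : Subset n) {row : Subset n} {k} → emb T k ∈ row → k ∈ restrict T row
∈-restrict⁺ T {row} {k} p =
  lookup⇒[]= k (restrict T row) (≡.trans (lookup-restrict T row k) ([]=⇒lookup p))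

∈-restrict⁻ : ∀ {n} (T : Subset n) {row : Subset n} {k} → k ∈ restrict T row → emb T k ∈ row
∈-restrict⁻ T {row} {k} p =
  lookup⇒[]= (emb T k) row (≡.trans (≡.sym (lookup-restrict T row k)) ([]=⇒lookup p))

∣∣-restrict : ∀ {n} (T : Subset n) (row : Subset n) →
              ∣ row ∣ ≡ ∣ restrict T row ∣ ℕ.+ ∣ restrict (∁ T) row ∣
∣∣-restrict []            []              = ≡.refl
∣∣-restrict (inside  ∷ T) (inside  ∷ row) = ≡.cong suc (∣∣-restrict T row)
∣∣-restrict (inside  ∷ T) (outside ∷ row) = ∣∣-restrict T row
∣∣-restrict (outside ∷ T) (inside  ∷ row) =
  ≡.trans (≡.cong suc (∣∣-restrict T row)) (≡.sym (ℕₚ.+-suc _ _))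
∣∣-restrict (outside ∷ T) (outside ∷ row) = ∣∣-restrict T row

-- The subgraph induced on S ⊔ T, relabelled in increasing order. Taken with the complements of S
-- and T, four blocks partition the edges.
block : ∀ {r s} (S : Subset r) (T : Subset s) → Graph r s → Graph ∣ S ∣ ∣ T ∣
block S T g = Vec.map (restrict T) (restrict S g)

block-∈ : ∀ {r s} (S : Subset r) (T : Subset s) (g : Graph r s) k →
          lookup (block S T g) k ≡ restrict T (lookup g (emb S k))
block-∈ S T g k =
  ≡.trans (lookup-map k (restrict T) (restrict S g)) (≡.cong (restrict T) (lookup-restrict S g k))

edgeCount-map-restrict : ∀ {r s} (T : Subset s) (g : Graph r s) →
  edgeCount g ≡ edgeCount (Vec.map (restrict T) g) ℕ.+ edgeCount (Vec.map (restrict (∁ T)) g)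
edgeCount-map-restrict T []        = ≡.refl
edgeCount-map-restrict T (row ∷ g) =
  ≡.trans (≡.cong₂ ℕ._+_ (∣∣-restrict T row) (edgeCount-map-restrict T g))
    (solve 4 (λ a b c d → (a :+ b) :+ (c :+ d) := (a :+ c) :+ (b :+ d)) ≡.refl
      ∣ restrict T row ∣ ∣ restrict (∁ T) row ∣
      (edgeCount (Vec.map (restrict T) g)) (edgeCount (Vec.map (restrict (∁ T)) g)))
  where open Data.Nat.Solver.+-*-Solver

edgeCount-restrict : ∀ {r s} (S : Subset r) (g : Graph r s) →
  edgeCount g ≡ edgeCount (restrict S g) ℕ.+ edgeCount (restrict (∁ S) g)
edgeCount-restrict []            []        = ≡.refl
edgeCount-restrict (inside  ∷ S) (row ∷ g) =
  ≡.trans (≡.cong (∣ row ∣ ℕ.+_) (edgeCount-restrict S g)) (≡.sym (ℕₚ.+-assoc ∣ row ∣ _ _))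
edgeCount-restrict (outside ∷ S) (row ∷ g) =
  ≡.trans (≡.cong (∣ row ∣ ℕ.+_) (edgeCount-restrict S g))
    (solve 3 (λ a b c → a :+ (b :+ c) := b :+ (a :+ c)) ≡.refl
      ∣ row ∣ (edgeCount (restrict S g)) (edgeCount (restrict (∁ S) g)))
  where open Data.Nat.Solver.+-*-Solver

∣p∣≡0⇒∉ : ∀ {n} (p : Subset n) → ∣ p ∣ ≡ 0 → ∀ {i} → i ∉ p
∣p∣≡0⇒∉ (outside ∷ p) e (there i∈p) = ∣p∣≡0⇒∉ p e i∈p

∉⇒∣p∣≡0 : ∀ {n} (p : Subset n) → (∀ {i} → i ∉ p) → ∣ p ∣ ≡ 0
∉⇒∣p∣≡0 []            ∉p = ≡.refl
∉⇒∣p∣≡0 (inside  ∷ p) ∉p = contradiction here ∉p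
∉⇒∣p∣≡0 (outside ∷ p) ∉p = ∉⇒∣p∣≡0 p (∉p ∘ there)

edgeCount≡0⇒∉ : ∀ {r s} (g : Graph r s) → edgeCount g ≡ 0 → ∀ i {j} → j ∉ lookup g i
edgeCount≡0⇒∉ (row ∷ g) e zero    = ∣p∣≡0⇒∉ row (ℕₚ.m+n≡0⇒m≡0 ∣ row ∣ e)
edgeCount≡0⇒∉ (row ∷ g) e (suc i) = edgeCount≡0⇒∉ g (ℕₚ.m+n≡0⇒n≡0 ∣ row ∣ e) i

∉⇒edgeCount≡0 : ∀ {r s} (g : Graph r s) → (∀ i {j} → j ∉ lookup g i) → edgeCount g ≡ 0
∉⇒edgeCount≡0 []        ∉g = ≡.refl
∉⇒edgeCount≡0 (row ∷ g) ∉g = ≡.cong₂ ℕ._+_ (∉⇒∣p∣≡0 row (∉g zero)) (∉⇒edgeCount≡0 g (∉g ∘ suc))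

block-empty⁻ : ∀ {r s} (S : Subset r) (T : Subset s) (g : Graph r s) →
  edgeCount (block S T g) ≡ 0 → ∀ {i j} → i ∈ S → j ∈ T → j ∉ lookup g i
block-empty⁻ S T g e {i} {j} i∈S j∈T j∈gi =
  edgeCount≡0⇒∉ (block S T g) e (index i∈S)
    (≡.subst (index j∈T ∈_) (≡.sym (block-∈ S T g (index i∈S)))
      (∈-restrict⁺ T (≡.subst (λ k → emb T (index j∈T) ∈ lookup g k) (≡.sym (emb-index i∈S))
        (≡.subst (_∈ lookup g i) (≡.sym (emb-index j∈T)) j∈gi))))

block-empty⁺ : ∀ {r s} (S : Subset r) (T : Subset s) (g : Graph r s) →
  (∀ {i j} → i ∈ S → j ∈ T → j ∉ lookup g i) → edgeCount (block S T g) ≡ 0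
block-empty⁺ S T g ∉g = ∉⇒edgeCount≡0 (block S T g) λ i {j} j∈ →
  ∉g (emb-∈ S i) (emb-∈ T j) (∈-restrict⁻ T (≡.subst (j ∈_) (block-∈ S T g i) j∈))

reverseAdj : ∀ {r s} {g : Graph r s} {u v} → Adj g u v → Adj g v u
reverseAdj (forth p) = back p
reverseAdj (back p)  = forth p

module _ {r s} (g : Graph r s) (S : Subset r) (T : Subset s) where

  In : Vertex r s → Set
  In (inj₁ i) = i ∈ S
  In (inj₂ j) = j ∈ T

  Closed : Set
  Closed = ∀ {i j} → j ∈ lookup g i → (i ∈ S → j ∈ T) × (j ∈ T → i ∈ S)

  -- The edges leaving S ⊔ T are those of the two off-diagonal blocks. They are counted, because
  -- this number later becomes an exponent of `0#`.
  closed⁺ : edgeCount (block S (∁ T) g) ℕ.+ edgeCount (block (∁ S) T g) ≡ 0 → Closed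
  closed⁺ e {i} {j} j∈gi =
    (λ i∈S → x∉∁p⇒x∈p λ j∈∁T →
      block-empty⁻ S (∁ T) g (ℕₚ.m+n≡0⇒m≡0 _ e) i∈S j∈∁T j∈gi) ,
    (λ j∈T → x∉∁p⇒x∈p λ i∈∁S →
      block-empty⁻ (∁ S) T g (ℕₚ.m+n≡0⇒n≡0 (edgeCount (block S (∁ T) g)) e) i∈∁S j∈T j∈gi)

  closed⁻ : Closed → edgeCount (block S (∁ T) g) ℕ.+ edgeCount (block (∁ S) T g) ≡ 0
  closed⁻ cl = ≡.cong₂ ℕ._+_
    (block-empty⁺ S (∁ T) g λ i∈S j∈∁T j∈gi → x∈∁p⇒x∉p j∈∁T (proj₁ (cl j∈gi) i∈S))
    (block-empty⁺ (∁ S) T g λ i∈∁S j∈T j∈gi → x∈∁p⇒x∉p i∈∁S (proj₂ (cl j∈gi) j∈T))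

  embᵛ : Vertex ∣ S ∣ ∣ T ∣ → Vertex r s
  embᵛ (inj₁ k) = inj₁ (emb S k)
  embᵛ (inj₂ k) = inj₂ (emb T k)

  indexᵛ : ∀ v → In v → Vertex ∣ S ∣ ∣ T ∣
  indexᵛ (inj₁ i) p = inj₁ (index p)
  indexᵛ (inj₂ j) p = inj₂ (index p)

  embᵛ-In : ∀ v → In (embᵛ v)
  embᵛ-In (inj₁ k) = emb-∈ S k
  embᵛ-In (inj₂ k) = emb-∈ T k

  embᵛ-indexᵛ : ∀ v (p : In v) → embᵛ (indexᵛ v p) ≡ v
  embᵛ-indexᵛ (inj₁ i) p = ≡.cong inj₁ (emb-index p)
  embᵛ-indexᵛ (inj₂ j) p = ≡.cong inj₂ (emb-index p)

  indexᵛ-embᵛ : ∀ v (p : In (embᵛ v)) → indexᵛ (embᵛ v) p ≡ v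
  indexᵛ-embᵛ (inj₁ k) p = ≡.cong inj₁ (index-emb S k p ≡.refl)
  indexᵛ-embᵛ (inj₂ k) p = ≡.cong inj₂ (index-emb T k p ≡.refl)

  adj-push : ∀ {u v} → Adj (block S T g) u v → Adj g (embᵛ u) (embᵛ v)
  adj-push (forth {i} {j} p) = forth (∈-restrict⁻ T (≡.subst (j ∈_) (block-∈ S T g i) p))
  adj-push (back  {i} {j} p) = back  (∈-restrict⁻ T (≡.subst (j ∈_) (block-∈ S T g i) p))

  edge-pull : ∀ {i j} (p : i ∈ S) (q : j ∈ T) → j ∈ lookup g i →
              index q ∈ lookup (block S T g) (index p)
  edge-pull {i} {j} p q e = ≡.subst (index q ∈_) (≡.sym (block-∈ S T g (index p)))
    (∈-restrict⁺ T (≡.subst (λ k → emb T (index q) ∈ lookup g k) (≡.sym (emb-index p))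
      (≡.subst (_∈ lookup g i) (≡.sym (emb-index q)) e)))

  -- A walk that starts in a closed set never leaves it, so each of its edges lies in the block.
  walk-pull : Closed → ∀ {u v} → Star (Adj g) u v → (p : In u) →
              Σ[ q ∈ In v ] Star (Adj (block S T g)) (indexᵛ u p) (indexᵛ v q)
  walk-pull cl ε             p = p , ε
  walk-pull cl (forth e ◅ w) p = let p′ = proj₁ (cl e) p; q , w′ = walk-pull cl w p′ in
    q , forth (edge-pull p p′ e) ◅ w′
  walk-pull cl (back e ◅ w)  p = let p′ = proj₂ (cl e) p; q , w′ = walk-pull cl w p′ in
    q , back (edge-pull p′ p e) ◅ w′

  block-connected⁻ : Connected (block S T g) → ∀ {u v} → In u → In v → Star (Adj g) u v
  block-connected⁻ c {u} {v} p q =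
    ≡.subst (λ u → Star (Adj g) u v) (embᵛ-indexᵛ u p)
      (≡.subst (Star (Adj g) (embᵛ (indexᵛ u p))) (embᵛ-indexᵛ v q)
        (gmap embᵛ adj-push (c (indexᵛ u p) (indexᵛ v q))))

  block-connected⁺ : Closed → (∀ {u v} → In u → In v → Star (Adj g) u v) →
                     Connected (block S T g)
  block-connected⁺ cl c u v =
    let q , w = walk-pull cl (c (embᵛ-In u) (embᵛ-In v)) (embᵛ-In u) in
    ≡.subst (λ u → Star (Adj (block S T g)) u v) (indexᵛ-embᵛ u (embᵛ-In u))
      (≡.subst (Star (Adj (block S T g)) (indexᵛ (embᵛ u) (embᵛ-In u))) (indexᵛ-embᵛ v q) w)

subset : ∀ {n} {P : Fin n → Set} → (∀ i → Dec (P i)) → Subset n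
subset P? = tabulate (does ∘ P?)

∈-subset⁺ : ∀ {n} {P : Fin n → Set} (P? : ∀ i → Dec (P i)) {i} → P i → i ∈ subset P?
∈-subset⁺ P? {i} p =
  lookup⇒[]= i (subset P?) (≡.trans (lookup∘tabulate (does ∘ P?) i) (dec-true (P? i) p))

∈-subset⁻ : ∀ {n} {P : Fin n → Set} (P? : ∀ i → Dec (P i)) {i} → i ∈ subset P? → P i
∈-subset⁻ P? {i} i∈ with P? i | ≡.trans (≡.sym (lookup∘tabulate (does ∘ P?) i)) ([]=⇒lookup i∈)
... | yes p | _ = p

module Component {r s} (g : Graph (suc r) s) where

  Reachable : Vertex (suc r) s → Set
  Reachable = Star (Adj g) (inj₁ zero)

  reachable? : ∀ v → Dec (Reachable v)
  reachable? = star? (≡-dec Finₚ._≟_ Finₚ._≟_) (adj? g) (vertices (suc r) s) ∈-vertices (inj₁ zero)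

  component₁ : Subset r
  component₁ = subset (reachable? ∘ inj₁ ∘ suc)

  component₂ : Subset s
  component₂ = subset (reachable? ∘ inj₂)

  -- Phrased by the blocks alone, so that it can be turned into a weight on pairs (S, T). The first
  -- vertex of V₁ always belongs, hence S ranges over subsets of the others.
  IsComponent : Subset r → Subset s → Set
  IsComponent S T =
    Connected (block (inside ∷ S) T g) ×
    edgeCount (block (inside ∷ S) (∁ T) g) ℕ.+ edgeCount (block (outside ∷ ∁ S) T g) ≡ 0

  -- Closedness keeps everything reachable inside; connectedness of the block makes everything
  -- inside reachable.
  isComponent⇒≡ : ∀ {S T} → IsComponent S T → S ≡ component₁ × T ≡ component₂
  isComponent⇒≡ {S} {T} (c , e) =
    ⊆-antisym (λ i∈S → ∈-subset⁺ (reachable? ∘ inj₁ ∘ suc) (from here (there i∈S)))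
              (λ i∈C → drop (to (∈-subset⁻ (reachable? ∘ inj₁ ∘ suc) i∈C))) ,
    ⊆-antisym (λ j∈T → ∈-subset⁺ (reachable? ∘ inj₂) (from here j∈T))
              (λ j∈C → to (∈-subset⁻ (reachable? ∘ inj₂) j∈C))
    where
    to : ∀ {v} → Reachable v → In g (inside ∷ S) T v
    to w = proj₁ (walk-pull g (inside ∷ S) T (closed⁺ g (inside ∷ S) T e) w here)
    from : ∀ {u v} → In g (inside ∷ S) T u → In g (inside ∷ S) T v → Star (Adj g) u v
    from = block-connected⁻ g (inside ∷ S) T c
    drop : ∀ {i} → suc i ∈ inside ∷ S → i ∈ S
    drop (there p) = p

  component-isComponent : IsComponent component₁ component₂
  component-isComponent = block-connected⁺ g S T closed connected , closed⁻ g S T closed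
    where
    S : Subset (suc r)
    S = inside ∷ component₁
    T : Subset s
    T = component₂
    to : ∀ {v} → In g S T v → Reachable v
    to {inj₁ zero}    p         = ε
    to {inj₁ (suc i)} (there p) = ∈-subset⁻ (reachable? ∘ inj₁ ∘ suc) p
    to {inj₂ j}       p         = ∈-subset⁻ (reachable? ∘ inj₂) p
    from : ∀ {v} → Reachable v → In g S T v
    from {inj₁ zero}    w = here
    from {inj₁ (suc i)} w = there (∈-subset⁺ (reachable? ∘ inj₁ ∘ suc) w)
    from {inj₂ j}       w = ∈-subset⁺ (reachable? ∘ inj₂) w
    closed : Closed g S T
    closed e = (λ p → from {inj₂ _} (to {inj₁ _} p ◅◅ forth e ◅ ε)) ,
               (λ p → from {inj₁ _} (to {inj₂ _} p ◅◅ back e ◅ ε))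
    connected : ∀ {u v} → In g S T u → In g S T v → Star (Adj g) u v
    connected {u} {v} p q = reverse reverseAdj (to {u} p) ◅◅ to {v} q

-- Sums over graphs

subsets : ∀ n → List (Subset n)
subsets = allVecs (inside ∷ outside ∷ [])

module ListSum {c ℓ} (R : CommutativeRing c ℓ) where
  open CommutativeRing R
  open Relation.Binary.Reasoning.Setoid setoid
  open RingSolver R

  ∑ : ∀ {A : Set} → List A → (A → Carrier) → Carrier
  ∑ []       f = 0#
  ∑ (x ∷ xs) f = f x + ∑ xs f

  private variable
    A B C D : Set

  ∑-cong : ∀ (xs : List A) {f g : A → Carrier} → (∀ x → f x ≈ g x) → ∑ xs f ≈ ∑ xs g
  ∑-cong []       e = refl
  ∑-cong (x ∷ xs) e = +-cong (e x) (∑-cong xs e)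

  ∑-zero : ∀ (xs : List A) → ∑ xs (λ _ → 0#) ≈ 0#
  ∑-zero []       = refl
  ∑-zero (x ∷ xs) = trans (+-identityˡ _) (∑-zero xs)

  ∑-+ : ∀ (xs : List A) (f g : A → Carrier) → ∑ xs (λ x → f x + g x) ≈ ∑ xs f + ∑ xs g
  ∑-+ []       f g = sym (+-identityˡ 0#)
  ∑-+ (x ∷ xs) f g = trans (+-congˡ (∑-+ xs f g))
    (solve 4 (λ a b c d → (a :+ b) :+ (c :+ d) := (a :+ c) :+ (b :+ d)) refl (f x) (g x) _ _)

  ∑-*ˡ : ∀ (xs : List A) k (f : A → Carrier) → ∑ xs (λ x → k * f x) ≈ k * ∑ xs f
  ∑-*ˡ []       k f = sym (zeroʳ k)
  ∑-*ˡ (x ∷ xs) k f = trans (+-congˡ (∑-*ˡ xs k f)) (sym (distribˡ _ _ _))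

  ∑-*ʳ : ∀ (xs : List A) k (f : A → Carrier) → ∑ xs (λ x → f x * k) ≈ ∑ xs f * k
  ∑-*ʳ xs k f = trans (∑-cong xs (λ x → *-comm _ _)) (trans (∑-*ˡ xs k f) (*-comm _ _))

  ∑-comm : ∀ (xs : List A) (ys : List B) (f : A → B → Carrier) →
           ∑ xs (λ x → ∑ ys (f x)) ≈ ∑ ys (λ y → ∑ xs (λ x → f x y))
  ∑-comm []       ys f = sym (∑-zero ys)
  ∑-comm (x ∷ xs) ys f = trans (+-congˡ (∑-comm xs ys f)) (sym (∑-+ ys (f x) _))

  ∑-++ : ∀ (xs ys : List A) (f : A → Carrier) → ∑ (xs ++ ys) f ≈ ∑ xs f + ∑ ys f
  ∑-++ []       ys f = sym (+-identityˡ _)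
  ∑-++ (x ∷ xs) ys f = trans (+-congˡ (∑-++ xs ys f)) (sym (+-assoc _ _ _))

  ∑-map : ∀ (g : A → B) xs (f : B → Carrier) → ∑ (List.map g xs) f ≈ ∑ xs (λ x → f (g x))
  ∑-map g []       f = refl
  ∑-map g (x ∷ xs) f = +-congˡ (∑-map g xs f)

  ∑-cartesianProductWith : ∀ (g : A → B → C) xs ys (f : C → Carrier) →
    ∑ (cartesianProductWith g xs ys) f ≈ ∑ xs (λ x → ∑ ys (λ y → f (g x y)))
  ∑-cartesianProductWith g []       ys f = refl
  ∑-cartesianProductWith g (x ∷ xs) ys f = trans (∑-++ (List.map (g x) ys) _ f)
    (+-cong (∑-map (g x) ys f) (∑-cartesianProductWith g xs ys f))

  ∑-∷ : ∀ (xs : List A) n (f : Vec A (suc n) → Carrier) →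
        ∑ (allVecs xs (suc n)) f ≈ ∑ xs (λ x → ∑ (allVecs xs n) (λ v → f (x ∷ v)))
  ∑-∷ xs n = ∑-cartesianProductWith _∷_ xs (allVecs xs n)

  ∑-subsets-suc : ∀ n (f : Subset (suc n) → Carrier) → ∑ (subsets (suc n)) f ≈
                  ∑ (subsets n) (λ p → f (inside ∷ p)) + ∑ (subsets n) (λ p → f (outside ∷ p))
  ∑-subsets-suc n f =
    trans (∑-∷ (inside ∷ outside ∷ []) n f) (+-congˡ (+-identityʳ _))

  ∑-product : ∀ (xs : List A) (ys : List B) (zs : List C) (ws : List D)
              (f : A → Carrier) (g : B → Carrier) (h : C → Carrier) (k : D → Carrier) →
    ∑ xs (λ x → ∑ ys (λ y → ∑ zs (λ z → ∑ ws (λ w → (f x * g y) * (h z * k w))))) ≈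
    (∑ xs f * ∑ ys g) * (∑ zs h * ∑ ws k)
  ∑-product xs ys zs ws f g h k = begin
    ∑ xs (λ x → ∑ ys (λ y → ∑ zs (λ z → ∑ ws (λ w → (f x * g y) * (h z * k w)))))
      ≈⟨ ∑-cong xs (λ x → ∑-cong ys (λ y → trans
           (∑-cong zs (λ z → trans (∑-*ˡ ws (f x * g y) (λ w → h z * k w))
                                   (*-congˡ (∑-*ˡ ws (h z) k))))
           (trans (∑-*ˡ zs (f x * g y) (λ z → h z * ∑ ws k)) (*-congˡ (∑-*ʳ zs (∑ ws k) h))))) ⟩
    ∑ xs (λ x → ∑ ys (λ y → (f x * g y) * (∑ zs h * ∑ ws k)))
      ≈⟨ ∑-cong xs (λ x → trans (∑-*ʳ ys (∑ zs h * ∑ ws k) (λ y → f x * g y))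
                                (*-congʳ (∑-*ˡ ys (f x) g))) ⟩
    ∑ xs (λ x → (f x * ∑ ys g) * (∑ zs h * ∑ ws k))
      ≈⟨ trans (∑-*ʳ xs (∑ zs h * ∑ ws k) (λ x → f x * ∑ ys g)) (*-congʳ (∑-*ʳ xs (∑ ys g) f)) ⟩
    (∑ xs f * ∑ ys g) * (∑ zs h * ∑ ws k) ∎

  -- The entries at positions in S and those in its complement vary independently and together
  -- determine the vector.
  ∑-split : ∀ (xs : List A) {n} (S : Subset n) (h : Vec A ∣ S ∣ → Vec A ∣ ∁ S ∣ → Carrier) →
    ∑ (allVecs xs n) (λ v → h (restrict S v) (restrict (∁ S) v)) ≈
    ∑ (allVecs xs ∣ S ∣) (λ p → ∑ (allVecs xs ∣ ∁ S ∣) (λ q → h p q))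
  ∑-split xs [] h = sym (+-identityʳ _)
  ∑-split xs {suc n} (inside ∷ S) h = begin
    ∑ (allVecs xs (suc n)) (λ v → h (restrict (inside ∷ S) v) (restrict (outside ∷ ∁ S) v))
      ≈⟨ ∑-∷ xs n _ ⟩
    ∑ xs (λ x → ∑ (allVecs xs n) (λ v → h (x ∷ restrict S v) (restrict (∁ S) v)))
      ≈⟨ ∑-cong xs (λ x → ∑-split xs S (λ p q → h (x ∷ p) q)) ⟩
    ∑ xs (λ x → ∑ (allVecs xs ∣ S ∣) (λ p → ∑ (allVecs xs ∣ ∁ S ∣) (λ q → h (x ∷ p) q)))
      ≈⟨ ∑-∷ xs ∣ S ∣ (λ p → ∑ (allVecs xs ∣ ∁ S ∣) (λ q → h p q)) ⟨
    ∑ (allVecs xs (suc ∣ S ∣)) (λ p → ∑ (allVecs xs ∣ ∁ S ∣) (λ q → h p q)) ∎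
  ∑-split xs {suc n} (outside ∷ S) h = begin
    ∑ (allVecs xs (suc n)) (λ v → h (restrict (outside ∷ S) v) (restrict (inside ∷ ∁ S) v))
      ≈⟨ ∑-∷ xs n _ ⟩
    ∑ xs (λ x → ∑ (allVecs xs n) (λ v → h (restrict S v) (x ∷ restrict (∁ S) v)))
      ≈⟨ ∑-cong xs (λ x → ∑-split xs S (λ p q → h p (x ∷ q))) ⟩
    ∑ xs (λ x → ∑ (allVecs xs ∣ S ∣) (λ p → ∑ (allVecs xs ∣ ∁ S ∣) (λ q → h p (x ∷ q))))
      ≈⟨ ∑-comm xs (allVecs xs ∣ S ∣) _ ⟩
    ∑ (allVecs xs ∣ S ∣) (λ p → ∑ xs (λ x → ∑ (allVecs xs ∣ ∁ S ∣) (λ q → h p (x ∷ q))))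
      ≈⟨ ∑-cong (allVecs xs ∣ S ∣) (λ p → sym (∑-∷ xs ∣ ∁ S ∣ (h p))) ⟩
    ∑ (allVecs xs ∣ S ∣) (λ p → ∑ (allVecs xs (suc ∣ ∁ S ∣)) (λ q → h p q)) ∎

  -- The hypothesis says, in terms of sums, that (π₁, π₂) is a bijection onto pairs. With π₁ and π₂
  -- the restrictions of a row to T and `∁ T`, this splits the columns of a graph.
  ∑-split-map : ∀ (xs : List A) (ys : List B) (zs : List C) (π₁ : A → B) (π₂ : A → C) →
    (∀ (h : B → C → Carrier) → ∑ xs (λ x → h (π₁ x) (π₂ x)) ≈ ∑ ys (λ y → ∑ zs (h y))) →
    ∀ n (h : Vec B n → Vec C n → Carrier) → ∑ (allVecs xs n) (λ v → h (Vec.map π₁ v) (Vec.map π₂ v)) ≈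
            ∑ (allVecs ys n) (λ p → ∑ (allVecs zs n) (h p))
  ∑-split-map xs ys zs π₁ π₂ e zero    h = sym (+-identityʳ _)
  ∑-split-map xs ys zs π₁ π₂ e (suc n) h = begin
    ∑ (allVecs xs (suc n)) (λ v → h (Vec.map π₁ v) (Vec.map π₂ v))
      ≈⟨ ∑-∷ xs n _ ⟩
    ∑ xs (λ x → ∑ (allVecs xs n) (λ v → h (π₁ x ∷ Vec.map π₁ v) (π₂ x ∷ Vec.map π₂ v)))
      ≈⟨ ∑-cong xs (λ x → ∑-split-map xs ys zs π₁ π₂ e n (λ p q → h (π₁ x ∷ p) (π₂ x ∷ q))) ⟩
    ∑ xs (λ x → ∑ (allVecs ys n) (λ p → ∑ (allVecs zs n) (λ q → h (π₁ x ∷ p) (π₂ x ∷ q))))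
      ≈⟨ e (λ y z → ∑ (allVecs ys n) (λ p → ∑ (allVecs zs n) (λ q → h (y ∷ p) (z ∷ q)))) ⟩
    ∑ ys (λ y → ∑ zs (λ z → ∑ (allVecs ys n) (λ p → ∑ (allVecs zs n) (λ q → h (y ∷ p) (z ∷ q)))))
      ≈⟨ ∑-cong ys (λ y → ∑-comm zs (allVecs ys n) _) ⟩
    ∑ ys (λ y → ∑ (allVecs ys n) (λ p → ∑ zs (λ z → ∑ (allVecs zs n) (λ q → h (y ∷ p) (z ∷ q)))))
      ≈⟨ ∑-cong ys (λ y → ∑-cong (allVecs ys n) (λ p → sym (∑-∷ zs n (h (y ∷ p))))) ⟩
    ∑ ys (λ y → ∑ (allVecs ys n) (λ p → ∑ (allVecs zs (suc n)) (h (y ∷ p))))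
      ≈⟨ ∑-∷ ys n (λ p → ∑ (allVecs zs (suc n)) (h p)) ⟨
    ∑ (allVecs ys (suc n)) (λ p → ∑ (allVecs zs (suc n)) (h p)) ∎

  ⟦_⟧? : ∀ {P : Set} → Dec P → Carrier
  ⟦ P? ⟧? = if does P? then 1# else 0#

  ⟦⟧?-cong : ∀ {P Q : Set} (P? : Dec P) (Q? : Dec Q) → (P → Q) → (Q → P) → ⟦ P? ⟧? ≈ ⟦ Q? ⟧?
  ⟦⟧?-cong (yes p) (yes q) f g = refl
  ⟦⟧?-cong (yes p) (no ¬q) f g = contradiction (f p) ¬q
  ⟦⟧?-cong (no ¬p) (yes q) f g = contradiction (g q) ¬p
  ⟦⟧?-cong (no ¬p) (no ¬q) f g = refl

  ⟦⟧?-× : ∀ {P Q : Set} (P? : Dec P) (Q? : Dec Q) → ⟦ P? ×-dec Q? ⟧? ≈ ⟦ P? ⟧? * ⟦ Q? ⟧?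
  ⟦⟧?-× (yes p) (yes q) = sym (*-identityˡ 1#)
  ⟦⟧?-× (yes p) (no ¬q) = sym (zeroʳ 1#)
  ⟦⟧?-× (no ¬p) Q?      = sym (zeroˡ _)

_≟ˢ_ : ∀ {n} → DecidableEquality (Subset n)
_≟ˢ_ = Vecₚ.≡-dec Boolₚ._≟_

module ComponentSum {c ℓ} (R : CommutativeRing c ℓ) where
  open CommutativeRing R
  open Relation.Binary.Reasoning.Setoid setoid
  open RingSolver R
  open Algebra.Properties.Semiring.Exp semiring
  open ListSum R

  ∑-≟ˢ : ∀ {n} (p : Subset n) → ∑ (subsets n) (λ q → ⟦ q ≟ˢ p ⟧?) ≈ 1#
  ∑-≟ˢ []      = +-identityʳ 1#
  ∑-≟ˢ {suc n} (x ∷ p) = trans (∑-subsets-suc n _) (at x)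
    where
    same : ∀ b → ∑ (subsets n) (λ q → ⟦ (b ∷ q) ≟ˢ (b ∷ p) ⟧?) ≈ 1#
    same b = trans (∑-cong (subsets n) (λ q →
      ⟦⟧?-cong ((b ∷ q) ≟ˢ (b ∷ p)) (q ≟ˢ p) Vecₚ.∷-injectiveʳ (≡.cong (b ∷_)))) (∑-≟ˢ p)
    other : ∀ a b → a ≡.≢ b → ∑ (subsets n) (λ q → ⟦ (a ∷ q) ≟ˢ (b ∷ p) ⟧?) ≈ 0#
    other a b a≢b = trans (∑-cong (subsets n) (λ q →
      ⟦⟧?-cong {Q = a ≡ b} ((a ∷ q) ≟ˢ (b ∷ p)) (no a≢b) Vecₚ.∷-injectiveˡ
        (λ e → contradiction e a≢b))) (∑-zero (subsets n))
    at : ∀ b → ∑ (subsets n) (λ q → ⟦ (inside ∷ q) ≟ˢ (b ∷ p) ⟧?) +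
               ∑ (subsets n) (λ q → ⟦ (outside ∷ q) ≟ˢ (b ∷ p) ⟧?) ≈ 1#
    at inside  = trans (+-cong (same inside) (other outside inside λ ())) (+-identityʳ 1#)
    at outside = trans (+-cong (other inside outside λ ()) (same outside)) (+-identityˡ 1#)

  -- With the convention 0⁰ = 1, edges of weight `0#` select the edgeless blocks by a factor that is
  -- multiplicative over blocks.
  0^≈⟦⟧? : ∀ n → 0# ^ n ≈ ⟦ n ℕₚ.≟ 0 ⟧?
  0^≈⟦⟧? zero    = refl
  0^≈⟦⟧? (suc n) = zeroˡ _

  ^*0^ : ∀ q n → q ^ n * 0# ^ n ≈ 0# ^ n
  ^*0^ q zero    = *-identityˡ 1#
  ^*0^ q (suc n) = trans (*-congˡ (zeroˡ _)) (trans (zeroʳ _) (sym (zeroˡ _)))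

  ∑-subsets-^ : ∀ q n → ∑ (subsets n) (λ p → q ^ ∣ p ∣) ≈ (1# + q) ^ n
  ∑-subsets-^ q zero    = +-identityʳ 1#
  ∑-subsets-^ q (suc n) = begin
    ∑ (subsets (suc n)) (λ p → q ^ ∣ p ∣)
      ≈⟨ ∑-subsets-suc n _ ⟩
    ∑ (subsets n) (λ p → q * q ^ ∣ p ∣) + ∑ (subsets n) (λ p → q ^ ∣ p ∣)
      ≈⟨ +-congʳ (∑-*ˡ (subsets n) q _) ⟩
    q * ∑ (subsets n) (λ p → q ^ ∣ p ∣) + ∑ (subsets n) (λ p → q ^ ∣ p ∣)
      ≈⟨ solve 2 (λ q s → q :* s :+ s := (con (+ 1) :+ q) :* s) refl q _ ⟩
    (1# + q) * ∑ (subsets n) (λ p → q ^ ∣ p ∣)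
      ≈⟨ *-congˡ (∑-subsets-^ q n) ⟩
    (1# + q) ^ suc n ∎
    where open import Data.Integer.Base using (+_)

  all : Carrier → ℕ → ℕ → Carrier
  all q r s = ∑ (allGraphs r s) (λ g → q ^ edgeCount g)

  -- Rows are independent and each is an arbitrary subset of V₂. The power stays nested because it
  -- is differentiated one exponent at a time.
  all-closed : ∀ q r s → all q r s ≈ ((1# + q) ^ s) ^ r
  all-closed q zero    s = +-identityʳ 1#
  all-closed q (suc r) s = begin
    all q (suc r) s
      ≈⟨ ∑-∷ (subsets s) r _ ⟩
    ∑ (subsets s) (λ row → ∑ (allGraphs r s) (λ g → q ^ (∣ row ∣ ℕ.+ edgeCount g)))
      ≈⟨ ∑-cong (subsets s) (λ row → ∑-cong (allGraphs r s) (λ g →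
           ^-homo-* q ∣ row ∣ (edgeCount g))) ⟩
    ∑ (subsets s) (λ row → ∑ (allGraphs r s) (λ g → q ^ ∣ row ∣ * q ^ edgeCount g))
      ≈⟨ ∑-cong (subsets s) (λ row → ∑-*ˡ (allGraphs r s) (q ^ ∣ row ∣) _) ⟩
    ∑ (subsets s) (λ row → q ^ ∣ row ∣ * all q r s)
      ≈⟨ ∑-*ʳ (subsets s) (all q r s) _ ⟩
    ∑ (subsets s) (λ row → q ^ ∣ row ∣) * all q r s
      ≈⟨ *-cong (∑-subsets-^ q s) (all-closed q r s) ⟩
    ((1# + q) ^ s) ^ suc r ∎

  1^ : ∀ n → 1# ^ n ≈ 1#
  1^ zero    = refl
  1^ (suc n) = trans (*-identityˡ _) (1^ n)

  -- Used for the two crossing blocks: at weight `0#` only the empty graph contributes, so their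
  -- sums disappear from the product.
  all-0 : ∀ r s → all 0# r s ≈ 1#
  all-0 r s = trans (all-closed 0# r s)
    (trans (^-congˡ r (trans (^-congˡ s (+-identityʳ 1#)) (1^ s))) (1^ r))

  conn : Carrier → ℕ → ℕ → Carrier
  conn q r s = ∑ (allGraphs r s) (λ g → ⟦ connected? g ⟧? * q ^ edgeCount g)

  -- Inserted as a factor `1#` below a sum over graphs, this replaces the component of each graph by
  -- a sum over all pairs (S, T), which can then be moved outside.
  component-unique : ∀ {r s} (g : Graph (suc r) s) →
    ∑ (subsets r) (λ S → ∑ (subsets s) (λ T →
      ⟦ connected? (block (inside ∷ S) T g) ⟧? *
      0# ^ (edgeCount (block (inside ∷ S) (∁ T) g) ℕ.+ edgeCount (block (outside ∷ ∁ S) T g))))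
    ≈ 1#
  component-unique {r} {s} g = begin
    _ ≈⟨ ∑-cong (subsets r) (λ S → ∑-cong (subsets s) (indicator S)) ⟩
    ∑ (subsets r) (λ S → ∑ (subsets s) (λ T → ⟦ S ≟ˢ component₁ ⟧? * ⟦ T ≟ˢ component₂ ⟧?))
      ≈⟨ ∑-cong (subsets r) (λ S →
           trans (∑-*ˡ (subsets s) ⟦ S ≟ˢ component₁ ⟧? _)
                 (trans (*-congˡ (∑-≟ˢ component₂)) (*-identityʳ _))) ⟩
    ∑ (subsets r) (λ S → ⟦ S ≟ˢ component₁ ⟧?)
      ≈⟨ ∑-≟ˢ component₁ ⟩
    1# ∎
    where
    open Component g
    indicator : ∀ S T →
      ⟦ connected? (block (inside ∷ S) T g) ⟧? *
      0# ^ (edgeCount (block (inside ∷ S) (∁ T) g) ℕ.+ edgeCount (block (outside ∷ ∁ S) T g))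
      ≈ ⟦ S ≟ˢ component₁ ⟧? * ⟦ T ≟ˢ component₂ ⟧?
    indicator S T = begin
      ⟦ conn? ⟧? * 0# ^ cross                              ≈⟨ *-congˡ (0^≈⟦⟧? cross) ⟩
      ⟦ conn? ⟧? * ⟦ cross ℕₚ.≟ 0 ⟧?                       ≈⟨ ⟦⟧?-× conn? (cross ℕₚ.≟ 0) ⟨
      ⟦ conn? ×-dec (cross ℕₚ.≟ 0) ⟧?
        ≈⟨ ⟦⟧?-cong (conn? ×-dec (cross ℕₚ.≟ 0)) ((S ≟ˢ component₁) ×-dec (T ≟ˢ component₂))
             isComponent⇒≡ (λ { (≡.refl , ≡.refl) → component-isComponent }) ⟩
      ⟦ (S ≟ˢ component₁) ×-dec (T ≟ˢ component₂) ⟧?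
        ≈⟨ ⟦⟧?-× (S ≟ˢ component₁) (T ≟ˢ component₂) ⟩
      ⟦ S ≟ˢ component₁ ⟧? * ⟦ T ≟ˢ component₂ ⟧?          ∎
      where
      conn? = connected? (block (inside ∷ S) T g)
      cross = edgeCount (block (inside ∷ S) (∁ T) g) ℕ.+ edgeCount (block (outside ∷ ∁ S) T g)

  ∑-blocks : ∀ {r s} (S : Subset r) (T : Subset s)
    (h : Graph ∣ S ∣ ∣ T ∣ → Graph ∣ S ∣ ∣ ∁ T ∣ → Graph ∣ ∁ S ∣ ∣ T ∣ → Graph ∣ ∁ S ∣ ∣ ∁ T ∣ → Carrier) →
    ∑ (allGraphs r s) (λ g → h (block S T g) (block S (∁ T) g) (block (∁ S) T g) (block (∁ S) (∁ T) g)) ≈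
    ∑ (allGraphs ∣ S ∣ ∣ T ∣) (λ a → ∑ (allGraphs ∣ S ∣ ∣ ∁ T ∣) (λ b →
      ∑ (allGraphs ∣ ∁ S ∣ ∣ T ∣) (λ c → ∑ (allGraphs ∣ ∁ S ∣ ∣ ∁ T ∣) (λ d → h a b c d))))
  ∑-blocks {r} {s} S T h = begin
    ∑ (allGraphs r s) (λ g → h (block S T g) (block S (∁ T) g) (block (∁ S) T g) (block (∁ S) (∁ T) g))
      ≈⟨ ∑-split (subsets s) S (λ p q → h (Vec.map (restrict T) p) (Vec.map (restrict (∁ T)) p)
                                         (Vec.map (restrict T) q) (Vec.map (restrict (∁ T)) q)) ⟩
    ∑ (allGraphs ∣ S ∣ s) (λ p → ∑ (allGraphs ∣ ∁ S ∣ s) (λ q →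
      h (Vec.map (restrict T) p) (Vec.map (restrict (∁ T)) p)
        (Vec.map (restrict T) q) (Vec.map (restrict (∁ T)) q)))
      ≈⟨ ∑-cong (allGraphs ∣ S ∣ s) (λ p → columns ∣ ∁ S ∣
           (h (Vec.map (restrict T) p) (Vec.map (restrict (∁ T)) p))) ⟩
    ∑ (allGraphs ∣ S ∣ s) (λ p → ∑ (allGraphs ∣ ∁ S ∣ ∣ T ∣) (λ c → ∑ (allGraphs ∣ ∁ S ∣ ∣ ∁ T ∣) (λ d →
      h (Vec.map (restrict T) p) (Vec.map (restrict (∁ T)) p) c d)))
      ≈⟨ columns ∣ S ∣ (λ a b → ∑ (allGraphs ∣ ∁ S ∣ ∣ T ∣) (λ c →
           ∑ (allGraphs ∣ ∁ S ∣ ∣ ∁ T ∣) (λ d → h a b c d))) ⟩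
    ∑ (allGraphs ∣ S ∣ ∣ T ∣) (λ a → ∑ (allGraphs ∣ S ∣ ∣ ∁ T ∣) (λ b →
      ∑ (allGraphs ∣ ∁ S ∣ ∣ T ∣) (λ c → ∑ (allGraphs ∣ ∁ S ∣ ∣ ∁ T ∣) (λ d → h a b c d)))) ∎
    where
    columns : ∀ m (h : Graph m ∣ T ∣ → Graph m ∣ ∁ T ∣ → Carrier) →
      ∑ (allGraphs m s) (λ p → h (Vec.map (restrict T) p) (Vec.map (restrict (∁ T)) p)) ≈
      ∑ (allGraphs m ∣ T ∣) (λ a → ∑ (allGraphs m ∣ ∁ T ∣) (h a))
    columns = ∑-split-map (subsets s) (subsets ∣ T ∣) (subsets ∣ ∁ T ∣)
                (restrict T) (restrict (∁ T)) (∑-split (inside ∷ outside ∷ []) T)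

  edgeCount-block : ∀ {r s} (S : Subset r) (T : Subset s) (g : Graph r s) →
    edgeCount g ≡ (edgeCount (block S T g) ℕ.+ edgeCount (block S (∁ T) g)) ℕ.+
                  (edgeCount (block (∁ S) T g) ℕ.+ edgeCount (block (∁ S) (∁ T) g))
  edgeCount-block S T g = ≡.trans (edgeCount-restrict S g)
    (≡.cong₂ ℕ._+_ (edgeCount-map-restrict T (restrict S g))
                   (edgeCount-map-restrict T (restrict (∁ S) g)))

  -- Split off the component of the first vertex of V₁. Edges leaving the
  -- component are given weight 0, so that a power of 0# excludes them.
  all-by-component : ∀ q r s →
    all q (suc r) s ≈
    ∑ (subsets r) (λ S → ∑ (subsets s) (λ T →
      conn q (suc ∣ S ∣) ∣ T ∣ * all q ∣ ∁ S ∣ ∣ ∁ T ∣))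
  all-by-component q r s = begin
    ∑ (allGraphs (suc r) s) (λ g → q ^ edgeCount g)
      ≈⟨ ∑-cong (allGraphs (suc r) s) (λ g →
           trans (sym (*-identityʳ _)) (*-congˡ (sym (component-unique g)))) ⟩
    ∑ (allGraphs (suc r) s) (λ g → q ^ edgeCount g *
        ∑ (subsets r) (λ S → ∑ (subsets s) (term g S)))
      ≈⟨ ∑-cong (allGraphs (suc r) s) (λ g →
           trans (sym (∑-*ˡ (subsets r) (q ^ edgeCount g) (λ S → ∑ (subsets s) (term g S))))
             (∑-cong (subsets r) (λ S → sym (∑-*ˡ (subsets s) (q ^ edgeCount g) (term g S))))) ⟩
    ∑ (allGraphs (suc r) s) (λ g →
      ∑ (subsets r) (λ S → ∑ (subsets s) (λ T → q ^ edgeCount g * term g S T)))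
      ≈⟨ ∑-comm (allGraphs (suc r) s) (subsets r)
           (λ g S → ∑ (subsets s) (λ T → q ^ edgeCount g * term g S T)) ⟩
    ∑ (subsets r) (λ S → ∑ (allGraphs (suc r) s) (λ g →
      ∑ (subsets s) (λ T → q ^ edgeCount g * term g S T)))
      ≈⟨ ∑-cong (subsets r) (λ S → ∑-comm (allGraphs (suc r) s) (subsets s)
           (λ g T → q ^ edgeCount g * term g S T)) ⟩
    ∑ (subsets r) (λ S → ∑ (subsets s) (λ T →
      ∑ (allGraphs (suc r) s) (λ g → q ^ edgeCount g * term g S T)))
      ≈⟨ ∑-cong (subsets r) (λ S → ∑-cong (subsets s) (λ T → fixed S T)) ⟩
    _ ∎
    where
    term : Graph (suc r) s → Subset r → Subset s → Carrier
    term g S T = ⟦ connected? (block (inside ∷ S) T g) ⟧? *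
      0# ^ (edgeCount (block (inside ∷ S) (∁ T) g) ℕ.+ edgeCount (block (outside ∷ ∁ S) T g))

    regroup : ∀ k a b c d →
      q ^ ((a ℕ.+ b) ℕ.+ (c ℕ.+ d)) * (k * 0# ^ (b ℕ.+ c)) ≈
      ((k * q ^ a) * 0# ^ b) * (0# ^ c * q ^ d)
    regroup k a b c d = begin
      q ^ ((a ℕ.+ b) ℕ.+ (c ℕ.+ d)) * (k * 0# ^ (b ℕ.+ c))
        ≈⟨ *-cong (trans (^-homo-* q (a ℕ.+ b) (c ℕ.+ d))
                         (*-cong (^-homo-* q a b) (^-homo-* q c d)))
                  (*-congˡ (^-homo-* 0# b c)) ⟩
      (q ^ a * q ^ b) * (q ^ c * q ^ d) * (k * (0# ^ b * 0# ^ c))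
        ≈⟨ solve 7 (λ a b c d k x y → (a :* b) :* (c :* d) :* (k :* (x :* y)) :=
                     ((k :* a) :* (b :* x)) :* ((c :* y) :* d)) refl
             (q ^ a) (q ^ b) (q ^ c) (q ^ d) k (0# ^ b) (0# ^ c) ⟩
      ((k * q ^ a) * (q ^ b * 0# ^ b)) * ((q ^ c * 0# ^ c) * q ^ d)
        ≈⟨ *-cong (*-congˡ (^*0^ q b)) (*-congʳ (^*0^ q c)) ⟩
      ((k * q ^ a) * 0# ^ b) * (0# ^ c * q ^ d) ∎

    fixed : ∀ S T → ∑ (allGraphs (suc r) s) (λ g → q ^ edgeCount g * term g S T) ≈
                    conn q (suc ∣ S ∣) ∣ T ∣ * all q ∣ ∁ S ∣ ∣ ∁ T ∣
    fixed S T = begin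
      ∑ (allGraphs (suc r) s) (λ g → q ^ edgeCount g * term g S T)
        ≈⟨ ∑-cong (allGraphs (suc r) s) (λ g → trans
             (*-congʳ (^-congʳ q (edgeCount-block (inside ∷ S) T g)))
             (regroup ⟦ connected? (block (inside ∷ S) T g) ⟧?
               (edgeCount (block (inside ∷ S) T g)) (edgeCount (block (inside ∷ S) (∁ T) g))
               (edgeCount (block (outside ∷ ∁ S) T g))
               (edgeCount (block (outside ∷ ∁ S) (∁ T) g)))) ⟩
      ∑ (allGraphs (suc r) s) (λ g →
        (wa (block (inside ∷ S) T g) * wb (block (inside ∷ S) (∁ T) g)) *
        (wc (block (outside ∷ ∁ S) T g) * wd (block (outside ∷ ∁ S) (∁ T) g)))
        ≈⟨ ∑-blocks (inside ∷ S) T (λ a b c d → (wa a * wb b) * (wc c * wd d)) ⟩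
      ∑ As (λ a → ∑ Bs (λ b → ∑ Cs (λ c → ∑ Ds (λ d → (wa a * wb b) * (wc c * wd d)))))
        ≈⟨ ∑-product As Bs Cs Ds wa wb wc wd ⟩
      (∑ As wa * ∑ Bs wb) * (∑ Cs wc * ∑ Ds wd)
        ≈⟨ *-cong (*-congˡ (all-0 (suc ∣ S ∣) ∣ ∁ T ∣)) (*-congʳ (all-0 ∣ ∁ S ∣ ∣ T ∣)) ⟩
      (∑ As wa * 1#) * (1# * ∑ Ds wd)
        ≈⟨ *-cong (*-identityʳ _) (*-identityˡ _) ⟩
      conn q (suc ∣ S ∣) ∣ T ∣ * all q ∣ ∁ S ∣ ∣ ∁ T ∣ ∎
      where
      As = allGraphs (suc ∣ S ∣) ∣ T ∣
      Bs = allGraphs (suc ∣ S ∣) ∣ ∁ T ∣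
      Cs = allGraphs ∣ ∁ S ∣ ∣ T ∣
      Ds = allGraphs ∣ ∁ S ∣ ∣ ∁ T ∣
      wa : Graph (suc ∣ S ∣) ∣ T ∣ → Carrier
      wa g = ⟦ connected? g ⟧? * q ^ edgeCount g
      wb : Graph (suc ∣ S ∣) ∣ ∁ T ∣ → Carrier
      wb g = 0# ^ edgeCount g
      wc : Graph ∣ ∁ S ∣ ∣ T ∣ → Carrier
      wc g = 0# ^ edgeCount g
      wd : Graph ∣ ∁ S ∣ ∣ ∁ T ∣ → Carrier
      wd g = q ^ edgeCount g

-- The series of connected graphs

-- The logarithm C of a series G, described by Dx G = Dx C * G, in a ring where
-- an element is determined by its x-derivative and its constant term in x.
module Logarithm {c ℓ} (R : CommutativeRing c ℓ) (δˣ δʸ δᵘ : Derivation R) where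

  open CommutativeRing R
  open Derivation δˣ using () renaming (D to Dx)
  open Derivation δʸ using () renaming (D to Dy)
  open Derivation δᵘ using () renaming (D to Δ)
  open RingSolver R
  open Relation.Binary.Reasoning.Setoid setoid
  open Algebra.Properties.AbelianGroup +-abelianGroup using (x∙y⁻¹≈ε⇒x≈y; x≈y⇒x∙y⁻¹≈ε)
  private
    module X = Derivation δˣ
    module Y = Derivation δʸ
    module V = Derivation δᵘ

  module _ {p} (Zero₀ : Carrier → Set p) (Q G C : Carrier)
    (DxDy : ∀ x → Dx (Dy x) ≈ Dy (Dx x))
    (DxΔ : ∀ x → Dx (Δ x) ≈ Δ (Dx x))
    (kernel : ∀ x → Dx x ≈ 0# → Zero₀ x → x ≈ 0#)
    (unique : ∀ x → Dx x ≈ Dx C * x → Zero₀ x → x ≈ 0#)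
    (regular : ∀ x → G * x ≈ 0# → x ≈ 0#)
    (DxG : Dx G ≈ Dx C * G)
    (ΔG : Δ G ≈ Q * Dx (Dy G))
    (boundary-Dy : Zero₀ (Dy G - Dy C * G))
    (boundary-Δ : Zero₀ (Δ C - Q * (Dx (Dy C) + Dx C * Dy C)))
    where

    -- The difference of the two sides solves the same linear equation in x as `G` does, and it
    -- vanishes at x = 0.
    DyG : Dy G ≈ Dy C * G
    DyG = x∙y⁻¹≈ε⇒x≈y _ _ (unique _ (begin
      Dx (Dy G - Dy C * G)
        ≈⟨ trans (X.D-- _ _) (+-cong (trans (DxDy G) (trans (Y.D-cong DxG) (Y.D-* _ _)))
                                     (-‿cong (trans (X.D-* _ _) (+-cong (*-congʳ (DxDy C)) (*-congˡ DxG))))) ⟩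
      (Dy (Dx C) * G + Dx C * Dy G) - (Dy (Dx C) * G + Dy C * (Dx C * G))
        ≈⟨ solve 5 (λ a b c g d → (a :* g :+ b :* d) :- (a :* g :+ c :* (b :* g)) := b :* (d :- c :* g))
             refl (Dy (Dx C)) (Dx C) (Dy C) G (Dy G) ⟩
      Dx C * (Dy G - Dy C * G) ∎) boundary-Dy)

    private
      Y : Carrier
      Y = Q * (Dx (Dy C) + Dx C * Dy C)

      ΔG≈YG : Δ G ≈ Y * G
      ΔG≈YG = begin
        Δ G                                         ≈⟨ ΔG ⟩
        Q * Dx (Dy G)                               ≈⟨ *-congˡ (trans (X.D-cong DyG) (X.D-* _ _)) ⟩
        Q * (Dx (Dy C) * G + Dy C * Dx G)           ≈⟨ *-congˡ (+-congˡ (*-congˡ DxG)) ⟩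
        Q * (Dx (Dy C) * G + Dy C * (Dx C * G))
          ≈⟨ solve 5 (λ q a b c g → q :* (a :* g :+ c :* (b :* g)) := q :* (a :+ b :* c) :* g) refl
               Q (Dx (Dy C)) (Dx C) (Dy C) G ⟩
        Y * G                                       ∎

    -- `Dx` and `Δ` multiply `G` by `Dx C` and `Y`. As they commute, `G * (Δ (Dx C) - Dx Y)`
    -- vanishes; cancelling `G` leaves `Dx (Δ C - Y) ≈ 0#`, and `boundary-Δ` fixes the constant of
    -- integration.
    log-pde : Δ C ≈ Q * (Dx (Dy C) + Dx C * Dy C)
    log-pde = x∙y⁻¹≈ε⇒x≈y _ _ (kernel _ (regular _ (begin
      G * Dx (Δ C - Y)
        ≈⟨ *-congˡ (trans (X.D-- _ _) (+-congʳ (DxΔ C))) ⟩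
      G * (Δ (Dx C) - Dx Y)
        ≈⟨ solve 5 (λ g a b c y → g :* (a :- b) :=
             (a :* g :+ c :* (y :* g)) :- (b :* g :+ y :* (c :* g))) refl G (Δ (Dx C)) (Dx Y) (Dx C) Y ⟩
      (Δ (Dx C) * G + Dx C * (Y * G)) - (Dx Y * G + Y * (Dx C * G))
        ≈⟨ x≈y⇒x∙y⁻¹≈ε (begin
          Δ (Dx C) * G + Dx C * (Y * G)    ≈⟨ +-congˡ (*-congˡ ΔG≈YG) ⟨
          Δ (Dx C) * G + Dx C * Δ G        ≈⟨ V.D-* _ _ ⟨
          Δ (Dx C * G)                     ≈⟨ V.D-cong DxG ⟨
          Δ (Dx G)                         ≈⟨ DxΔ G ⟨
          Dx (Δ G)                         ≈⟨ X.D-cong ΔG≈YG ⟩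
          Dx (Y * G)                       ≈⟨ X.D-* _ _ ⟩
          Dx Y * G + Y * Dx G              ≈⟨ +-congˡ (*-congˡ DxG) ⟩
          Dx Y * G + Y * (Dx C * G)        ∎) ⟩
      0# ∎)) boundary-Δ)

module Labelled {c ℓ} (R : CommutativeRing c ℓ) (ρ : Reciprocals R) where
  open CommutativeRing R
  open Numerals R
  open Reciprocals ρ
  open Series R
  open RingSolver R
  open ListSum R
  open Relation.Binary.Reasoning.Setoid setoid
  private module E = Derivation euler

  egf : (ℕ → Carrier) → ℕ → Carrier
  egf f n = 1/ n ! * f n

  nat*egf : ∀ f n → nat (suc n) * egf f (suc n) ≈ egf (tail f) n
  nat*egf f n = trans (sym (*-assoc _ _ _)) (*-congʳ (nat*1/! n))

  E-egf-⊛ : ∀ f b n → (E.D (egf f) ⊛ b) (suc n) ≈ (egf (tail f) ⊛ b) n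
  E-egf-⊛ f b n = begin
    0# * egf f 0 * b (suc n) + (tail (E.D (egf f)) ⊛ b) n
      ≈⟨ +-cong (trans (*-congʳ (zeroˡ _)) (zeroˡ _)) (⊛-cong {b = b} (nat*egf f) (λ _ → refl) n) ⟩
    0# + (egf (tail f) ⊛ b) n
      ≈⟨ +-identityˡ _ ⟩
    (egf (tail f) ⊛ b) n ∎

  -- The product rule takes the place of binomial coefficients: its two terms shift `f` or `g`,
  -- which matches the first element lying in S or in its complement.
  egf-⊛ : ∀ f g n → (egf f ⊛ egf g) n ≈ 1/ n ! * ∑ (subsets n) (λ S → f ∣ S ∣ * g ∣ ∁ S ∣)
  egf-⊛ f g zero    = begin
    (1# * f 0) * (1# * g 0)    ≈⟨ solve 2 (λ x y → (con (+ 1) :* x) :* (con (+ 1) :* y) :=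
                                                  con (+ 1) :* (x :* y :+ con (+ 0))) refl (f 0) (g 0) ⟩
    1# * (f 0 * g 0 + 0#)      ∎
  egf-⊛ f g (suc n) = nat-cancel-≈ n (begin
    nat (suc n) * (egf f ⊛ egf g) (suc n)
      ≈⟨ E.D-* (egf f) (egf g) (suc n) ⟩
    (E.D (egf f) ⊛ egf g) (suc n) + (egf f ⊛ E.D (egf g)) (suc n)
      ≈⟨ +-cong (E-egf-⊛ f (egf g) n)
                (trans (⊛-comm (egf f) (E.D (egf g)) (suc n))
                  (trans (E-egf-⊛ g (egf f) n) (⊛-comm (egf (tail g)) (egf f) n))) ⟩
    (egf (tail f) ⊛ egf g) n + (egf f ⊛ egf (tail g)) n
      ≈⟨ +-cong (egf-⊛ (tail f) g n) (egf-⊛ f (tail g) n) ⟩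
    1/ n ! * ∑ (subsets n) (λ S → f (suc ∣ S ∣) * g ∣ ∁ S ∣) +
    1/ n ! * ∑ (subsets n) (λ S → f ∣ S ∣ * g (suc ∣ ∁ S ∣))
      ≈⟨ distribˡ _ _ _ ⟨
    1/ n ! * (∑ (subsets n) (λ S → f (suc ∣ S ∣) * g ∣ ∁ S ∣) +
              ∑ (subsets n) (λ S → f ∣ S ∣ * g (suc ∣ ∁ S ∣)))
      ≈⟨ *-congˡ (∑-subsets-suc n (λ S → f ∣ S ∣ * g ∣ ∁ S ∣)) ⟨
    1/ n ! * ∑ (subsets (suc n)) (λ S → f ∣ S ∣ * g ∣ ∁ S ∣)
      ≈⟨ *-congʳ (nat*1/! n) ⟨
    nat (suc n) * 1/ suc n ! * ∑ (subsets (suc n)) (λ S → f ∣ S ∣ * g ∣ ∁ S ∣)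
      ≈⟨ *-assoc _ _ _ ⟩
    nat (suc n) * (1/ suc n ! * ∑ (subsets (suc n)) (λ S → f ∣ S ∣ * g ∣ ∁ S ∣)) ∎)

  private
    module S = Reciprocals (reciprocals ρ)
    module SL = ListSum commutativeRing

  series-1/! : ∀ n a k → (S.1/ n ! ⊛ a) k ≈ 1/ n ! * a k
  series-1/! zero    a k = ⊛-constantˡ 1# a k
  series-1/! (suc n) a k = begin
    ((constant (recip n) ⊛ S.1/ n !) ⊛ a) k   ≈⟨ ⊛-assoc (constant (recip n)) S.1/ n ! a k ⟩
    (constant (recip n) ⊛ (S.1/ n ! ⊛ a)) k   ≈⟨ ⊛-constantˡ (recip n) (S.1/ n ! ⊛ a) k ⟩
    recip n * (S.1/ n ! ⊛ a) k                ≈⟨ *-congˡ (series-1/! n a k) ⟩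
    recip n * (1/ n ! * a k)                  ≈⟨ *-assoc _ _ _ ⟨
    1/ suc n ! * a k                          ∎

  ∑-coefficient : ∀ {A : Set} (xs : List A) (f : A → ℕ → Carrier) n →
                  SL.∑ xs f n ≈ ∑ xs (λ x → f x n)
  ∑-coefficient []       f n = refl
  ∑-coefficient (x ∷ xs) f n = +-congˡ (∑-coefficient xs f n)

-- An element of ℕ → ℕ → K is a series in x over series in y over K, where q ∈ K is
-- the weight of an edge.
module ConnectedSeries {c ℓ} (K : CommutativeRing c ℓ) (ρ : Reciprocals K) (δ : Derivation K) where

  open CommutativeRing K
  open Numerals K
  open Reciprocals ρ
  open Derivation δ
  open ListSum K using (∑-cong; ∑-*ˡ) renaming (∑ to ∑ᴷ)
  open ComponentSum K
  open RingSolver K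
  open Algebra.Properties.Semiring.Exp semiring
  module S₁ = Series K
  R₁ = S₁.commutativeRing
  module S₂ = Series R₁
  R₂ = S₂.commutativeRing
  private
    module R₁ = CommutativeRing R₁
    module R₂ = CommutativeRing R₂
    ρ₁ = S₁.reciprocals ρ
    module L₁ = Labelled K ρ
    module L₂ = Labelled R₁ ρ₁
    module ρ₁ = Reciprocals ρ₁

  δˣ δʸ δᵘ : Derivation R₂
  δˣ = S₂.euler
  δʸ = S₂.pointwise S₁.euler
  δᵘ = S₂.pointwise (S₁.pointwise δ)

  open Derivation δˣ using () renaming (D to Dx)
  open Derivation δʸ using () renaming (D to Dy)
  open Derivation δᵘ using () renaming (D to Δ)

  egf₂ : (ℕ → ℕ → Carrier) → ℕ → ℕ → Carrier
  egf₂ f = L₂.egf (λ r → L₁.egf (f r))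

  egf₂-coefficient : ∀ f r s → egf₂ f r s ≈ 1/ r ! * (1/ s ! * f r s)
  egf₂-coefficient f r s = L₁.series-1/! r (L₁.egf (f r)) s

  module Weighted (q : Carrier) (D[1+q] : D (1# + q) ≈ q * (1# + q)) where

    -- Row 0 is not conn q 0, which counts the empty graph as connected.
    connected : ℕ → ℕ → Carrier
    connected zero    1 = 1#
    connected zero    _ = 0#
    connected (suc r) s = conn q (suc r) s

    C G Q : ℕ → ℕ → Carrier
    C = egf₂ connected
    G = egf₂ (all q)
    Q = S₂.constant (S₁.constant q)

    Q-⊛ : ∀ a r s → (Q S₂.⊛ a) r s ≈ q * a r s
    Q-⊛ a r s = trans (S₂.⊛-constantˡ (S₁.constant q) a r s) (S₁.⊛-constantˡ q (a r) s)

    private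
      -- The sum over T has become a product of series in y; the remaining sum over S becomes the
      -- product in x in `DxG`.
      rows : ∀ r → L₁.egf (all q (suc r)) S₁.≋
             ListSum.∑ R₁ (subsets r) (λ S → L₁.egf (connected (suc ∣ S ∣)) S₁.⊛ L₁.egf (all q ∣ ∁ S ∣))
      rows r s = begin
        1/ s ! * all q (suc r) s
          ≈⟨ *-congˡ (all-by-component q r s) ⟩
        1/ s ! * ∑ᴷ (subsets r) (λ S → ∑ᴷ (subsets s) (inner S))
          ≈⟨ ∑-*ˡ (subsets r) (1/ s !) (λ S → ∑ᴷ (subsets s) (inner S)) ⟨
        ∑ᴷ (subsets r) (λ S → 1/ s ! * ∑ᴷ (subsets s) (inner S))
          ≈⟨ ∑-cong (subsets r) (λ S →
               L₁.egf-⊛ (connected (suc ∣ S ∣)) (all q ∣ ∁ S ∣) s) ⟨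
        ∑ᴷ (subsets r) (λ S → (L₁.egf (connected (suc ∣ S ∣)) S₁.⊛ L₁.egf (all q ∣ ∁ S ∣)) s)
          ≈⟨ L₁.∑-coefficient (subsets r)
               (λ S → L₁.egf (connected (suc ∣ S ∣)) S₁.⊛ L₁.egf (all q ∣ ∁ S ∣)) s ⟨
        _ ∎
        where
        open Relation.Binary.Reasoning.Setoid setoid
        inner : Subset r → Subset s → Carrier
        inner S T = connected (suc ∣ S ∣) ∣ T ∣ * all q ∣ ∁ S ∣ ∣ ∁ T ∣

    -- On exponential series the Euler operator shifts the index: one vertex of V₁ is marked, and S
    -- records which of the other r share its component.
    DxG : Dx G S₂.≋ Dx C S₂.⊛ G
    DxG zero    = R₁.trans (R₁.zeroˡ (G 0)) (R₁.sym {Dx C 0 S₁.⊛ G 0} {S₁.𝟘}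
      (R₁.trans (R₁.*-congʳ {G 0} {Dx C 0} {S₁.𝟘} (R₁.zeroˡ (C 0))) (R₁.zeroˡ (G 0))))
    DxG (suc r) = begin
      Dx G (suc r)
        ≈⟨ L₂.nat*egf (λ r → L₁.egf (all q r)) r ⟩
      ρ₁.1/ r ! S₁.⊛ L₁.egf (all q (suc r))
        ≈⟨ R₁.*-congˡ {ρ₁.1/ r !} {L₁.egf (all q (suc r))} (rows r) ⟩
      ρ₁.1/ r ! S₁.⊛ ListSum.∑ R₁ (subsets r)
        (λ S → L₁.egf (connected (suc ∣ S ∣)) S₁.⊛ L₁.egf (all q ∣ ∁ S ∣))
        ≈⟨ L₂.egf-⊛ (λ r → L₁.egf (connected (suc r))) (λ r → L₁.egf (all q r)) r ⟨
      (L₂.egf (λ r → L₁.egf (connected (suc r))) S₂.⊛ G) r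
        ≈⟨ L₂.E-egf-⊛ (λ r → L₁.egf (connected r)) G r ⟨
      (Dx C S₂.⊛ G) (suc r) ∎
      where open Relation.Binary.Reasoning.Setoid R₁.setoid

    private
      p : Carrier
      p = 1# + q

      -- Applied first with exponent s and then with r, this gives the logarithmic derivative r s q
      -- of (1 + q)^(rs), and with it `ΔG`.
      D-^ : ∀ k x → D x ≈ k * x → ∀ n → D (x ^ n) ≈ (nat n * k) * x ^ n
      D-^ k x e zero    = trans D-1 (sym (trans (*-congʳ (zeroˡ k)) (zeroˡ 1#)))
      D-^ k x e (suc n) = begin
        D (x * x ^ n)                             ≈⟨ D-* x (x ^ n) ⟩
        D x * x ^ n + x * D (x ^ n)               ≈⟨ +-cong (*-congʳ e) (*-congˡ (D-^ k x e n)) ⟩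
        k * x * x ^ n + x * (nat n * k * x ^ n)
          ≈⟨ solve 4 (λ k x y n → k :* x :* y :+ x :* (n :* k :* y) :=
                      (con (+ 1) :+ n) :* k :* (x :* y)) refl k x (x ^ n) (nat n) ⟩
        nat (suc n) * k * x ^ suc n               ∎
        where open Relation.Binary.Reasoning.Setoid setoid

    D-recip : ∀ n → D (recip n) ≈ 0#
    D-recip n = nat-cancel n (trans (sym (D-nat* (suc n) (recip n))) (trans (D-cong (nat*recip n)) D-1))

    D-1/! : ∀ n → D (1/ n !) ≈ 0#
    D-1/! zero    = D-1
    D-1/! (suc n) = trans (D-const* _ _ (D-recip n)) (trans (*-congˡ (D-1/! n)) (zeroʳ _))

    ΔG : Δ G S₂.≋ Q S₂.⊛ Dx (Dy G)
    ΔG r s = begin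
      D (G r s)
        ≈⟨ D-cong (egf₂-coefficient (all q) r s) ⟩
      D (1/ r ! * (1/ s ! * all q r s))
        ≈⟨ trans (D-const* _ _ (D-1/! r)) (*-congˡ (trans (D-const* _ _ (D-1/! s))
             (*-congˡ D-all))) ⟩
      1/ r ! * (1/ s ! * (nat r * (nat s * q) * all q r s))
        ≈⟨ solve 6 (λ a b r s q x → a :* (b :* (r :* (s :* q) :* x)) :=
                     q :* (r :* (s :* (a :* (b :* x))))) refl
             (1/ r !) (1/ s !) (nat r) (nat s) q (all q r s) ⟩
      q * (nat r * (nat s * (1/ r ! * (1/ s ! * all q r s))))
        ≈⟨ *-congˡ (*-congˡ (*-congˡ (egf₂-coefficient (all q) r s))) ⟨
      q * (nat r * (nat s * G r s))
        ≈⟨ *-congˡ (S₁.nat-⊛ r (Dy G r) s) ⟨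
      q * Dx (Dy G) r s
        ≈⟨ Q-⊛ (Dx (Dy G)) r s ⟨
      (Q S₂.⊛ Dx (Dy G)) r s ∎
      where
      open Relation.Binary.Reasoning.Setoid setoid
      D-all : D (all q r s) ≈ nat r * (nat s * q) * all q r s
      D-all = trans (D-cong (all-closed q r s)) (trans
        (D-^ (nat s * q) (p ^ s) (D-^ q p D[1+q] s) r)
        (*-congˡ (sym (all-closed q r s))))

    private
      C₀ : ∀ s → C 0 s ≈ 1/ s ! * connected 0 s
      C₀ s = trans (egf₂-coefficient connected 0 s) (*-identityˡ _)

      C₀-other : ∀ s → C 0 (suc (suc s)) ≈ 0#
      C₀-other s = trans (C₀ (suc (suc s))) (zeroʳ _)

      C₀₁ : C 0 1 ≈ 1#
      C₀₁ = begin
        C 0 1                              ≈⟨ C₀ 1 ⟩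
        recip 0 * 1# * 1#                  ≈⟨ solve 1 (λ x → x :* con (+ 1) :* con (+ 1) :=
                                                (con (+ 1) :+ con (+ 0)) :* x) refl (recip 0) ⟩
        nat 1 * recip 0                    ≈⟨ nat*recip 0 ⟩
        1#                                 ∎
        where open Relation.Binary.Reasoning.Setoid setoid

      DyC₀-tail : ∀ s → Dy C 0 (suc s) ≈ S₁.𝟙 s
      DyC₀-tail zero    = trans (*-cong (+-identityʳ 1#) C₀₁) (*-identityˡ 1#)
      DyC₀-tail (suc s) = trans (*-congˡ (C₀-other s)) (zeroʳ _)

      G₀ : ∀ s → G 0 s ≈ 1/ s !
      G₀ s = trans (egf₂-coefficient (all q) 0 s)
        (trans (*-identityˡ _) (trans (*-congˡ (all-closed q 0 s)) (*-identityʳ _)))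

      -- At x = 0 the series `C` is y and `G` is exp y, so this is Dy (exp y) = y exp y.
      boundary-Dy : ∀ s → Dy G 0 s ≈ (Dy C 0 S₁.⊛ G 0) s
      boundary-Dy zero    = trans (zeroˡ _) (sym (trans (*-congʳ (zeroˡ _)) (zeroˡ _)))
      boundary-Dy (suc s) = begin
        nat (suc s) * G 0 (suc s)                 ≈⟨ *-congˡ (G₀ (suc s)) ⟩
        nat (suc s) * 1/ suc s !                  ≈⟨ nat*1/! s ⟩
        1/ s !                                    ≈⟨ G₀ s ⟨
        G 0 s                                     ≈⟨ S₁.⊛-identityˡ (G 0) s ⟨
        (S₁.𝟙 S₁.⊛ G 0) s                         ≈⟨ S₁.⊛-cong {b = G 0} DyC₀-tail (λ _ → refl) s ⟨
        (S₁.tail (Dy C 0) S₁.⊛ G 0) s             ≈⟨ +-identityˡ _ ⟨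
        0# + (S₁.tail (Dy C 0) S₁.⊛ G 0) s
          ≈⟨ +-congʳ (trans (*-congʳ (zeroˡ _)) (zeroˡ _)) ⟨
        (Dy C 0 S₁.⊛ G 0) (suc s)                 ∎
        where open Relation.Binary.Reasoning.Setoid setoid

      ΔC₀ : ∀ s → Δ C 0 s ≈ 0#
      ΔC₀ 0 = trans (D-cong (trans (C₀ 0) (zeroʳ _))) D-0
      ΔC₀ 1 = trans (D-cong C₀₁) D-1
      ΔC₀ (suc (suc s)) = trans (D-cong (C₀-other s)) D-0

      -- At x = 0 the series `C` is y, which carries no edge weight, and every term on the right
      -- contains a `Dx`.
      boundary-Δ : ∀ s → Δ C 0 s ≈ (Q S₂.⊛ (Dx (Dy C) S₂.⊕ Dx C S₂.⊛ Dy C)) 0 s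
      boundary-Δ s = trans (ΔC₀ s) (sym (trans (Q-⊛ (Dx (Dy C) S₂.⊕ Dx C S₂.⊛ Dy C) 0 s)
        (trans (*-congˡ (trans (+-cong (R₁.zeroˡ (Dy C 0) s)
          (R₁.trans (R₁.*-congʳ {Dy C 0} {Dx C 0} {S₁.𝟘} (R₁.zeroˡ (C 0))) (R₁.zeroˡ (Dy C 0)) s))
            (+-identityʳ 0#))) (zeroʳ q))))

      G-regular : ∀ x → G S₂.⊛ x S₂.≋ S₂.𝟘 → x S₂.≋ S₂.𝟘
      G-regular = S₂.regular G (S₁.regular (G 0) λ x e →
        trans (sym (*-identityˡ x)) (trans (*-congʳ (sym (G₀ 0))) e))

      module A₁ = Algebra.Properties.AbelianGroup R₁.+-abelianGroup

    connected-pde : Δ C S₂.≋ Q S₂.⊛ (Dx (Dy C) S₂.⊕ Dx C S₂.⊛ Dy C)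
    connected-pde = Logarithm.log-pde R₂ δˣ δʸ δᵘ
      (λ x → x 0 S₁.≋ S₁.𝟘) Q G C
      (S₂.euler-pointwise-comm S₁.euler)
      (S₂.euler-pointwise-comm (S₁.pointwise δ))
      (S₂.euler-kernel ρ₁)
      (λ x ode → S₂.linear-ode-unique ρ₁ (Dx C) x ode (R₁.zeroˡ (C 0)))
      G-regular
      DxG ΔG
      (A₁.x≈y⇒x∙y⁻¹≈ε boundary-Dy)
      (A₁.x≈y⇒x∙y⁻¹≈ε boundary-Δ)

module SeriesSum {c ℓ} (R : CommutativeRing c ℓ) where
  open CommutativeRing R
  open Series R
  open Algebra.Properties.Semiring.Sum semiring using (sum-syntax; sum⁺-syntax)
  private module S = Algebra.Properties.Semiring.Sum (CommutativeRing.semiring commutativeRing)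

  ⊛-∑ : ∀ a b n → (a ⊛ b) n ≈ ∑[ i ≤ n ] (a (toℕ i) * b (n ∸ toℕ i))
  ⊛-∑ a b zero    = sym (+-identityʳ _)
  ⊛-∑ a b (suc n) = +-congˡ (⊛-∑ (tail a) b n)

  sum-coefficient : ∀ m (f : Fin m → ℕ → Carrier) n → S.sum f n ≈ ∑[ i < m ] f i n
  sum-coefficient zero    f n = refl
  sum-coefficient (suc m) f n = +-congˡ (sum-coefficient m (λ i → f (Fin.suc i)) n)

  ⊛-vanish : ∀ a b n → (∀ i j → i ℕ.+ j ≡ n → a i * b j ≈ 0#) → (a ⊛ b) n ≈ 0#
  ⊛-vanish a b zero    e = e 0 0 ≡.refl
  ⊛-vanish a b (suc n) e = trans
    (+-cong (e 0 (suc n) ≡.refl) (⊛-vanish (tail a) b n (λ i j p → e (suc i) j (≡.cong suc p))))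
    (+-identityˡ 0#)

  shift : ℕ → (ℕ → Carrier) → ℕ → Carrier
  shift p a n = a (p ℕ.+ n)

  ⊛-shiftˡ : ∀ p a b n → (∀ i → i ℕ.< p → a i ≈ 0#) → (a ⊛ b) (p ℕ.+ n) ≈ (shift p a ⊛ b) n
  ⊛-shiftˡ zero    a b n e = refl
  ⊛-shiftˡ (suc p) a b n e = trans
    (+-cong (trans (*-congʳ (e 0 (s≤s z≤n))) (zeroˡ _))
            (⊛-shiftˡ p (tail a) b n (λ i i<p → e (suc i) (s≤s i<p))))
    (+-identityˡ _)

  -- With p and q the edge numbers of trees on two vertex sets, the indices that remain are Betti
  -- numbers.
  ⊛-shift : ∀ p q a b n → (∀ i → i ℕ.< p → a i ≈ 0#) → (∀ i → i ℕ.< q → b i ≈ 0#) →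
            (a ⊛ b) (p ℕ.+ (q ℕ.+ n)) ≈ (shift p a ⊛ shift q b) n
  ⊛-shift p q a b n a≈0 b≈0 = trans (⊛-shiftˡ p a b (q ℕ.+ n) a≈0)
    (trans (⊛-comm (shift p a) b (q ℕ.+ n))
      (trans (⊛-shiftˡ q b (shift p a) n b≈0) (⊛-comm (shift q b) (shift p a) n)))

module SeriesSum₂ {c ℓ} (R : CommutativeRing c ℓ) where
  open CommutativeRing R
  private
    module S₁ = Series R
    module S₂ = Series S₁.commutativeRing
  open Algebra.Properties.Semiring.Sum semiring using (sum-syntax; sum⁺-syntax; sum-cong-≋)

  ⊛⊛-∑ : ∀ a b i j → (a S₂.⊛ b) i j ≈
         ∑[ k ≤ i ] ∑[ l ≤ j ] (a (toℕ k) (toℕ l) * b (i ∸ toℕ k) (j ∸ toℕ l))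
  ⊛⊛-∑ a b i j = trans (SeriesSum.⊛-∑ S₁.commutativeRing a b i j)
    (trans (SeriesSum.sum-coefficient R (suc i) (λ k → a (toℕ k) S₁.⊛ b (i ∸ toℕ k)) j)
      (sum-cong-≋ {suc i} (λ k → SeriesSum.⊛-∑ R (a (toℕ k)) (b (i ∸ toℕ k)) j)))

-- Solving the equations for Betti numbers 0, 1 and 2

module BettiTwo {c ℓ} (R : CommutativeRing c ℓ) (δˣ δʸ : Derivation R)
  (F₀ F₁ F₂ : CommutativeRing.Carrier R) where

  open CommutativeRing R
  open Derivation δˣ using () renaming (D to Dx)
  open Derivation δʸ using () renaming (D to Dy)
  open RingSolver R
  open Relation.Binary.Reasoning.Setoid setoid
  open Algebra.Properties.AbelianGroup +-abelianGroup using (x∙y⁻¹≈ε⇒x≈y; x≈y⇒x∙y⁻¹≈ε)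
  open Algebra.Properties.Semiring.Mult.TCOptimised semiring using (×ᵤ≈×)
  # : ℕ → Carrier
  # n = ⟦ + n ⟧ℤ

  a b m w : Carrier
  a = Dx F₀
  b = Dy F₀
  m = Dx (Dy F₀)
  w = a * b

  -- d = 0 is the claim m = w / (1 - w). For V = (1 - b) Dx + (1 - a) Dy one finds
  -- (1 - a) (1 - b) V d = (1 + r) d; p, q and r collect everything that vanishes at
  -- the origin.
  d p q r f g : Carrier
  d = (1# - w) * m - w
  p = 1# - (1# - a) * (1# - b) * (1# - b)
  q = 1# - (1# - a) * (1# - b) * (1# - a)
  r = # 2 * (1# - a) * (1# - b) * (m + 1#) - # 2 + w
  -- In closed form F₁ is -(log (1 - w) + w) / 2. Its derivatives m Dx w / 2 and m Dy w / 2, with Dx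
  -- w = m (1 + a) and Dy w = m (1 + b), are rational, and F₁ enters the later equations through
  -- derivatives only.
  f = # 2 * Dx F₁ - m * m * (1# + a)
  g = # 2 * Dy F₁ - m * m * (1# + b)

  module _
    (DxDy : ∀ x → Dx (Dy x) ≈ Dy (Dx x))
    (Betti₀ : a + b ≈ F₀ + a * b)
    (Betti₁ : (Dx F₁ + Dy F₁) + (a + b) ≈ F₀ + (m + (a * Dy F₁ + Dx F₁ * b)))
    (Betti₂ : (Dx F₂ + Dy F₂) + F₂ + (Dx F₁ + Dy F₁) ≈
              Dx (Dy F₁) + (a * Dy F₂ + (Dx F₁ * Dy F₁ + Dx F₂ * b)))
    (unique-m : Dx d + Dy d ≈ d + (p * Dx d + q * Dy d + r * d) → d ≈ 0#)
    (unique-closed : Dy f ≈ Dx g → f + g ≈ a * g + f * b → f ≈ 0# × g ≈ 0#)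
    (unique-F₂ : ∀ h → (Dx h + Dy h) + h ≈ a * Dy h + Dx h * b → h ≈ 0#)
    (cancel-1-a : ∀ x → (1# - a) * x ≈ 0# → x ≈ 0#)
    (cancel-1-b : ∀ x → (1# - b) * x ≈ 0# → x ≈ 0#)
    where

    private
      module X = Derivation δˣ
      module Y = Derivation δʸ

      α β ξ η : Carrier
      α = Dx a
      β = Dy b
      ξ = Dx m
      η = Dy m

      Dya : Dy a ≈ m
      Dya = sym (DxDy F₀)

      Dyα : Dy α ≈ ξ
      Dyα = trans (sym (DxDy a)) (X.D-cong Dya)

      infixr 5 _⊞_
      _⊞_ : ∀ {x y} → x ≈ 0# → y ≈ 0# → x + y ≈ 0#
      p ⊞ q = trans (+-cong p q) (+-identityˡ 0#)

      -- Multiples of l - r for a known equation l ≈ r; every polynomial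
      -- consequence below is an explicit combination of such multiples.
      multiple : ∀ k {l r} → l ≈ r → k * (l - r) ≈ 0#
      multiple k e = trans (*-congˡ (x≈y⇒x∙y⁻¹≈ε e)) (zeroʳ k)

      conclude : ∀ {x y z} → x - y ≈ z → z ≈ 0# → x ≈ y
      conclude e z≈0 = x∙y⁻¹≈ε⇒x≈y _ _ (trans e z≈0)

      Dx-w : Dx w ≈ α * b + a * m
      Dx-w = X.D-* a b

      Dy-w : Dy w ≈ m * b + a * β
      Dy-w = trans (Y.D-* a b) (+-congʳ (*-congʳ Dya))

      eqˣ : α + m ≈ a + (α * b + a * m)
      eqˣ = trans (sym (X.D-+ a b)) (trans (X.D-cong Betti₀) (trans (X.D-+ F₀ w) (+-congˡ Dx-w)))

      eqʸ : m + β ≈ b + (m * b + a * β)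
      eqʸ = trans (+-congʳ (sym Dya)) (trans (sym (Y.D-+ a b))
        (trans (Y.D-cong Betti₀) (trans (Y.D-+ F₀ w) (+-congˡ Dy-w))))

      -- `Betti₀` under both operators. The derivatives of m occur only as (1 - b) ξ + (1 - a) η,
      -- which dictates the operator V applied to `d`.
      eqˣʸ : ξ + η ≈ m + ((ξ * b + α * β) + (m * m + a * η))
      eqˣʸ = begin
        ξ + η                             ≈⟨ +-congʳ Dyα ⟨
        Dy α + Dy m                       ≈⟨ Y.D-+ α m ⟨
        Dy (α + m)                        ≈⟨ Y.D-cong eqˣ ⟩
        Dy (a + (α * b + a * m))          ≈⟨ trans (Y.D-+ _ _) (+-cong Dya (trans (Y.D-+ _ _)
                                               (+-cong (Y.D-* α b) (Y.D-* a m)))) ⟩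
        m + ((Dy α * b + α * β) + (Dy a * m + a * η))
          ≈⟨ +-congˡ (+-cong (+-congʳ (*-congʳ Dyα)) (+-congʳ (*-congʳ Dya))) ⟩
        m + ((ξ * b + α * β) + (m * m + a * η)) ∎

      D-d : ∀ (δ : Derivation R) → let open Derivation δ in ∀ {w′} → D w ≈ w′ →
            D d ≈ (1# - w) * D m - w′ * (m + 1#)
      D-d δ {w′} Dw = begin
        D ((1# - w) * m - w)
          ≈⟨ trans (D-- _ _) (+-cong (D-* _ _) (-‿cong Dw)) ⟩
        (D (1# - w) * m + (1# - w) * D m) - w′
          ≈⟨ +-congʳ (+-congʳ (*-congʳ (trans (D-- 1# w) (+-cong D-1 (-‿cong Dw))))) ⟩
        ((0# - w′) * m + (1# - w) * D m) - w′
          ≈⟨ solve 4 (λ x m w y → ((con (+ 0) :- x) :* m :+ (con (+ 1) :- w) :* y) :- x :=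
               (con (+ 1) :- w) :* y :- x :* (m :+ con (+ 1))) refl w′ m w (D m) ⟩
        (1# - w) * D m - w′ * (m + 1#) ∎
        where open Derivation δ

      d-equation : Dx d + Dy d ≈ d + (p * Dx d + q * Dy d + r * d)
      d-equation = begin
        Dx d + Dy d        ≈⟨ +-cong Dxd Dyd ⟩
        dx + dy            ≈⟨ conclude
          (solve 7 (λ a b m ξ η α β →
             let one = con (+ 1); two = con (+ 2); w = a :* b
                 dx = (one :- w) :* ξ :- (α :* b :+ a :* m) :* (m :+ one)
                 dy = (one :- w) :* η :- (m :* b :+ a :* β) :* (m :+ one)
                 d = (one :- w) :* m :- w
                 p = one :- (one :- a) :* (one :- b) :* (one :- b)
                 q = one :- (one :- a) :* (one :- b) :* (one :- a)
                 r = two :* (one :- a) :* (one :- b) :* (m :+ one) :- two :+ w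
             in (dx :+ dy) :- (d :+ (p :* dx :+ q :* dy :+ r :* d)) :=
                -- These multipliers come from elimination. The third equation replaces (1 - b) ξ +
                -- (1 - a) η; the first two remove α and β, which they give with denominators 1 - b
                -- and 1 - a. This is the origin of the overall factor (1 - a) (1 - b).
                ((one :- w) :* (b :- (one :- b) :* m) :-
                  (one :- a) :* (one :- b) :* (one :+ m) :* b) :*
                    ((α :+ m) :- (a :+ (α :* b :+ a :* m))) :+
                (((one :- w) :* (one :- b) :* α :-
                  (one :- a) :* (one :- b) :* (one :+ m) :* a) :*
                    ((m :+ β) :- (b :+ (m :* b :+ a :* β))) :+
                (one :- a) :* (one :- b) :* (one :- w) :*
                    ((ξ :+ η) :- (m :+ ((ξ :* b :+ α :* β) :+ (m :* m :+ a :* η))))))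
            refl a b m ξ η α β)
          (multiple _ eqˣ ⊞ multiple _ eqʸ ⊞ multiple _ eqˣʸ) ⟩
        d + (p * dx + q * dy + r * d)
          ≈⟨ +-congˡ (+-congʳ (+-cong (*-congˡ Dxd) (*-congˡ Dyd))) ⟨
        d + (p * Dx d + q * Dy d + r * d) ∎
        where
        dx = (1# - w) * ξ - (α * b + a * m) * (m + 1#)
        dy = (1# - w) * η - (m * b + a * β) * (m + 1#)
        Dxd : Dx d ≈ dx
        Dxd = D-d δˣ Dx-w
        Dyd : Dy d ≈ dy
        Dyd = D-d δʸ Dy-w

    m-equation : m ≈ w + w * m
    m-equation = conclude
      (solve 2 (λ w m → m :- (w :+ w :* m) :=
        con (+ 1) :* (((con (+ 1) :- w) :* m :- w) :- con (+ 0))) refl w m)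
      (multiple 1# (unique-m d-equation))

    -- `eqˣ` reads (1 - b) α = a - (1 - a) m, and m = w + w m turns the right side into (1 - b) a (1
    -- + m).
    Dxa : α ≈ a * (1# + m)
    Dxa = x∙y⁻¹≈ε⇒x≈y _ _ (cancel-1-b _ (trans
      (solve 4 (λ a b m α → (con (+ 1) :- b) :* (α :- a :* (con (+ 1) :+ m)) :=
          con (+ 1) :* ((α :+ m) :- (a :+ (α :* b :+ a :* m))) :+
          (:- con (+ 1)) :* (m :- (a :* b :+ a :* b :* m))) refl a b m α)
      (multiple 1# eqˣ ⊞ multiple (- 1#) m-equation)))

    Dyb : β ≈ b * (1# + m)
    Dyb = x∙y⁻¹≈ε⇒x≈y _ _ (cancel-1-a _ (trans
      (solve 4 (λ a b m β → (con (+ 1) :- a) :* (β :- b :* (con (+ 1) :+ m)) :=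
          con (+ 1) :* ((m :+ β) :- (b :+ (m :* b :+ a :* β))) :+
          (:- con (+ 1)) :* (m :- (a :* b :+ a :* b :* m))) refl a b m β)
      (multiple 1# eqʸ ⊞ multiple (- 1#) m-equation)))

    -- Differentiating m = w + w m gives (1 - w) ξ = (1 + m) Dx w, where Dx w = m (1 + a);
    -- multiplication by 1 + m, the inverse of 1 - w, isolates ξ.
    Dxm : ξ ≈ m * (1# + m) * (1# + m) * (1# + a)
    Dxm = conclude
      (solve 5 (λ a b m α ξ → let one = con (+ 1); v = one :+ m in
        ξ :- m :* v :* v :* (one :+ a) :=
        v :* (ξ :- ((α :* b :+ a :* m) :+ ((α :* b :+ a :* m) :* m :+ a :* b :* ξ))) :+
        (b :* v :* v :* (α :- a :* v) :+
        (:- (v :* v :+ ξ)) :* (m :- (a :* b :+ a :* b :* m)))) refl a b m α ξ)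
      (multiple (1# + m) ξ-equation ⊞ multiple _ Dxa ⊞ multiple _ m-equation)
      where
      ξ-equation : ξ ≈ (α * b + a * m) + ((α * b + a * m) * m + w * ξ)
      ξ-equation = trans (X.D-cong m-equation) (trans (X.D-+ _ _)
        (+-cong Dx-w (trans (X.D-* _ _) (+-congʳ (*-congʳ Dx-w)))))

    Dym : η ≈ m * (1# + m) * (1# + m) * (1# + b)
    Dym = conclude
      (solve 5 (λ a b m β η → let one = con (+ 1); v = one :+ m in
        η :- m :* v :* v :* (one :+ b) :=
        v :* (η :- ((m :* b :+ a :* β) :+ ((m :* b :+ a :* β) :* m :+ a :* b :* η))) :+
        (a :* v :* v :* (β :- b :* v) :+
        (:- (v :* v :+ η)) :* (m :- (a :* b :+ a :* b :* m)))) refl a b m β η)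
      (multiple (1# + m) η-equation ⊞ multiple _ Dyb ⊞ multiple _ m-equation)
      where
      η-equation : η ≈ (m * b + a * β) + ((m * b + a * β) * m + w * η)
      η-equation = trans (Y.D-cong m-equation) (trans (Y.D-+ _ _)
        (+-cong Dy-w (trans (Y.D-* _ _) (+-congʳ (*-congʳ Dy-w)))))

    private
      D-# : ∀ (δ : Derivation R) → let open Derivation δ in ∀ n → D (# n) ≈ 0#
      D-# δ n = trans (D-cong (sym (×ᵤ≈× n 1#))) (D-nat n)
        where open Derivation δ

      D-#* : ∀ (δ : Derivation R) → let open Derivation δ in ∀ n x → D (# n * x) ≈ # n * D x
      D-#* δ n x = Derivation.D-const* δ (# n) x (D-# δ n)

      D-m²[1+x] : ∀ (δ : Derivation R) → let open Derivation δ in ∀ x {x′ m′} → D x ≈ x′ → D m ≈ m′ →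
        D (m * m * (1# + x)) ≈ (m′ * m + m * m′) * (1# + x) + m * m * x′
      D-m²[1+x] δ x Dx Dm = trans (D-* _ _) (+-cong
        (*-congʳ (trans (D-* m m) (+-cong (*-congʳ Dm) (*-congˡ Dm))))
        (*-congˡ (trans (D-+ 1# x) (trans (+-cong D-1 Dx) (+-identityˡ _)))))
        where open Derivation δ

      f₁ g₁ : Carrier
      f₁ = m * m * (1# + a)
      g₁ = m * m * (1# + b)

      ξ′ η′ : Carrier
      ξ′ = m * (1# + m) * (1# + m) * (1# + a)
      η′ = m * (1# + m) * (1# + m) * (1# + b)

      Dxg₁ : Dx g₁ ≈ (ξ′ * m + m * ξ′) * (1# + b) + m * m * m
      Dxg₁ = D-m²[1+x] δˣ b refl Dxm

      Dyf₁ : Dy f₁ ≈ (η′ * m + m * η′) * (1# + a) + m * m * m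
      Dyf₁ = D-m²[1+x] δʸ a Dya Dym

      -- `Dy f₁` and `Dx g₁` both equal 2 m² (1 + m)² (1 + a) (1 + b) + m³, an expression symmetric
      -- in a and b.
      closed : Dy f ≈ Dx g
      closed = begin
        Dy f
          ≈⟨ trans (Y.D-- _ _) (+-cong (trans (D-#* δʸ 2 _) (*-congˡ (sym (DxDy F₁)))) (-‿cong Dyf₁)) ⟩
        # 2 * Dx (Dy F₁) - ((η′ * m + m * η′) * (1# + a) + m * m * m)
          ≈⟨ solve 4 (λ a b m x → let one = con (+ 1); ξ = m :* (one :+ m) :* (one :+ m) :* (one :+ a)
                                      η = m :* (one :+ m) :* (one :+ m) :* (one :+ b) in
               con (+ 2) :* x :- ((η :* m :+ m :* η) :* (one :+ a) :+ m :* m :* m) :=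
               con (+ 2) :* x :- ((ξ :* m :+ m :* ξ) :* (one :+ b) :+ m :* m :* m)) refl
               a b m (Dx (Dy F₁)) ⟩
        # 2 * Dx (Dy F₁) - ((ξ′ * m + m * ξ′) * (1# + b) + m * m * m)
          ≈⟨ trans (X.D-- _ _) (+-cong (D-#* δˣ 2 _) (-‿cong Dxg₁)) ⟨
        Dx g ∎

      -- By `Betti₀`, `Betti₁` becomes (1 - b) Dx F₁ + (1 - a) Dy F₁ = m - w = w m. The candidates
      -- agree with it, since (1 - b) (1 + a) + (1 - a) (1 + b) = 2 (1 - w) and m (1 - w) = w.
      trace : f + g ≈ a * g + f * b
      trace = conclude
        (solve 6 (λ a b m t x y →
          let one = con (+ 1); two = con (+ 2)
              f = m :* m :* (one :+ a); g = m :* m :* (one :+ b) in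
          ((two :* x :- f) :+ (two :* y :- g)) :- (a :* (two :* y :- g) :+ (two :* x :- f) :* b) :=
          two :* (((x :+ y) :+ (a :+ b)) :- (t :+ (m :+ (a :* y :+ x :* b)))) :+
          ((:- two) :* ((a :+ b) :- (t :+ a :* b)) :+
          two :* (one :- m) :* (m :- (a :* b :+ a :* b :* m)))) refl a b m F₀ (Dx F₁) (Dy F₁))
        (multiple (# 2) Betti₁ ⊞ multiple (- # 2) Betti₀ ⊞ multiple _ m-equation)

    DxF₁ : # 2 * Dx F₁ ≈ m * m * (1# + a)
    DxF₁ = x∙y⁻¹≈ε⇒x≈y _ _ (proj₁ (unique-closed closed trace))

    DyF₁ : # 2 * Dy F₁ ≈ m * m * (1# + b)
    DyF₁ = x∙y⁻¹≈ε⇒x≈y _ _ (proj₂ (unique-closed closed trace))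

    private
      DxDyF₁ : # 2 * Dx (Dy F₁) ≈ (ξ′ * m + m * ξ′) * (1# + b) + m * m * m
      DxDyF₁ = trans (sym (D-#* δˣ 2 (Dy F₁))) (trans (X.D-cong DyF₁) Dxg₁)

      -- The claimed value of 24 F₂ is kept as a polynomial in a, b and m: these are closed under
      -- `Dx` and `Dy`, so no division appears.
      B H : Carrier
      B = ((# 2 + # 5 * m) * (a + b) + # 10 * m) + # 2 * (a * b)
      H = m * m * B

      D-H : ∀ (δ : Derivation R) → let open Derivation δ in
        ∀ {a′ b′ m′} → D a ≈ a′ → D b ≈ b′ → D m ≈ m′ →
        D H ≈ (m′ * m + m * m′) * B +
              m * m * (((# 5 * m′ * (a + b) + (# 2 + # 5 * m) * (a′ + b′)) + # 10 * m′)
                       + # 2 * (a′ * b + a * b′))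
      D-H δ {a′} {b′} {m′} Da Db Dm = trans (D-* _ _) (+-cong
        (*-congʳ (trans (D-* m m) (+-cong (*-congʳ Dm) (*-congˡ Dm))))
        (*-congˡ (trans (D-+ _ _) (+-cong (trans (D-+ _ _) (+-cong
          (trans (D-* _ _) (+-cong (*-congʳ D[2+5m]) (*-congˡ (trans (D-+ a b) (+-cong Da Db)))))
          (trans (D-#* δ 10 m) (*-congˡ Dm))))
          (trans (D-#* δ 2 (a * b)) (*-congˡ (trans (D-* a b) (+-cong (*-congʳ Da) (*-congˡ Db)))))))))
        where
        open Derivation δ
        D[2+5m] : D (# 2 + # 5 * m) ≈ # 5 * m′
        D[2+5m] = trans (D-+ _ _) (trans (+-cong (D-# δ 2) (trans (D-#* δ 5 m) (*-congˡ Dm))) (+-identityˡ _))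

      Hˣ Hʸ : Carrier
      Hˣ = (ξ′ * m + m * ξ′) * B +
           m * m * (((# 5 * ξ′ * (a + b) + (# 2 + # 5 * m) * (a * (1# + m) + m)) + # 10 * ξ′)
                    + # 2 * (a * (1# + m) * b + a * m))
      Hʸ = (η′ * m + m * η′) * B +
           m * m * (((# 5 * η′ * (a + b) + (# 2 + # 5 * m) * (m + b * (1# + m))) + # 10 * η′)
                    + # 2 * (m * b + a * (b * (1# + m))))

      h : Carrier
      h = # 24 * F₂ - H

      h-equation : (Dx h + Dy h) + h ≈ a * Dy h + Dx h * b
      h-equation = begin
        (Dx h + Dy h) + h   ≈⟨ +-congʳ (+-cong Dxh Dyh) ⟩
        (hˣ + hʸ) + h       ≈⟨ conclude
          (solve 9 (λ a b m s x y t x₂ y₂ →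
            let one = con (+ 1); v = one :+ m
                ξ = m :* v :* v :* (one :+ a); η = m :* v :* v :* (one :+ b)
                f = m :* m :* (one :+ a); g = m :* m :* (one :+ b)
                B = ((con (+ 2) :+ con (+ 5) :* m) :* (a :+ b) :+ con (+ 10) :* m) :+ con (+ 2) :* (a :* b)
                Hˣ = (ξ :* m :+ m :* ξ) :* B :+
                  m :* m :* (((con (+ 5) :* ξ :* (a :+ b) :+ (con (+ 2) :+ con (+ 5) :* m) :* (a :* v :+ m))
                    :+ con (+ 10) :* ξ) :+ con (+ 2) :* (a :* v :* b :+ a :* m))
                Hʸ = (η :* m :+ m :* η) :* B :+
                  m :* m :* (((con (+ 5) :* η :* (a :+ b) :+ (con (+ 2) :+ con (+ 5) :* m) :* (m :+ b :* v))
                    :+ con (+ 10) :* η) :+ con (+ 2) :* (m :* b :+ a :* (b :* v)))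
                hˣ = con (+ 24) :* x₂ :- Hˣ
                hʸ = con (+ 24) :* y₂ :- Hʸ
            in
            ((hˣ :+ hʸ) :+ (con (+ 24) :* s :- m :* m :* B)) :- (a :* hʸ :+ hˣ :* b) :=
            con (+ 24) :* (((x₂ :+ y₂) :+ s :+ (x :+ y)) :-
                           (t :+ (a :* y₂ :+ (x :* y :+ x₂ :* b)))) :+
            -- F₁ is known through twice its derivatives, so 24 t splits as 12 · 2 t. The product 24
            -- x y is replaced in two steps, 12 y (2 x - f) + 6 f (2 y - g) = 24 x y - 6 f g.
            (con (+ 12) :* (con (+ 2) :* t :- ((ξ :* m :+ m :* ξ) :* (one :+ b) :+ m :* m :* m)) :+
            ((con (+ 12) :* y :- con (+ 12)) :* (con (+ 2) :* x :- f) :+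
            ((con (+ 6) :* f :- con (+ 12)) :* (con (+ 2) :* y :- g) :+
            -- After these substitutions a polynomial in a, b and m is left, divisible by m - (w + w
            -- m); this factor is the quotient.
            (:- (m :* m :* ((con (+ 14) :+ con (+ 100) :* m :+ con (+ 60) :* m :* m)
              :+ (con (+ 10) :+ con (+ 38) :* m :+ con (+ 30) :* m :* m) :* (a :+ b)
              :+ (con (+ 8) :+ con (+ 8) :* m) :* a :* b))) :*
              (m :- (a :* b :+ a :* b :* m))))))
            refl a b m F₂ (Dx F₁) (Dy F₁) (Dx (Dy F₁)) (Dx F₂) (Dy F₂))
          (multiple (# 24) Betti₂ ⊞ multiple (# 12) DxDyF₁ ⊞ multiple _ DxF₁ ⊞ multiple _ DyF₁
            ⊞ multiple _ m-equation) ⟩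
        a * hʸ + hˣ * b     ≈⟨ +-cong (*-congˡ Dyh) (*-congʳ Dxh) ⟨
        a * Dy h + Dx h * b ∎
        where
        hˣ = # 24 * Dx F₂ - Hˣ
        hʸ = # 24 * Dy F₂ - Hʸ
        Dxh : Dx h ≈ hˣ
        Dxh = trans (X.D-- _ _) (+-cong (D-#* δˣ 24 F₂) (-‿cong (D-H δˣ Dxa refl Dxm)))
        Dyh : Dy h ≈ hʸ
        Dyh = trans (Y.D-- _ _) (+-cong (D-#* δʸ 24 F₂) (-‿cong (D-H δʸ Dya Dyb Dym)))

    24F₂ : # 24 * F₂ ≈ H
    24F₂ = x∙y⁻¹≈ε⇒x≈y _ _ (unique-F₂ h h-equation)

    -- The trailing factors `1#` are those of unfolded powers, so that the right side agrees with
    -- `f₂` up to its numerals.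
    F₂-formula : ∀ k v → k * # 24 ≈ 1# → (1# - w) * v ≈ 1# →
      F₂ ≈ k * (w * (w * 1#)) * (v * (v * (v * 1#))) *
           ((# 2 + # 3 * w) * (a + b) + # 2 * w * (# 6 - w))
    F₂-formula k v k24 v-inverse = begin
      F₂                     ≈⟨ *-identityˡ F₂ ⟨
      1# * F₂                ≈⟨ *-congʳ k24 ⟨
      k * # 24 * F₂          ≈⟨ *-assoc _ _ _ ⟩
      k * (# 24 * F₂)        ≈⟨ *-congˡ 24F₂ ⟩
      k * (m * m * B)
        -- Replacing 2 w by 2 m - 2 w m makes every summand of `B` linear in v once 1 + m = v and m
        -- = w v; together with m² this produces v³.
        ≈⟨ conclude
          (solve 4 (λ a b m k →
            let w = a :* b; two = con (+ 2) in
            k :* (m :* m :* (((two :+ con (+ 5) :* m) :* (a :+ b) :+ con (+ 10) :* m) :+ two :* w)) :-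
            k :* ((m :* m) :* (two :* (con (+ 1) :+ m) :* (a :+ b) :+ con (+ 3) :* m :* (a :+ b)
                   :+ con (+ 12) :* m :- two :* w :* m)) :=
            :- (two :* k :* m :* m) :* (m :- (w :+ w :* m))) refl a b m k)
          (multiple _ m-equation) ⟩
      k * ((m * m) * (# 2 * (1# + m) * (a + b) + # 3 * m * (a + b) + # 12 * m - # 2 * w * m))
        ≈⟨ *-congˡ (*-cong (*-cong wv wv) (+-cong (+-cong (+-cong
             (*-congʳ (*-congˡ v≈1+m)) (*-congʳ (*-congˡ wv))) (*-congˡ wv)) (-‿cong (*-congˡ wv)))) ⟨
      k * (((w * v) * (w * v)) * (# 2 * v * (a + b) + # 3 * (w * v) * (a + b) + # 12 * (w * v)
           - # 2 * w * (w * v)))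
        ≈⟨ solve 4 (λ k w v z → let one = con (+ 1); two = con (+ 2) in
             k :* (((w :* v) :* (w :* v)) :* (two :* v :* z :+ con (+ 3) :* (w :* v) :* z
               :+ con (+ 12) :* (w :* v) :- two :* w :* (w :* v))) :=
             k :* (w :* (w :* one)) :* (v :* (v :* (v :* one))) :*
               ((two :+ con (+ 3) :* w) :* z :+ two :* w :* (con (+ 6) :- w))) refl k w v (a + b) ⟩
      k * (w * (w * 1#)) * (v * (v * (v * 1#))) *
           ((# 2 + # 3 * w) * (a + b) + # 2 * w * (# 6 - w)) ∎
      where
      v≈1+m : v ≈ 1# + m
      v≈1+m = conclude
        (solve 3 (λ w m v → let one = con (+ 1) in
          v :- (one :+ m) := (one :+ m) :* ((one :- w) :* v :- one) :+
                             (:- v) :* (m :- (w :+ w :* m))) refl w m v)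
        (multiple _ v-inverse ⊞ multiple _ m-equation)
      wv : w * v ≈ m
      wv = trans (*-congˡ v≈1+m) (trans (solve 2 (λ w m → w :* (con (+ 1) :+ m) := w :+ w :* m) refl w m)
        (sym m-equation))

-- Specialisation to rational power series in x and y.

open Defs

ℚ-ring : CommutativeRing 0ℓ 0ℓ
ℚ-ring = ℚₚ.+-*-commutativeRing

open Numerals ℚ-ring using () renaming (nat to natℚ)

-- Reduction to lowest terms does not compute on variables, so identities between fractions are
-- proved for unnormalised ones and transported.
fromℚᵘ-+ : ∀ p q → ℚ.fromℚᵘ p ℚ.+ ℚ.fromℚᵘ q ≡ ℚ.fromℚᵘ (p ℚᵘ.+ q)
fromℚᵘ-+ p q = ℚₚ.toℚᵘ-injective (begin
  ℚ.toℚᵘ (ℚ.fromℚᵘ p ℚ.+ ℚ.fromℚᵘ q)               ≈⟨ ℚₚ.toℚᵘ-homo-+ (ℚ.fromℚᵘ p) (ℚ.fromℚᵘ q) ⟩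
  ℚ.toℚᵘ (ℚ.fromℚᵘ p) ℚᵘ.+ ℚ.toℚᵘ (ℚ.fromℚᵘ q)     ≈⟨ ℚᵘₚ.+-cong (ℚₚ.toℚᵘ-fromℚᵘ p) (ℚₚ.toℚᵘ-fromℚᵘ q) ⟩
  p ℚᵘ.+ q                                         ≈⟨ ℚₚ.toℚᵘ-fromℚᵘ (p ℚᵘ.+ q) ⟨
  ℚ.toℚᵘ (ℚ.fromℚᵘ (p ℚᵘ.+ q))                     ∎)
  where open Relation.Binary.Reasoning.Setoid ℚᵘₚ.≃-setoid

fromℚᵘ-* : ∀ p q → ℚ.fromℚᵘ p ℚ.* ℚ.fromℚᵘ q ≡ ℚ.fromℚᵘ (p ℚᵘ.* q)
fromℚᵘ-* p q = ℚₚ.toℚᵘ-injective (begin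
  ℚ.toℚᵘ (ℚ.fromℚᵘ p ℚ.* ℚ.fromℚᵘ q)               ≈⟨ ℚₚ.toℚᵘ-homo-* (ℚ.fromℚᵘ p) (ℚ.fromℚᵘ q) ⟩
  ℚ.toℚᵘ (ℚ.fromℚᵘ p) ℚᵘ.* ℚ.toℚᵘ (ℚ.fromℚᵘ q)     ≈⟨ ℚᵘₚ.*-cong (ℚₚ.toℚᵘ-fromℚᵘ p) (ℚₚ.toℚᵘ-fromℚᵘ q) ⟩
  p ℚᵘ.* q                                         ≈⟨ ℚₚ.toℚᵘ-fromℚᵘ (p ℚᵘ.* q) ⟨
  ℚ.toℚᵘ (ℚ.fromℚᵘ (p ℚᵘ.* q))                     ∎)
  where open Relation.Binary.Reasoning.Setoid ℚᵘₚ.≃-setoid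

natℚ≡/1 : ∀ n → natℚ n ≡ ℤ.+ n / 1
natℚ≡/1 zero    = ≡.refl
natℚ≡/1 (suc n) = ≡.trans (≡.cong (1ℚ ℚ.+_) (natℚ≡/1 n))
  (≡.trans (fromℚᵘ-+ ℚᵘ.1ℚᵘ (ℚᵘ.mkℚᵘ (ℤ.+ n) 0))
    (ℚₚ.fromℚᵘ-cong {ℚᵘ.1ℚᵘ ℚᵘ.+ ℚᵘ.mkℚᵘ (ℤ.+ n) 0} {ℚᵘ.mkℚᵘ (ℤ.+ suc n) 0} (ℚᵘ.*≡*
      (solve 1 (λ n → (con (ℤ.+ 1) :+ n :* con (ℤ.+ 1)) :* con (ℤ.+ 1) :=
                      (con (ℤ.+ 1) :+ n) :* con (ℤ.+ 1)) ≡.refl (ℤ.+ n)))))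
  where open Data.Integer.Solver.+-*-Solver

/-*-nat : ∀ N d .{{_ : ℕ.NonZero d}} → (ℤ.+ N / d) ℚ.* natℚ d ≡ natℚ N
/-*-nat N d@(suc d-1) = ≡.trans (≡.cong ((ℤ.+ N / d) ℚ.*_) (natℚ≡/1 d))
  (≡.trans (fromℚᵘ-* (ℚᵘ.mkℚᵘ (ℤ.+ N) d-1) (ℚᵘ.mkℚᵘ (ℤ.+ d) 0))
    (≡.trans (ℚₚ.fromℚᵘ-cong {ℚᵘ.mkℚᵘ (ℤ.+ N) d-1 ℚᵘ.* ℚᵘ.mkℚᵘ (ℤ.+ d) 0} {ℚᵘ.mkℚᵘ (ℤ.+ N) 0}
        (ℚᵘ.*≡* (solve 2 (λ N d → N :* d :* con (ℤ.+ 1) := N :* (d :* con (ℤ.+ 1)))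
          ≡.refl (ℤ.+ N) (ℤ.+ d))))
      (≡.sym (natℚ≡/1 N))))
  where open Data.Integer.Solver.+-*-Solver

ℚ-reciprocals : Reciprocals ℚ-ring
ℚ-reciprocals = record
  { recip     = λ n → ℤ.+ 1 / suc n
  ; nat*recip = λ n → ≡.trans (ℚₚ.*-comm (natℚ (suc n)) (ℤ.+ 1 / suc n)) (/-*-nat 1 (suc n))
  }

private
  module P₁ = Series ℚ-ring
  module P₂ = Series P₁.commutativeRing
  module N = CommutativeRing P₂.commutativeRing

·≈⊛ : ∀ A B → A · B ≈ A P₂.⊛ B
·≈⊛ A B i j = ≡.sym (SeriesSum₂.⊛⊛-∑ ℚ-ring A B i j)

const≈constant : ∀ c → const c ≈ P₂.constant (P₁.constant c)
const≈constant c zero    zero    = ≡.refl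
const≈constant c zero    (suc j) = ≡.refl
const≈constant c (suc i) j       = ≡.refl

-- Built on the operations of the theorem's statement, with laws drawn from the iterated series ring
-- by `·≈⊛`, so that the abstract formula for F₂ applies to `F` directly.
powerSeriesRing : CommutativeRing 0ℓ 0ℓ
powerSeriesRing = record
  { Carrier = PowerSeries
  ; _≈_ = _≈_
  ; _+_ = _+_
  ; _*_ = _·_
  ; -_  = λ A i j → ℚ.- A i j
  ; 0#  = λ _ _ → 0ℚ
  ; 1#  = const 1ℚ
  ; isCommutativeRing = record
    { isRing = record
      { +-isAbelianGroup = N.+-isAbelianGroup
      ; *-cong = λ {A} {A′} {B} {B′} p q i j → ≡.trans (·≈⊛ A B i j)
          (≡.trans (N.*-cong {A} {A′} {B} {B′} p q i j) (≡.sym (·≈⊛ A′ B′ i j)))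
      ; *-assoc = λ A B C i j → ≡.trans (·≈⊛ (A · B) C i j)
          (≡.trans (N.*-congʳ {C} {A · B} {A P₂.⊛ B} (·≈⊛ A B) i j)
          (≡.trans (N.*-assoc A B C i j)
          (≡.trans (N.*-congˡ {A} {B P₂.⊛ C} {B · C} (λ k l → ≡.sym (·≈⊛ B C k l)) i j)
                   (≡.sym (·≈⊛ A (B · C) i j)))))
      ; *-identity = const-· , λ A i j → ≡.trans (comm A (const 1ℚ) i j) (const-· A i j)
      ; distrib = (λ A B C i j → ≡.trans (comm A (B + C) i j)
                    (≡.trans (·-distribʳ-+ B C A i j)
                      (≡.cong₂ ℚ._+_ (comm B A i j) (comm C A i j))))
                , (λ A B C → ·-distribʳ-+ B C A)
      }
    ; *-comm = comm
    }
  }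
  where
  comm : ∀ A B → A · B ≈ B · A
  comm A B i j = ≡.trans (·≈⊛ A B i j) (≡.trans (N.*-comm A B i j) (≡.sym (·≈⊛ B A i j)))

eulerˣ eulerʸ : Derivation powerSeriesRing
eulerˣ = record
  { D = Dx
  ; D-cong = λ p i j → ≡.cong ((ℤ.+ i / 1) ℚ.*_) (p i j)
  ; D-+ = λ A B i j → ℚₚ.*-distribˡ-+ (ℤ.+ i / 1) (A i j) (B i j)
  ; D-* = λ A B i j → ≡.trans (≡.cong ((ℤ.+ i / 1) ℚ.*_) (·≈⊛ A B i j))
      (≡.trans (Dx≈ (A P₂.⊛ B) i j) (≡.trans (E.D-* A B i j) (≡.cong₂ ℚ._+_
        (≡.trans (N.*-congʳ {B} {E.D A} {Dx A} (λ k l → ≡.sym (Dx≈ A k l)) i j) (≡.sym (·≈⊛ (Dx A) B i j)))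
        (≡.trans (N.*-congˡ {A} {E.D B} {Dx B} (λ k l → ≡.sym (Dx≈ B k l)) i j) (≡.sym (·≈⊛ A (Dx B) i j))))))
  }
  where
  module E = Derivation P₂.euler
  Dx≈ : ∀ A → Dx A ≈ E.D A
  Dx≈ A i j = ≡.trans (≡.cong (ℚ._* A i j) (≡.sym (natℚ≡/1 i))) (≡.sym (P₁.nat-⊛ i (A i) j))
eulerʸ = record
  { D = Dy
  ; D-cong = λ p i j → ≡.cong ((ℤ.+ j / 1) ℚ.*_) (p i j)
  ; D-+ = λ A B i j → ℚₚ.*-distribˡ-+ (ℤ.+ j / 1) (A i j) (B i j)
  ; D-* = λ A B i j → ≡.trans (≡.cong ((ℤ.+ j / 1) ℚ.*_) (·≈⊛ A B i j))
      (≡.trans (Dy≈ (A P₂.⊛ B) i j) (≡.trans (E.D-* A B i j) (≡.cong₂ ℚ._+_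
        (≡.trans (N.*-congʳ {B} {E.D A} {Dy A} (λ k l → ≡.sym (Dy≈ A k l)) i j) (≡.sym (·≈⊛ (Dy A) B i j)))
        (≡.trans (N.*-congˡ {A} {E.D B} {Dy B} (λ k l → ≡.sym (Dy≈ B k l)) i j) (≡.sym (·≈⊛ A (Dy B) i j))))))
  }
  where
  module E = Derivation (P₂.pointwise P₁.euler)
  Dy≈ : ∀ A → Dy A ≈ E.D A
  Dy≈ A i j = ≡.cong (ℚ._* A i j) (≡.sym (natℚ≡/1 j))

-- Coefficients of the connected series in the edge variable u.

private
  module S = Series ℚ-ring
  K : CommutativeRing 0ℓ 0ℓ
  K = S.commutativeRing
  module K = CommutativeRing K

open Algebra.Properties.Semiring.Sum (CommutativeRing.semiring ℚ-ring)
  using (sum; sum-syntax; sum⁺-syntax; sum-cong-≗; ∑-distrib-+)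

-- The coefficient of x^r y^s u^e in Dx C · Dy C, as an explicit sum over vertex splits that can be
-- regrouped by Betti number.
convolution : (ℕ → ℕ → ℕ → ℚ) → ℕ → ℕ → ℕ → ℚ
convolution C r s e = ∑[ a ≤ r ] ∑[ b ≤ s ]
  ((λ i → natℚ (toℕ a) ℚ.* C (toℕ a) (toℕ b) i) S.⊛
   (λ j → natℚ (s ∸ toℕ b) ℚ.* C (r ∸ toℕ a) (s ∸ toℕ b) j)) e

u : ℕ → ℚ
u zero    = 0ℚ
u (suc n) = S.𝟙 n

-- `S.euler` is u ∂ᵤ, so this is (1 + u) u ∂ᵤ. It sends 1 + u to u (1 + u), as required of the edge
-- weight.
[1+u]∂ᵤ : Derivation K
[1+u]∂ᵤ = scaled K (K.1# K.+ u) S.euler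

[1+u]∂ᵤ[1+u] : Derivation.D [1+u]∂ᵤ (K.1# K.+ u) S.≋ u K.* (K.1# K.+ u)
[1+u]∂ᵤ[1+u] n = ≡.trans (S.⊛-cong {K.1# K.+ u} (λ _ → ≡.refl) euler-1+u n) (S.⊛-comm (K.1# K.+ u) u n)
  where
  euler-1+u : ∀ n → natℚ n ℚ.* (K.1# K.+ u) n ≡ u n
  euler-1+u 0             = ≡.refl
  euler-1+u 1             = ≡.refl
  euler-1+u (suc (suc n)) = ℚₚ.*-zeroʳ (natℚ (suc (suc n)))

open ConnectedSeries K (S.reciprocals ℚ-reciprocals) [1+u]∂ᵤ
open Weighted u [1+u]∂ᵤ[1+u]
open ComponentSum K using (conn)
open Algebra.Properties.Semiring.Exp K.semiring using () renaming (_^_ to _^ᴷ_)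
private
  module Lℚ = ListSum ℚ-ring
  module LK = ListSum K

u-⊛ : ∀ a n → (u S.⊛ a) (suc n) ≡ a n
u-⊛ a n = ≡.trans (≡.cong₂ ℚ._+_ (ℚₚ.*-zeroˡ (a (suc n))) (S.⊛-identityˡ a n)) (ℚₚ.+-identityˡ (a n))

u^-coefficient : ∀ k e → (u ^ᴷ k) e ≡ Lℚ.⟦ k ℕₚ.≟ e ⟧?
u^-coefficient zero    zero    = ≡.refl
u^-coefficient zero    (suc e) = ≡.refl
u^-coefficient (suc k) zero    = ℚₚ.*-zeroˡ ((u ^ᴷ k) 0)
u^-coefficient (suc k) (suc e) = ≡.trans (u-⊛ (u ^ᴷ k) e) (≡.trans (u^-coefficient k e)
  (Lℚ.⟦⟧?-cong (k ℕₚ.≟ e) (suc k ℕₚ.≟ suc e) (≡.cong suc) ℕₚ.suc-injective))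

⟦⟧?-⊛ : ∀ {P : Set} (P? : Dec P) a e → (LK.⟦ P? ⟧? S.⊛ a) e ≡ Lℚ.⟦ P? ⟧? ℚ.* a e
⟦⟧?-⊛ (yes p) a e = S.⊛-constantˡ 1ℚ a e
⟦⟧?-⊛ (no ¬p) a e = ≡.trans (K.zeroˡ a e) (≡.sym (ℚₚ.*-zeroˡ (a e)))

∑-indicator : ∀ {A : Set} {P : A → Set} (P? : ∀ x → Dec (P x)) xs →
              Lℚ.∑ xs (λ x → Lℚ.⟦ P? x ⟧?) ≡ natℚ (length (filter P? xs))
∑-indicator P? []       = ≡.refl
∑-indicator P? (x ∷ xs) with does (P? x)
... | true  = ≡.cong (1ℚ ℚ.+_) (∑-indicator P? xs)
... | false = ≡.trans (ℚₚ.+-identityˡ _) (∑-indicator P? xs)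

conn-coefficient : ∀ r s e → conn u r s e ≡
  Lℚ.∑ (allGraphs r s) (λ g → Lℚ.⟦ connected? g ×-dec (edgeCount g ℕₚ.≟ e) ⟧?)
conn-coefficient r s e = ≡.trans
  (Labelled.∑-coefficient ℚ-ring ℚ-reciprocals (allGraphs r s)
    (λ g → LK.⟦ connected? g ⟧? S.⊛ u ^ᴷ edgeCount g) e)
  (Lℚ.∑-cong (allGraphs r s) λ g → ≡.trans (⟦⟧?-⊛ (connected? g) (u ^ᴷ edgeCount g) e)
    (≡.trans (≡.cong (Lℚ.⟦ connected? g ⟧? ℚ.*_) (u^-coefficient (edgeCount g) e))
      (≡.sym (Lℚ.⟦⟧?-× (connected? g) (edgeCount g ℕₚ.≟ e)))))

conn-Betti : ∀ r s e k → e ℕ.+ 1 ≡ r ℕ.+ s ℕ.+ k →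
  conn u r s e ≡ natℚ (length (filter (isConnectedOfBetti? k) (allGraphs r s)))
conn-Betti r s e k eq = ≡.trans (conn-coefficient r s e) (≡.trans
  (Lℚ.∑-cong (allGraphs r s) λ g →
    Lℚ.⟦⟧?-cong (connected? g ×-dec (edgeCount g ℕₚ.≟ e)) (isConnectedOfBetti? k g)
      (λ { (c , ≡.refl) → c , eq })
      (λ { (c , eq′) → c , ℕₚ.+-cancelʳ-≡ 1 _ _ (≡.trans eq′ (≡.sym eq)) }))
  (∑-indicator (isConnectedOfBetti? k) (allGraphs r s)))

edgeless-walk : ∀ {r s} {g : Graph r s} → (∀ i {j} → j ∉ lookup g i) →
                ∀ {v w} → Star (Adj g) v w → v ≡ w
edgeless-walk ∉g ε             = ≡.refl
edgeless-walk ∉g (forth e ◅ _) = contradiction e (∉g _)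
edgeless-walk ∉g (back e ◅ _)  = contradiction e (∉g _)

-- The content lies in the cases with r s = 0, where `Nbi` is fixed by convention and `connected`
-- partly by counting.
connected-Betti : ∀ r s e k → e ℕ.+ 1 ≡ r ℕ.+ s ℕ.+ k → connected r s e ≡ natℚ (Nbi r s k)
connected-Betti 0 0 e k eq = ≡.refl
connected-Betti 0 1 zero    zero    eq = ≡.refl
connected-Betti 0 1 (suc e) (suc k) eq = ≡.refl
connected-Betti 0 1 (suc e) zero eq = contradiction (ℕₚ.suc-injective eq) (ℕₚ.m+1+n≢0 e)
connected-Betti 0 1 zero (suc k) ()
connected-Betti 0 (suc (suc s)) e k eq = ≡.refl
-- The only graph on one vertex is tested by evaluation; the split on k lets both the filter and
-- `Nbi` reduce.
connected-Betti 1 0 e zero    eq = conn-Betti 1 0 e 0 eq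
connected-Betti 1 0 e (suc k) eq = conn-Betti 1 0 e (suc k) eq
-- With V₂ empty there are no edges, so two vertices of V₁ cannot be joined.
connected-Betti (suc (suc r)) 0 e k eq = ≡.trans (conn-Betti (suc (suc r)) 0 e k eq)
  (≡.cong (natℚ ∘ length) (Listₚ.filter-none (isConnectedOfBetti? k)
    (All.universal (λ { g (c , _) → distinct (edgeless-walk {g = g} (λ _ {j} _ → noColumn j)
      (c (inj₁ Fin.zero) (inj₁ (Fin.suc Fin.zero)))) }) (allGraphs (suc (suc r)) 0))))
  where
  distinct : inj₁ {B = Fin 0} (Fin.zero {suc r}) ≡ inj₁ (Fin.suc Fin.zero) → _
  distinct ()
  noColumn : Fin 0 → _
  noColumn ()
connected-Betti (suc r) (suc s) e k eq = conn-Betti (suc r) (suc s) e k eq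

-- The base case of the lower bound on the number of edges.
edgeless-not-connected : ∀ r s → 2 ℕ.≤ r ℕ.+ s → connected r s 0 ≡ 0ℚ
edgeless-not-connected 0 (suc (suc s)) _ = ≡.refl
edgeless-not-connected 0 1 (s≤s ())
edgeless-not-connected (suc r) s 2≤ = ≡.trans (conn-coefficient (suc r) s 0)
  (≡.trans (∑-indicator edgeless? (allGraphs (suc r) s))
    (≡.cong (natℚ ∘ length) (Listₚ.filter-none edgeless?
      (All.universal (λ { g (c , e) → two r s 2≤ g c (edgeCount≡0⇒∉ g e) }) (allGraphs (suc r) s)))))
  where
  edgeless? : (g : Graph (suc r) s) → Dec (Connected g × edgeCount g ≡ 0)
  edgeless? g = connected? g ×-dec (edgeCount g ℕₚ.≟ 0)
  two : ∀ r s → 2 ℕ.≤ suc r ℕ.+ s → (g : Graph (suc r) s) → Connected g →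
        ¬ (∀ i {j} → j ∉ lookup g i)
  two (suc r) s _ g c ∉g with () ← edgeless-walk {g = g} ∉g (c (inj₁ Fin.zero) (inj₁ (Fin.suc Fin.zero)))
  two zero (suc s) _ g c ∉g with () ← edgeless-walk {g = g} ∉g (c (inj₁ Fin.zero) (inj₂ Fin.zero))
  two zero zero (s≤s ()) g c ∉g

open Reciprocals ℚ-reciprocals using (1/_!; nat*1/!)

C-coefficient : ∀ r s e → C r s e ≡ 1/ r ! ℚ.* (1/ s ! ℚ.* connected r s e)
C-coefficient r s e = ≡.trans (egf₂-coefficient connected r s e)
  (≡.trans (L.series-1/! r (SK.1/ s ! S.⊛ connected r s) e)
    (≡.cong (1/ r ! ℚ.*_) (L.series-1/! s (connected r s) e)))
  where
  module L = Labelled ℚ-ring ℚ-reciprocals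
  module SK = Reciprocals (S.reciprocals ℚ-reciprocals)

open Algebra.Properties.Semiring.Mult (CommutativeRing.semiring ℚ-ring)
  using (×1-homo-*; ×-homo-+)

natℚ-!-1/! : ∀ n → natℚ (n !) ℚ.* 1/ n ! ≡ 1ℚ
natℚ-!-1/! zero    = ≡.refl
natℚ-!-1/! (suc n) = begin
  natℚ (suc n ℕ.* n !) ℚ.* 1/ suc n !              ≡⟨ ≡.cong (ℚ._* 1/ suc n !) (≡.trans
                                                       (≡.cong natℚ (ℕₚ.*-comm (suc n) (n !)))
                                                       (×1-homo-* (n !) (suc n))) ⟩
  natℚ (n !) ℚ.* natℚ (suc n) ℚ.* 1/ suc n !       ≡⟨ ℚₚ.*-assoc (natℚ (n !)) (natℚ (suc n)) (1/ suc n !) ⟩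
  natℚ (n !) ℚ.* (natℚ (suc n) ℚ.* 1/ suc n !)     ≡⟨ ≡.cong (natℚ (n !) ℚ.*_) (nat*1/! n) ⟩
  natℚ (n !) ℚ.* 1/ n !                            ≡⟨ natℚ-!-1/! n ⟩
  1ℚ                                               ∎
  where open ≡.≡-Reasoning

F≡ : ∀ k r s → F k r s ≡ 1/ r ! ℚ.* (1/ s ! ℚ.* natℚ (Nbi r s k))
F≡ k r s = begin
  f                                                 ≡⟨ ℚₚ.*-identityʳ f ⟨
  f ℚ.* 1ℚ                                          ≡⟨ ≡.cong (f ℚ.*_) (≡.sym one) ⟩
  f ℚ.* ((natℚ (r !) ℚ.* a) ℚ.* (natℚ (s !) ℚ.* b))
    ≡⟨ solve 5 (λ f x a y b → f :* ((x :* a) :* (y :* b)) := a :* (b :* (f :* (x :* y)))) ≡.refl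
         f (natℚ (r !)) a (natℚ (s !)) b ⟩
  a ℚ.* (b ℚ.* (f ℚ.* (natℚ (r !) ℚ.* natℚ (s !))))
    ≡⟨ ≡.cong (λ x → a ℚ.* (b ℚ.* (f ℚ.* x))) (×1-homo-* (r !) (s !)) ⟨
  a ℚ.* (b ℚ.* (f ℚ.* natℚ (r ! ℕ.* s !)))
    ≡⟨ ≡.cong (λ x → a ℚ.* (b ℚ.* x)) (/-*-nat (Nbi r s k) (r ! ℕ.* s !)) ⟩
  a ℚ.* (b ℚ.* natℚ (Nbi r s k))                    ∎
  where
  instance _ = ℕₚ.m*n≢0 (r !) (s !) {{r ℕₚ.!≢0}} {{s ℕₚ.!≢0}}
  open ≡.≡-Reasoning
  open RingSolver ℚ-ring
  f = F k r s
  a = 1/ r !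
  b = 1/ s !
  one : (natℚ (r !) ℚ.* a) ℚ.* (natℚ (s !) ℚ.* b) ≡ 1ℚ
  one = ≡.cong₂ ℚ._*_ (natℚ-!-1/! r) (natℚ-!-1/! s)

C-F : ∀ r s e k → e ℕ.+ 1 ≡ r ℕ.+ s ℕ.+ k → C r s e ≡ F k r s
C-F r s e k eq = ≡.trans (C-coefficient r s e) (≡.trans
  (≡.cong (λ x → 1/ r ! ℚ.* (1/ s ! ℚ.* x)) (connected-Betti r s e k eq)) (≡.sym (F≡ k r s)))

open Derivation δˣ using () renaming (D to Dˣ)
open Derivation δʸ using () renaming (D to Dʸ)

Dˣ-coefficient : ∀ A r s e → Dˣ A r s e ≡ natℚ r ℚ.* A r s e
Dˣ-coefficient A r s e = ≡.trans (S₁.nat-⊛ r (A r) s e) (S.nat-⊛ r (A r s) e)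

Dʸ-coefficient : ∀ A r s e → Dʸ A r s e ≡ natℚ s ℚ.* A r s e
Dʸ-coefficient A r s e = S.nat-⊛ s (A r s) e

private
  module SumK = Algebra.Properties.Semiring.Sum K.semiring
  module Σℚ = SeriesSum ℚ-ring

convolution-correct : ∀ r s e → (Dˣ C S₂.⊛ Dʸ C) r s e ≡ convolution C r s e
convolution-correct r s e = ≡.trans (SeriesSum₂.⊛⊛-∑ K (Dˣ C) (Dʸ C) r s e)
  (≡.trans (Σℚ.sum-coefficient (suc r) (λ a → SumK.sum (f a)) e)
    (sum-cong-≗ {suc r} (λ a → ≡.trans (Σℚ.sum-coefficient (suc s) (f a) e)
      (sum-cong-≗ {suc s} (λ b → S.⊛-cong (Dˣ-coefficient C (toℕ a) (toℕ b))
                                          (Dʸ-coefficient C (r ∸ toℕ a) (s ∸ toℕ b)) e)))))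
  where
  f : Fin (suc r) → Fin (suc s) → ℕ → ℚ
  f a b = Dˣ C (toℕ a) (toℕ b) S.⊛ Dʸ C (r ∸ toℕ a) (s ∸ toℕ b)

-- The coefficient of u^(e+1) in `connected-pde`: the operator (1 + u) u ∂ᵤ contributes e + 1 and e,
-- and the factor u on the right lowers the index to e.
edge-recurrence : ∀ r s e →
  natℚ (suc e) ℚ.* C r s (suc e) ℚ.+ natℚ e ℚ.* C r s e ≡
  natℚ r ℚ.* (natℚ s ℚ.* C r s e) ℚ.+ convolution C r s e
edge-recurrence r s e = begin
  natℚ (suc e) ℚ.* c (suc e) ℚ.+ natℚ e ℚ.* c e
    ≡⟨ ≡.cong₂ ℚ._+_ (ℚₚ.*-identityˡ (natℚ (suc e) ℚ.* c (suc e)))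
         (≡.trans (S.⊛-cong {b = E c} (λ n → ℚₚ.+-identityˡ (S.𝟙 n)) (λ _ → ≡.refl) e)
                  (S.⊛-identityˡ (E c) e)) ⟨
  ((K.1# K.+ u) S.⊛ E c) (suc e)
    ≡⟨ connected-pde r s (suc e) ⟩
  (Q S₂.⊛ Y) r s (suc e)
    ≡⟨ Q-⊛ Y r s (suc e) ⟩
  (u S.⊛ Y r s) (suc e)
    ≡⟨ u-⊛ (Y r s) e ⟩
  Dˣ (Dʸ C) r s e ℚ.+ (Dˣ C S₂.⊛ Dʸ C) r s e
    ≡⟨ ≡.cong₂ ℚ._+_ (≡.trans (Dˣ-coefficient (Dʸ C) r s e)
                             (≡.cong (natℚ r ℚ.*_) (Dʸ-coefficient C r s e)))
                    (convolution-correct r s e) ⟩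
  natℚ r ℚ.* (natℚ s ℚ.* c e) ℚ.+ convolution C r s e ∎
  where
  open ≡.≡-Reasoning
  E = Derivation.D S.euler
  c = C r s
  Y = Dˣ (Dʸ C) S₂.⊕ Dˣ C S₂.⊛ Dʸ C

C-edgeless : ∀ r s → 2 ℕ.≤ r ℕ.+ s → C r s 0 ≡ 0ℚ
C-edgeless r s 2≤ = ≡.trans (C-coefficient r s 0)
  (≡.trans (≡.cong (λ x → 1/ r ! ℚ.* (1/ s ! ℚ.* x)) (edgeless-not-connected r s 2≤))
    (≡.trans (≡.cong (1/ r ! ℚ.*_) (ℚₚ.*-zeroʳ (1/ s !))) (ℚₚ.*-zeroʳ (1/ r !))))

-- From edge numbers to Betti numbers

zero-*ˡ : ∀ {x} y → x ≡ 0ℚ → x ℚ.* y ≡ 0ℚ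
zero-*ˡ y ≡.refl = ℚₚ.*-zeroˡ y

zero-*ʳ : ∀ x {y} → y ≡ 0ℚ → x ℚ.* y ≡ 0ℚ
zero-*ʳ x ≡.refl = ℚₚ.*-zeroʳ x

split-sizes : ∀ {r s} (a : Fin (suc r)) (b : Fin (suc s)) →
  (toℕ a ℕ.+ toℕ b) ℕ.+ ((r ∸ toℕ a) ℕ.+ (s ∸ toℕ b)) ≡ r ℕ.+ s
split-sizes {r} {s} a b = ≡.trans
  (solve 4 (λ a b c d → (a :+ b) :+ (c :+ d) := (a :+ c) :+ (b :+ d)) ≡.refl
    (toℕ a) (toℕ b) (r ∸ toℕ a) (s ∸ toℕ b))
  (≡.cong₂ ℕ._+_ (ℕₚ.m+[n∸m]≡n (Finₚ.toℕ≤pred[n] a)) (ℕₚ.m+[n∸m]≡n (Finₚ.toℕ≤pred[n] b)))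
  where open Data.Nat.Solver.+-*-Solver

-- If i + j < (m - 1) + (n - 1), then one of two pieces on m and n vertices has fewer edges than a
-- tree.
second-small : ∀ m n i j → suc (suc (i ℕ.+ j)) ℕ.< m ℕ.+ n → ¬ (suc i ℕ.< m) → suc j ℕ.< n
second-small m n i j lt ≮ = ℕₚ.≰⇒> λ n≤ → ℕₚ.<⇒≱ lt (ℕₚ.≤-trans (ℕₚ.+-mono-≤ (ℕₚ.≮⇒≥ ≮) n≤)
  (ℕₚ.≤-reflexive (ℕₚ.+-suc (suc i) j)))

degree : ∀ (A : PowerSeries) r s → Dx A r s ℚ.+ Dy A r s ≡ natℚ (r ℕ.+ s) ℚ.* A r s
degree A r s = ≡.trans (≡.sym (ℚₚ.*-distribʳ-+ (A r s) (ℤ.+ r / 1) (ℤ.+ s / 1)))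
  (≡.cong (ℚ._* A r s) (≡.trans
    (≡.cong₂ ℚ._+_ (≡.sym (natℚ≡/1 r)) (≡.sym (natℚ≡/1 s))) (≡.sym (×-homo-+ 1ℚ r s))))

module EdgesToBetti
  (C : ℕ → ℕ → ℕ → ℚ) (F : ℕ → PowerSeries)
  (C-edgeless : ∀ r s → 2 ℕ.≤ r ℕ.+ s → C r s 0 ≡ 0ℚ)
  (C-F : ∀ r s e k → e ℕ.+ 1 ≡ r ℕ.+ s ℕ.+ k → C r s e ≡ F k r s)
  (edge-recurrence : ∀ r s e →
    natℚ (suc e) ℚ.* C r s (suc e) ℚ.+ natℚ e ℚ.* C r s e ≡
    natℚ r ℚ.* (natℚ s ℚ.* C r s e) ℚ.+ convolution C r s e)
  where

  private
    xC yC : ℕ → ℕ → ℕ → ℚ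
    xC r s e = natℚ r ℚ.* C r s e
    yC r s e = natℚ s ℚ.* C r s e

  -- Connected graphs on n vertices have at least n - 1 edges: this follows from
  -- the recurrence alone, by induction on the number of edges.
  C-vanish-≤ : ∀ n {e} → e ℕ.≤ n → ∀ r s → suc e ℕ.< r ℕ.+ s → C r s e ≡ 0ℚ
  C-vanish-≤ n z≤n r s 1<r+s = C-edgeless r s 1<r+s
  C-vanish-≤ (suc n) {suc e} (s≤s e≤n) r s lt =
    Reciprocals.nat-cancel ℚ-reciprocals e (begin
      natℚ (suc e) ℚ.* C r s (suc e)
        ≡⟨ ℚₚ.+-identityʳ _ ⟨
      natℚ (suc e) ℚ.* C r s (suc e) ℚ.+ 0ℚ
        ≡⟨ ≡.cong (natℚ (suc e) ℚ.* C r s (suc e) ℚ.+_) (zero-*ʳ (natℚ e) C≡0) ⟨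
      natℚ (suc e) ℚ.* C r s (suc e) ℚ.+ natℚ e ℚ.* C r s e
        ≡⟨ edge-recurrence r s e ⟩
      natℚ r ℚ.* (natℚ s ℚ.* C r s e) ℚ.+ convolution C r s e
        ≡⟨ ≡.cong₂ ℚ._+_ (zero-*ʳ (natℚ r) (zero-*ʳ (natℚ s) C≡0)) conv≡0 ⟩
      0ℚ ∎)
    where
    open ≡.≡-Reasoning
    C≡0 : C r s e ≡ 0ℚ
    C≡0 = C-vanish-≤ n e≤n r s (ℕₚ.<-trans (ℕₚ.n<1+n (suc e)) lt)

    factor≡0 : ∀ a b i j → i ℕ.+ j ≡ e →
      xC (toℕ a) (toℕ b) i ℚ.* yC (r ∸ toℕ a) (s ∸ toℕ b) j ≡ 0ℚ
    factor≡0 a b i j i+j≡e with suc i ℕₚ.<? toℕ a ℕ.+ toℕ b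
    ... | yes lt′ = zero-*ˡ (yC (r ∸ toℕ a) (s ∸ toℕ b) j) (zero-*ʳ (natℚ (toℕ a)) (C-vanish-≤ n
        (ℕₚ.≤-trans (ℕₚ.≤-trans (ℕₚ.m≤m+n i j) (ℕₚ.≤-reflexive i+j≡e)) e≤n) (toℕ a) (toℕ b) lt′))
    ... | no ≮ = zero-*ʳ (xC (toℕ a) (toℕ b) i) (zero-*ʳ (natℚ (s ∸ toℕ b)) (C-vanish-≤ n
        (ℕₚ.≤-trans (ℕₚ.≤-trans (ℕₚ.m≤n+m j i) (ℕₚ.≤-reflexive i+j≡e)) e≤n) (r ∸ toℕ a) (s ∸ toℕ b)
        (second-small (toℕ a ℕ.+ toℕ b) ((r ∸ toℕ a) ℕ.+ (s ∸ toℕ b)) i j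
          (≡.subst₂ ℕ._<_ (≡.cong (2 ℕ.+_) (≡.sym i+j≡e)) (≡.sym (split-sizes a b)) lt) ≮)))

    conv≡0 : convolution C r s e ≡ 0ℚ
    conv≡0 = sum-zero (suc r) (λ a → ∑[ b ≤ s ] conv a b) λ a → sum-zero (suc s) (conv a) λ b →
      Σℚ.⊛-vanish (xC (toℕ a) (toℕ b)) (yC (r ∸ toℕ a) (s ∸ toℕ b)) e (factor≡0 a b)
      where
      conv : Fin (suc r) → Fin (suc s) → ℚ
      conv a b = (xC (toℕ a) (toℕ b) S.⊛ yC (r ∸ toℕ a) (s ∸ toℕ b)) e

  C-vanish : ∀ e r s → suc e ℕ.< r ℕ.+ s → C r s e ≡ 0ℚ
  C-vanish e = C-vanish-≤ e ℕₚ.≤-refl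

  /1*0 : ∀ x → (ℤ.+ 0 / 1) ℚ.* x ≡ 0ℚ
  /1*0 = ℚₚ.*-zeroˡ

  Dx-F : ∀ i r s e → e ℕ.+ 1 ≡ r ℕ.+ s ℕ.+ i → xC r s e ≡ Dx (F i) r s
  Dx-F i r s e eq = ≡.cong₂ ℚ._*_ (natℚ≡/1 r) (C-F r s e i eq)

  Dy-F : ∀ i r s e → e ℕ.+ 1 ≡ r ℕ.+ s ℕ.+ i → yC r s e ≡ Dy (F i) r s
  Dy-F i r s e eq = ≡.cong₂ ℚ._*_ (natℚ≡/1 s) (C-F r s e i eq)

  -- Each factor starts at the edge number of a tree, one less than its number of vertices; this
  -- accounts for the 2. If a or b′ is 0, then Dx or Dy kills both sides; otherwise its predecessor
  -- expresses the tree size without subtraction.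
  product-by-Betti : ∀ k a b a′ b′ e → e ℕ.+ 2 ≡ (a ℕ.+ b) ℕ.+ (a′ ℕ.+ b′) ℕ.+ k →
    (xC a b S.⊛ yC a′ b′) e ≡ ((λ i → Dx (F i) a b) S.⊛ (λ i → Dy (F i) a′ b′)) k
  product-by-Betti k zero b a′ b′ e eq = ≡.trans
    (Σℚ.⊛-vanish (xC 0 b) (yC a′ b′) e (λ i j _ →
      zero-*ˡ (yC a′ b′ j) (ℚₚ.*-zeroˡ (C 0 b i))))
    (≡.sym (Σℚ.⊛-vanish (λ i → Dx (F i) 0 b) (λ i → Dy (F i) a′ b′) k (λ i j _ →
      zero-*ˡ (Dy (F j) a′ b′) (/1*0 (F i 0 b)))))
  product-by-Betti k a@(suc _) b a′ zero e eq = ≡.trans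
    (Σℚ.⊛-vanish (xC a b) (yC a′ 0) e (λ i j _ →
      zero-*ʳ (xC a b i) (ℚₚ.*-zeroˡ (C a′ 0 j))))
    (≡.sym (Σℚ.⊛-vanish (λ i → Dx (F i) a b) (λ i → Dy (F i) a′ 0) k (λ i j _ →
      zero-*ʳ (Dx (F i) a b) (/1*0 (F j a′ 0)))))
  product-by-Betti k (suc a) b a′ (suc b′) e eq = begin
    (xC (suc a) b S.⊛ yC a′ (suc b′)) e
      ≡⟨ ≡.cong (xC (suc a) b S.⊛ yC a′ (suc b′)) e≡ ⟩
    (xC (suc a) b S.⊛ yC a′ (suc b′)) ((a ℕ.+ b) ℕ.+ ((a′ ℕ.+ b′) ℕ.+ k))
      ≡⟨ Σℚ.⊛-shift (a ℕ.+ b) (a′ ℕ.+ b′) (xC (suc a) b) (yC a′ (suc b′)) k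
           (λ i i<p → zero-*ʳ (natℚ (suc a)) (C-vanish i (suc a) b (s≤s i<p)))
           (λ j j<q → zero-*ʳ (natℚ (suc b′)) (C-vanish j a′ (suc b′)
             (≡.subst (suc j ℕ.<_) (≡.sym (ℕₚ.+-suc a′ b′)) (s≤s j<q)))) ⟩
    (Σℚ.shift (a ℕ.+ b) (xC (suc a) b) S.⊛ Σℚ.shift (a′ ℕ.+ b′) (yC a′ (suc b′))) k
      ≡⟨ S.⊛-cong
           (λ i → Dx-F i (suc a) b ((a ℕ.+ b) ℕ.+ i) (ℕₚ.+-comm ((a ℕ.+ b) ℕ.+ i) 1))
           (λ i → Dy-F i a′ (suc b′) ((a′ ℕ.+ b′) ℕ.+ i)
             (solve 3 (λ a b i → (a :+ b) :+ i :+ con 1 := a :+ (con 1 :+ b) :+ i) ≡.refl a′ b′ i)) k ⟩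
    ((λ i → Dx (F i) (suc a) b) S.⊛ (λ i → Dy (F i) a′ (suc b′))) k ∎
    where
    open ≡.≡-Reasoning
    open Data.Nat.Solver.+-*-Solver
    e≡ : e ≡ (a ℕ.+ b) ℕ.+ ((a′ ℕ.+ b′) ℕ.+ k)
    e≡ = ℕₚ.+-cancelʳ-≡ 2 e _ (≡.trans eq
      (solve 5 (λ a b a′ b′ k → (con 1 :+ a) :+ b :+ (a′ :+ (con 1 :+ b′)) :+ k :=
                                ((a :+ b) :+ ((a′ :+ b′) :+ k)) :+ con 2) ≡.refl a b a′ b′ k))

  convolution-by-Betti : ∀ k r s e → e ℕ.+ 2 ≡ r ℕ.+ s ℕ.+ k →
    convolution C r s e ≡ ∑[ a ≤ r ] ∑[ b ≤ s ]
      ((λ i → Dx (F i) (toℕ a) (toℕ b)) S.⊛ (λ i → Dy (F i) (r ∸ toℕ a) (s ∸ toℕ b))) k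
  convolution-by-Betti k r s e eq = ∑∑-cong (suc r) (suc s) (λ a b → (xC (toℕ a) (toℕ b) S.⊛ yC (r ∸ toℕ a) (s ∸ toℕ b)) e)
      (λ a b → ((λ i → Dx (F i) (toℕ a) (toℕ b)) S.⊛ (λ i → Dy (F i) (r ∸ toℕ a) (s ∸ toℕ b))) k) λ a b →
    product-by-Betti k (toℕ a) (toℕ b) (r ∸ toℕ a) (s ∸ toℕ b) e
      (≡.trans eq (≡.cong (ℕ._+ k) (≡.sym (split-sizes a b))))

  convolution₀ : ∀ r s e → e ℕ.+ 2 ≡ r ℕ.+ s ℕ.+ 0 → convolution C r s e ≡ (Dx (F 0) · Dy (F 0)) r s
  convolution₀ = convolution-by-Betti 0

  ∑∑-+ : ∀ m n (f g : Fin m → Fin n → ℚ) →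
    ∑[ a < m ] ∑[ b < n ] (f a b ℚ.+ g a b) ≡
    ∑[ a < m ] ∑[ b < n ] f a b ℚ.+ ∑[ a < m ] ∑[ b < n ] g a b
  ∑∑-+ m n f g = ≡.trans
    (sum-cong-≗ {m} {λ a → ∑[ b < n ] (f a b ℚ.+ g a b)} {λ a → ∑[ b < n ] f a b ℚ.+ ∑[ b < n ] g a b}
      (λ a → ∑-distrib-+ {n} (f a) (g a)))
    (∑-distrib-+ {m} (λ a → ∑[ b < n ] f a b) (λ a → ∑[ b < n ] g a b))

  convolution₁ : ∀ r s e → e ℕ.+ 2 ≡ r ℕ.+ s ℕ.+ 1 → convolution C r s e ≡
    (Dx (F 0) · Dy (F 1) + Dx (F 1) · Dy (F 0)) r s
  convolution₁ r s e eq = ≡.trans (convolution-by-Betti 1 r s e eq)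
    (∑∑-+ (suc r) (suc s) (term (Dx (F 0)) (Dy (F 1)) r s) (term (Dx (F 1)) (Dy (F 0)) r s))

  convolution₂ : ∀ r s e → e ℕ.+ 2 ≡ r ℕ.+ s ℕ.+ 2 → convolution C r s e ≡
    (Dx (F 0) · Dy (F 2) + (Dx (F 1) · Dy (F 1) + Dx (F 2) · Dy (F 0))) r s
  convolution₂ r s e eq = ≡.trans (convolution-by-Betti 2 r s e eq)
    (≡.trans (∑∑-+ (suc r) (suc s) (t 0 2) (λ a b → t 1 1 a b ℚ.+ t 2 0 a b))
      (≡.cong ((Dx (F 0) · Dy (F 2)) r s ℚ.+_) (∑∑-+ (suc r) (suc s) (t 1 1) (t 2 0))))
    where
    t : ℕ → ℕ → Fin (suc r) → Fin (suc s) → ℚ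
    t i j = term (Dx (F i)) (Dy (F j)) r s

  private
    DxDy : ∀ (A : PowerSeries) r s → natℚ r ℚ.* (natℚ s ℚ.* A r s) ≡ Dx (Dy A) r s
    DxDy A r s = ≡.cong₂ ℚ._*_ (natℚ≡/1 r) (≡.cong (ℚ._* A r s) (natℚ≡/1 s))

    open ≡.≡-Reasoning
    open RingSolver ℚ-ring

  -- Here e is one edge short of a tree, so both terms with `C r s e` drop out of the recurrence.
  -- Degrees below 2 admit no such e and are evaluated in `Betti₀`.
  recurrence₀ : ∀ r s e → suc (suc e) ≡ r ℕ.+ s →
    Dx (F 0) r s ℚ.+ Dy (F 0) r s ≡ F 0 r s ℚ.+ (Dx (F 0) · Dy (F 0)) r s
  recurrence₀ r s e eq = begin
    Dx (F 0) r s ℚ.+ Dy (F 0) r s             ≡⟨ degree (F 0) r s ⟩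
    natℚ (r ℕ.+ s) ℚ.* f                      ≡⟨ ≡.cong (λ n → natℚ n ℚ.* f) eq ⟨
    (1ℚ ℚ.+ natℚ (suc e)) ℚ.* f               ≡⟨ solve 2 (λ n f → (con (ℤ.+ 1) :+ n) :* f :=
                                                   f :+ n :* f) ≡.refl (natℚ (suc e)) f ⟩
    f ℚ.+ natℚ (suc e) ℚ.* f                  ≡⟨ ≡.cong (f ℚ.+_) main ⟩
    f ℚ.+ (Dx (F 0) · Dy (F 0)) r s           ∎
    where
    f = F 0 r s
    eq′ : e ℕ.+ 2 ≡ r ℕ.+ s ℕ.+ 0
    eq′ = ≡.trans (ℕₚ.+-comm e 2) (≡.trans eq (≡.sym (ℕₚ.+-identityʳ (r ℕ.+ s))))
    C≡0 : C r s e ≡ 0ℚ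
    C≡0 = C-vanish e r s (ℕₚ.≤-reflexive eq)
    main : natℚ (suc e) ℚ.* f ≡ (Dx (F 0) · Dy (F 0)) r s
    main = begin
      natℚ (suc e) ℚ.* f
        ≡⟨ ≡.cong (natℚ (suc e) ℚ.*_) (C-F r s (suc e) 0 (≡.trans (≡.sym (ℕₚ.+-suc e 1)) eq′)) ⟨
      natℚ (suc e) ℚ.* C r s (suc e)
        ≡⟨ ≡.trans (≡.cong (natℚ (suc e) ℚ.* C r s (suc e) ℚ.+_) (zero-*ʳ (natℚ e) C≡0))
                   (ℚₚ.+-identityʳ _) ⟨
      natℚ (suc e) ℚ.* C r s (suc e) ℚ.+ natℚ e ℚ.* C r s e
        ≡⟨ edge-recurrence r s e ⟩
      natℚ r ℚ.* (natℚ s ℚ.* C r s e) ℚ.+ convolution C r s e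
        ≡⟨ ≡.cong₂ ℚ._+_ (zero-*ʳ (natℚ r) (zero-*ʳ (natℚ s) C≡0)) (convolution₀ r s e eq′) ⟩
      0ℚ ℚ.+ (Dx (F 0) · Dy (F 0)) r s
        ≡⟨ ℚₚ.+-identityˡ _ ⟩
      (Dx (F 0) · Dy (F 0)) r s ∎

  -- With e the edge number of a tree, both terms with `C r s e` survive and become tree terms; only
  -- degree 0 is left over.
  recurrence₁ : ∀ r s e → suc e ≡ r ℕ.+ s →
    (Dx (F 1) r s ℚ.+ Dy (F 1) r s) ℚ.+ (Dx (F 0) r s ℚ.+ Dy (F 0) r s) ≡
    F 0 r s ℚ.+ (Dx (Dy (F 0)) r s ℚ.+ (Dx (F 0) · Dy (F 1) + Dx (F 1) · Dy (F 0)) r s)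
  recurrence₁ r s e eq = begin
    (Dx (F 1) r s ℚ.+ Dy (F 1) r s) ℚ.+ (Dx (F 0) r s ℚ.+ Dy (F 0) r s)
      ≡⟨ ≡.cong₂ ℚ._+_ (degree (F 1) r s) (degree (F 0) r s) ⟩
    natℚ (r ℕ.+ s) ℚ.* F 1 r s ℚ.+ natℚ (r ℕ.+ s) ℚ.* F 0 r s
      ≡⟨ ≡.cong (λ n → natℚ n ℚ.* F 1 r s ℚ.+ natℚ n ℚ.* F 0 r s) eq ⟨
    natℚ (suc e) ℚ.* F 1 r s ℚ.+ (1ℚ ℚ.+ natℚ e) ℚ.* F 0 r s
      ≡⟨ solve 3 (λ x n f → x :+ (con (ℤ.+ 1) :+ n) :* f := f :+ (x :+ n :* f)) ≡.refl
           (natℚ (suc e) ℚ.* F 1 r s) (natℚ e) (F 0 r s) ⟩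
    F 0 r s ℚ.+ (natℚ (suc e) ℚ.* F 1 r s ℚ.+ natℚ e ℚ.* F 0 r s)
      ≡⟨ ≡.cong (F 0 r s ℚ.+_) main ⟩
    _ ∎
    where
    eq′ : e ℕ.+ 1 ≡ r ℕ.+ s ℕ.+ 0
    eq′ = ≡.trans (ℕₚ.+-comm e 1) (≡.trans eq (≡.sym (ℕₚ.+-identityʳ (r ℕ.+ s))))
    eq″ : suc e ℕ.+ 1 ≡ r ℕ.+ s ℕ.+ 1
    eq″ = ≡.cong (ℕ._+ 1) eq
    main : natℚ (suc e) ℚ.* F 1 r s ℚ.+ natℚ e ℚ.* F 0 r s ≡
           Dx (Dy (F 0)) r s ℚ.+ (Dx (F 0) · Dy (F 1) + Dx (F 1) · Dy (F 0)) r s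
    main = begin
      natℚ (suc e) ℚ.* F 1 r s ℚ.+ natℚ e ℚ.* F 0 r s
        ≡⟨ ≡.cong₂ (λ f g → natℚ (suc e) ℚ.* f ℚ.+ natℚ e ℚ.* g)
             (C-F r s (suc e) 1 eq″) (C-F r s e 0 eq′) ⟨
      natℚ (suc e) ℚ.* C r s (suc e) ℚ.+ natℚ e ℚ.* C r s e
        ≡⟨ edge-recurrence r s e ⟩
      natℚ r ℚ.* (natℚ s ℚ.* C r s e) ℚ.+ convolution C r s e
        ≡⟨ ≡.cong₂ ℚ._+_
             (≡.trans (≡.cong (λ f → natℚ r ℚ.* (natℚ s ℚ.* f)) (C-F r s e 0 eq′)) (DxDy (F 0) r s))
             (convolution₁ r s e (≡.trans (ℕₚ.+-suc e 1) eq″)) ⟩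
      _ ∎

  recurrence₂ : ∀ r s → let e = r ℕ.+ s in
    (Dx (F 2) r s ℚ.+ Dy (F 2) r s) ℚ.+ F 2 r s ℚ.+ (Dx (F 1) r s ℚ.+ Dy (F 1) r s) ≡
    Dx (Dy (F 1)) r s ℚ.+
      (Dx (F 0) · Dy (F 2) + (Dx (F 1) · Dy (F 1) + Dx (F 2) · Dy (F 0))) r s
  recurrence₂ r s = begin
    (Dx (F 2) r s ℚ.+ Dy (F 2) r s) ℚ.+ F 2 r s ℚ.+ (Dx (F 1) r s ℚ.+ Dy (F 1) r s)
      ≡⟨ ≡.cong₂ (λ x y → x ℚ.+ F 2 r s ℚ.+ y) (degree (F 2) r s) (degree (F 1) r s) ⟩
    natℚ e ℚ.* F 2 r s ℚ.+ F 2 r s ℚ.+ natℚ e ℚ.* F 1 r s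
      ≡⟨ ≡.cong (ℚ._+ natℚ e ℚ.* F 1 r s)
           (solve 2 (λ n f → n :* f :+ f := (con (ℤ.+ 1) :+ n) :* f) ≡.refl (natℚ e) (F 2 r s)) ⟩
    natℚ (suc e) ℚ.* F 2 r s ℚ.+ natℚ e ℚ.* F 1 r s
      ≡⟨ ≡.cong₂ (λ f g → natℚ (suc e) ℚ.* f ℚ.+ natℚ e ℚ.* g)
           (C-F r s (suc e) 2 (≡.sym (ℕₚ.+-suc e 1))) (C-F r s e 1 ≡.refl) ⟨
    natℚ (suc e) ℚ.* C r s (suc e) ℚ.+ natℚ e ℚ.* C r s e
      ≡⟨ edge-recurrence r s e ⟩
    natℚ r ℚ.* (natℚ s ℚ.* C r s e) ℚ.+ convolution C r s e
      ≡⟨ ≡.cong₂ ℚ._+_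
           (≡.trans (≡.cong (λ f → natℚ r ℚ.* (natℚ s ℚ.* f)) (C-F r s e 1 ≡.refl)) (DxDy (F 1) r s))
           (convolution₂ r s e ≡.refl) ⟩
    _ ∎
    where e = r ℕ.+ s

open EdgesToBetti C F C-edgeless C-F edge-recurrence

Betti₀ : Dx (F 0) + Dy (F 0) ≈ F 0 + Dx (F 0) · Dy (F 0)
Betti₀ 0 0 = ≡.refl
Betti₀ 0 1 = ≡.refl
Betti₀ 1 0 = ≡.refl
Betti₀ 0 s@(suc (suc s′))       = recurrence₀ 0 s s′ ≡.refl
Betti₀ 1 s@(suc s′)             = recurrence₀ 1 s s′ ≡.refl
Betti₀ r@(suc (suc r′)) s       = recurrence₀ r s (r′ ℕ.+ s) ≡.refl

Betti₁ : (Dx (F 1) + Dy (F 1)) + (Dx (F 0) + Dy (F 0)) ≈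
         F 0 + (Dx (Dy (F 0)) + (Dx (F 0) · Dy (F 1) + Dx (F 1) · Dy (F 0)))
Betti₁ 0 0              = ≡.refl
Betti₁ 0 s@(suc s′)     = recurrence₁ 0 s s′ ≡.refl
Betti₁ r@(suc r′) s     = recurrence₁ r s (r′ ℕ.+ s) ≡.refl

-- Uniqueness by induction on the degree

private module P = CommutativeRing powerSeriesRing

VanishesBelow : ℕ → PowerSeries → Set
VanishesBelow n A = ∀ i j → i ℕ.+ j ℕ.< n → A i j ≡ 0ℚ

Dx-vanishes : ∀ {n} A → VanishesBelow n A → VanishesBelow n (Dx A)
Dx-vanishes A v i j lt = zero-*ʳ (ℤ.+ i / 1) (v i j lt)

Dy-vanishes : ∀ {n} A → VanishesBelow n A → VanishesBelow n (Dy A)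
Dy-vanishes A v i j lt = zero-*ʳ (ℤ.+ j / 1) (v i j lt)

-- Without a constant term, `A` raises the degree, so only coefficients of `B` below degree n are
-- met.
·-vanishes : ∀ {n} A B → A 0 0 ≡ 0ℚ → VanishesBelow n B →
             ∀ i j → i ℕ.+ j ≡ n → (A · B) i j ≡ 0ℚ
·-vanishes {n} A B A₀₀ v i j ≡.refl =
  sum-zero (suc i) sum-row λ k → sum-zero (suc j) (term A B i j k) (factor k)
  where
  sum-row : Fin (suc i) → ℚ
  sum-row k = sum (term A B i j k)
  factor : ∀ k l → term A B i j k l ≡ 0ℚ
  factor Fin.zero Fin.zero = zero-*ˡ (B i j) A₀₀
  factor Fin.zero l@(Fin.suc {suc j′} l′) = zero-*ʳ (A 0 (toℕ l))
    (v i (j′ ∸ toℕ l′) (ℕₚ.+-monoʳ-< i (s≤s (ℕₚ.m∸n≤m j′ (toℕ l′)))))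
  factor k@(Fin.suc {suc i′} k′) l = zero-*ʳ (A (toℕ k) (toℕ l))
    (v (i′ ∸ toℕ k′) (j ∸ toℕ l)
      (ℕₚ.+-mono-<-≤ (s≤s (ℕₚ.m∸n≤m i′ (toℕ k′))) (ℕₚ.m∸n≤m j (toℕ l))))

degree-induction : ∀ A → (∀ n → VanishesBelow n A → ∀ i j → i ℕ.+ j ≡ n → A i j ≡ 0ℚ) → A ≈ P.0#
degree-induction A step i j = below (suc (i ℕ.+ j)) i j ℕₚ.≤-refl
  where
  below : ∀ n → VanishesBelow n A
  below (suc n) i j (s≤s i+j≤n) with ℕₚ.m≤n⇒m<n∨m≡n i+j≤n
  ... | inj₁ i+j<n = below n i j i+j<n
  ... | inj₂ i+j≡n = step n (below n) i j i+j≡n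

cancel-1- : ∀ A → A 0 0 ≡ 0ℚ → ∀ X → (P.1# - A) · X ≈ P.0# → X ≈ P.0#
cancel-1- A A₀₀ X e = degree-induction X λ n v i j i+j≡n → begin
  X i j                                            ≡⟨ x-y+y≡x (X i j) ((A · X) i j) ⟨
  (X i j ℚ.- (A · X) i j) ℚ.+ (A · X) i j
    ≡⟨ ≡.cong (λ x → (x ℚ.- (A · X) i j) ℚ.+ (A · X) i j) (const-· X i j) ⟨
  ((const 1ℚ · X) i j ℚ.- (A · X) i j) ℚ.+ (A · X) i j
    ≡⟨ ≡.cong₂ ℚ._+_ (≡.trans (≡.sym (·-distribʳ-- (const 1ℚ) A X i j)) (e i j))
                    (·-vanishes A X A₀₀ v i j i+j≡n) ⟩
  0ℚ                                               ∎
  where open ≡.≡-Reasoning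

module _ (d p q r : PowerSeries)
  (p₀₀ : p 0 0 ≡ 0ℚ) (q₀₀ : q 0 0 ≡ 0ℚ) (r₀₀ : r 0 0 ≡ 0ℚ)
  (d₀₁ : d 0 1 ≡ 0ℚ) (d₁₀ : d 1 0 ≡ 0ℚ)
  (equation : Dx d + Dy d ≈ d + (p · Dx d + q · Dy d + r · d))
  where

  -- In degree n the equation becomes n d = d. This forces d = 0 except at n = 1, where the
  -- coefficients `d₀₁` and `d₁₀` decide.
  unique-degree≥2 : d ≈ P.0#
  unique-degree≥2 = degree-induction d λ n v i j i+j≡n →
    at n i j i+j≡n (begin
      natℚ n ℚ.* d i j                        ≡⟨ ≡.cong (λ n → natℚ n ℚ.* d i j) i+j≡n ⟨
      natℚ (i ℕ.+ j) ℚ.* d i j                ≡⟨ degree d i j ⟨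
      (Dx d + Dy d) i j                       ≡⟨ equation i j ⟩
      d i j ℚ.+ ((p · Dx d) i j ℚ.+ (q · Dy d) i j ℚ.+ (r · d) i j)
        ≡⟨ ≡.cong (d i j ℚ.+_) (≡.cong₂ ℚ._+_ (≡.cong₂ ℚ._+_
             (·-vanishes p (Dx d) p₀₀ (Dx-vanishes d v) i j i+j≡n)
             (·-vanishes q (Dy d) q₀₀ (Dy-vanishes d v) i j i+j≡n))
             (·-vanishes r d r₀₀ v i j i+j≡n)) ⟩
      d i j ℚ.+ 0ℚ                            ≡⟨ ℚₚ.+-identityʳ (d i j) ⟩
      d i j                                   ∎)
    where
    open ≡.≡-Reasoning
    at : ∀ n i j → i ℕ.+ j ≡ n → natℚ n ℚ.* d i j ≡ d i j → d i j ≡ 0ℚ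
    at zero          i       j       _ e = ≡.trans (≡.sym e) (ℚₚ.*-zeroˡ (d i j))
    at 1             0       1       _ e = d₀₁
    at 1             1       0       _ e = d₁₀
    at (suc (suc n)) i       j       _ e = Reciprocals.nat-cancel ℚ-reciprocals n (begin
      natℚ (suc n) ℚ.* d i j
        ≡⟨ solve 2 (λ n d → n :* d := (con (ℤ.+ 1) :+ n) :* d :- d) ≡.refl (natℚ (suc n)) (d i j) ⟩
      natℚ (suc (suc n)) ℚ.* d i j ℚ.- d i j  ≡⟨ ≡.cong (ℚ._- d i j) e ⟩
      d i j ℚ.- d i j                         ≡⟨ ℚₚ.+-inverseʳ (d i j) ⟩
      0ℚ                                      ∎)
      where open RingSolver ℚ-ring

module _ (a b : PowerSeries) (a₀₀ : a 0 0 ≡ 0ℚ) (b₀₀ : b 0 0 ≡ 0ℚ) where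

  -- In degree n the left side is (n + 1) h and the right side vanishes by induction; as n + 1 is
  -- never 0, even the constant term is determined.
  unique-degree≥0 : ∀ h → (Dx h + Dy h) + h ≈ a · Dy h + Dx h · b → h ≈ P.0#
  unique-degree≥0 h equation = degree-induction h λ n v i j i+j≡n →
    Reciprocals.nat-cancel ℚ-reciprocals n (begin
      natℚ (suc n) ℚ.* h i j
        ≡⟨ solve 2 (λ n h → (con (ℤ.+ 1) :+ n) :* h := n :* h :+ h) ≡.refl (natℚ n) (h i j) ⟩
      natℚ n ℚ.* h i j ℚ.+ h i j
        ≡⟨ ≡.cong (λ n → natℚ n ℚ.* h i j ℚ.+ h i j) i+j≡n ⟨
      natℚ (i ℕ.+ j) ℚ.* h i j ℚ.+ h i j      ≡⟨ ≡.cong (ℚ._+ h i j) (degree h i j) ⟨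
      ((Dx h + Dy h) + h) i j                 ≡⟨ equation i j ⟩
      (a · Dy h) i j ℚ.+ (Dx h · b) i j
        ≡⟨ ≡.cong₂ ℚ._+_ (·-vanishes a (Dy h) a₀₀ (Dy-vanishes h v) i j i+j≡n)
             (≡.trans (P.*-comm (Dx h) b i j) (·-vanishes b (Dx h) b₀₀ (Dx-vanishes h v) i j i+j≡n)) ⟩
      0ℚ                                      ∎)
    where
    open ≡.≡-Reasoning
    open RingSolver ℚ-ring

  -- By induction the equation leaves f + g = 0 in each degree; closedness separates the two in
  -- positive degrees.
  unique-closed-form : ∀ f g → f 0 0 ≡ 0ℚ → g 0 0 ≡ 0ℚ → Dy f ≈ Dx g →
    f + g ≈ a · g + f · b → f ≈ P.0# × g ≈ P.0#
  unique-closed-form f g f₀₀ g₀₀ closed equation =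
    (λ i j → proj₁ (both (suc (i ℕ.+ j))) i j ℕₚ.≤-refl) ,
    (λ i j → proj₂ (both (suc (i ℕ.+ j))) i j ℕₚ.≤-refl)
    where
    open ≡.≡-Reasoning

    step : ∀ i j → VanishesBelow (i ℕ.+ j) f → VanishesBelow (i ℕ.+ j) g → f i j ≡ 0ℚ × g i j ≡ 0ℚ
    step i j vf vg = at i j f+g
      where
      f+g : f i j ℚ.+ g i j ≡ 0ℚ
      f+g = ≡.trans (equation i j) (≡.cong₂ ℚ._+_ (·-vanishes a g a₀₀ vg i j ≡.refl)
        (≡.trans (P.*-comm f b i j) (·-vanishes b f b₀₀ vf i j ≡.refl)))

      -- (i + j) f = i f + j f = i (f + g), as j f = i g by closedness.
      positive : ∀ i j n → i ℕ.+ j ≡ suc n → f i j ℚ.+ g i j ≡ 0ℚ → f i j ≡ 0ℚ × g i j ≡ 0ℚ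
      positive i j n i+j≡ e = f≡0 , ≡.trans (≡.sym (ℚₚ.+-identityˡ (g i j)))
        (≡.trans (≡.cong (ℚ._+ g i j) (≡.sym f≡0)) e)
        where
        f≡0 : f i j ≡ 0ℚ
        f≡0 = Reciprocals.nat-cancel ℚ-reciprocals n (begin
          natℚ (suc n) ℚ.* f i j                        ≡⟨ ≡.cong (λ n → natℚ n ℚ.* f i j) i+j≡ ⟨
          natℚ (i ℕ.+ j) ℚ.* f i j                      ≡⟨ degree f i j ⟨
          Dx f i j ℚ.+ Dy f i j                         ≡⟨ ≡.cong (Dx f i j ℚ.+_) (closed i j) ⟩
          Dx f i j ℚ.+ Dx g i j                         ≡⟨ ℚₚ.*-distribˡ-+ (ℤ.+ i / 1) (f i j) (g i j) ⟨
          (ℤ.+ i / 1) ℚ.* (f i j ℚ.+ g i j)             ≡⟨ zero-*ʳ (ℤ.+ i / 1) e ⟩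
          0ℚ                                            ∎)

      at : ∀ i j → f i j ℚ.+ g i j ≡ 0ℚ → f i j ≡ 0ℚ × g i j ≡ 0ℚ
      at zero zero    _ = f₀₀ , g₀₀
      at zero (suc j) e = positive zero (suc j) j ≡.refl e
      at (suc i) j    e = positive (suc i) j (i ℕ.+ j) ≡.refl e

    both : ∀ n → VanishesBelow n f × VanishesBelow n g
    both zero    = (λ _ _ ()) , (λ _ _ ())
    both (suc n) = (λ i j lt → proj₁ (at-n i j lt)) , (λ i j lt → proj₂ (at-n i j lt))
      where
      at-n : ∀ i j → i ℕ.+ j ℕ.< suc n → f i j ≡ 0ℚ × g i j ≡ 0ℚ
      at-n i j (s≤s i+j≤n) = step i j
        (λ k l lt → proj₁ (both n) k l (ℕₚ.<-≤-trans lt i+j≤n))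
        (λ k l lt → proj₂ (both n) k l (ℕₚ.<-≤-trans lt i+j≤n))

-- Numerals and the final formula.

Dx-Dy-comm : ∀ A → Dx (Dy A) ≈ Dy (Dx A)
Dx-Dy-comm A i j = solve 3 (λ x y a → x :* (y :* a) := y :* (x :* a)) ≡.refl (ℤ.+ i / 1) (ℤ.+ j / 1) (A i j)
  where open RingSolver ℚ-ring

const-scale : ∀ c A i j → (const c · A) i j ≡ c ℚ.* A i j
const-scale c A i j = ≡.trans (·≈⊛ (const c) A i j)
  (≡.trans (Series.⊛-cong ℚ[[y]] {b = A} (λ k l → const≈constant c k l) (λ _ _ → ≡.refl) i j)
    (≡.trans (Series.⊛-constantˡ ℚ[[y]] (Series.constant ℚ-ring c) A i j)
      (Series.⊛-constantˡ ℚ-ring c (A i) j)))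
  where ℚ[[y]] = Series.commutativeRing ℚ-ring

private
  open RingSolver powerSeriesRing using (⟦_⟧ℤ)

  1/24*24 : const (ℤ.+ 1 / 24) · ⟦ ℤ.+ 24 ⟧ℤ ≈ const 1ℚ
  1/24*24 i j = ≡.trans (const-scale (ℤ.+ 1 / 24) ⟦ ℤ.+ 24 ⟧ℤ i j) (at i j)
    where
    at : ∀ i j → (ℤ.+ 1 / 24) ℚ.* ⟦ ℤ.+ 24 ⟧ℤ i j ≡ const 1ℚ i j
    at zero    zero    = ≡.refl
    at zero    (suc j) = ≡.refl
    at (suc i) j       = ≡.refl

  -- The abstract formula has numerals that are sums of ones, whereas `f₂` has constant series; each
  -- coefficient agrees by evaluation.
  numeral₂ : ⟦ ℤ.+ 2 ⟧ℤ ≈ const (ℤ.+ 2 / 1)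
  numeral₂ zero    zero    = ≡.refl
  numeral₂ zero    (suc j) = ≡.refl
  numeral₂ (suc i) j       = ≡.refl

  numeral₃ : ⟦ ℤ.+ 3 ⟧ℤ ≈ const (ℤ.+ 3 / 1)
  numeral₃ zero    zero    = ≡.refl
  numeral₃ zero    (suc j) = ≡.refl
  numeral₃ (suc i) j       = ≡.refl

  numeral₆ : ⟦ ℤ.+ 6 ⟧ℤ ≈ const (ℤ.+ 6 / 1)
  numeral₆ zero    zero    = ≡.refl
  numeral₆ zero    (suc j) = ≡.refl
  numeral₆ (suc i) j       = ≡.refl

  numeral-cong : ∀ k z w {A A′ B B′ C C′} → A ≈ A′ → B ≈ B′ → C ≈ C′ →
    k · ((A + B · w) · z + A · w · (C - w)) ≈
    k · ((A′ + B′ · w) · z + A′ · w · (C′ - w))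
  numeral-cong k z w {A} {A′} {B} {B′} {C} {C′} p q r = P.*-congˡ {k}
    (P.+-cong (P.*-congʳ {z} (P.+-cong p (P.*-congʳ {w} {B} {B′} q)))
      (P.*-cong {A · w} {A′ · w} {C - w} {C′ - w} (P.*-congʳ {w} {A} {A′} p)
        (P.+-congʳ { λ i j → ℚ.- w i j } {C} {C′} r)))

  module Solution = BettiTwo powerSeriesRing eulerˣ eulerʸ (F 0) (F 1) (F 2)

theorem1p2 : F 2 ≈ f₂ Z W
theorem1p2 = P.trans {F 2}
  (Solution.F₂-formula Dx-Dy-comm Betti₀ Betti₁ recurrence₂
    (unique-degree≥2 Solution.d Solution.p Solution.q Solution.r
      -- Evaluation of the constant terms of p, q and r and of the two linear coefficients of d; the
      -- latter vanish because m and w begin in degree 2.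
      ≡.refl ≡.refl ≡.refl ≡.refl ≡.refl)
    (unique-closed-form Tx Ty ≡.refl ≡.refl Solution.f Solution.g ≡.refl ≡.refl)
    (unique-degree≥0 Tx Ty ≡.refl ≡.refl)
    (cancel-1- Tx ≡.refl)
    (cancel-1- Ty ≡.refl)
    (const (ℤ.+ 1 / 24)) 1/[1- W ] 1/24*24 (1/[1-]-inverse W W₀₀≡0))
  (numeral-cong (const (ℤ.+ 1 / 24) · W ^ 2 · 1/[1- W ] ^ 3) Z W numeral₂ numeral₃ numeral₆)
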